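{- Let $n$ be a positive integer, let $G = \mathbf{F}_2^n$, and suppose that $X^0_1, X^0_2$ are $G$-valued random variables. Then there is some subgroup $H \leq G$ such that \[ \operatorname{d}[X^0_1; U_H] + \operatorname{d}[X^0_2; U_H] \leq 11 \operatorname{d}[X^0_1; X^0_2], \] where $U_H$ denotes the uniform distribution on $H$. Furthermore, (for this $H$) both $\operatorname{d}[X^0_1; U_H]$ and $\operatorname{d}[X^0_2; U_H]$ are at most $6 \operatorname{d}[X^0_1; X^0_2]$.
   Context: For a finitely supported random variable $X$ with probability mass function $p_X$, the Shannon entropy is $\mathbf{H}[X] = \sum_{x : p_X(x)>0} p_X(x) \log \frac{1}{p_X(x)}$ (natural logarithm). If $X, Y$ are finitely supported random variables taking values in an abelian group, the entropic Ruzsa distance is \[ \operatorname{d}[X;Y] := \mathbf{H}[X'-Y'] - \tfrac12 \mathbf{H}[X'] - \tfrac12 \mathbf{H}[Y'], \] where $X',Y'$ are independent copies of $X,Y$. It depends only on the individual distributions of $X$ and $Y$; $X,Y$ need not be independent nor defined on a common sample space. -}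

module Defs where

open import Algebra.Bundles using (AbelianGroup; CommutativeRing)
import Algebra.Structures
import Algebra.Properties.Ring as RingProperties
open import Data.Bool.Base using (Bool; true; false; _xor_)
open import Data.Bool.Properties
  using (xor-assoc; xor-comm; xor-identityˡ; xor-identityʳ; xor-same)
  renaming (_≟_ to _≟ᵇ_)
open import Data.List.Base
  using (List; []; _∷_; _++_; length; filter; map; cartesianProductWith)
open import Data.List.Membership.Propositional using (_∈_)
open import Data.List.Membership.Propositional.Properties
  using (∈-cartesianProductWith⁺; ∈-filter⁺)
open import Data.List.Relation.Unary.Any using (here; there)
open import Data.List.Relation.Unary.Linked using (Linked; [-]; _∷_)
open import Data.Nat.Base using (ℕ; zero; suc)
open import Data.Product.Base using (∃; _×_; _,_; proj₁; proj₂)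
open import Data.Sum.Base using (inj₁; inj₂)
open import Data.Vec.Base using (Vec; []; _∷_; zipWith; replicate)
open import Data.Vec.Properties
  using (≡-dec; zipWith-assoc; zipWith-comm; zipWith-identityˡ; zipWith-identityʳ)
open import Function.Base using (id)
open import Level using (0ℓ) renaming (suc to lsuc)
open import Relation.Binary.Core using (Rel)
open import Relation.Binary.Structures using (IsDecTotalOrder)
open import Relation.Binary.PropositionalEquality
  using (_≡_; refl; cong; cong₂; isEquivalence)
open import Relation.Nullary using (¬_; yes; no; contradiction)
open import Relation.Unary using (Pred; Decidable)

------------------------------------------------------------------------
-- The real numbers

-- The standard library has no real numbers.  They enter as an arbitrary
-- Dedekind-complete ordered field, which classically determines them up to
-- unique isomorphism.  The order is decidable, as it is classically.

record CompleteOrderedField : Set (lsuc 0ℓ) where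
  infix 4 _≤_
  field
    commutativeRing : CommutativeRing 0ℓ 0ℓ

  open CommutativeRing commutativeRing public

  field
    _≤_             : Rel Carrier 0ℓ
    isDecTotalOrder : IsDecTotalOrder _≈_ _≤_

  UpperBound : Pred Carrier 0ℓ → Pred Carrier 0ℓ
  UpperBound P u = ∀ x → P x → x ≤ u

  LeastUpperBound : Pred Carrier 0ℓ → Pred Carrier 0ℓ
  LeastUpperBound P s = UpperBound P s × (∀ u → UpperBound P u → s ≤ u)

  field
    0≉1      : ¬ (0# ≈ 1#)
    inverse  : ∀ x → ¬ (x ≈ 0#) → ∃ λ y → x * y ≈ 1#
    +-monoʳ  : ∀ x {y z} → y ≤ z → x + y ≤ x + z
    *-pos    : ∀ {x y} → 0# ≤ x → 0# ≤ y → 0# ≤ x * y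
    complete : ∀ P → ∃ P → ∃ (UpperBound P) → ∃ (LeastUpperBound P)

------------------------------------------------------------------------
-- The group F₂ⁿ

-- F₂ is Bool with addition _xor_, so every vector is its own negative.
F₂^_ : ℕ → AbelianGroup 0ℓ 0ℓ
F₂^ n = record
  { Carrier = Vec Bool n
  ; _≈_     = _≡_
  ; _∙_     = zipWith _xor_
  ; ε       = replicate n false
  ; _⁻¹     = id
  ; isAbelianGroup = record
    { isGroup = record
      { isMonoid = record
        { isSemigroup = record
          { isMagma = record { isEquivalence = isEquivalence ; ∙-cong = cong₂ _ }
          ; assoc   = zipWith-assoc xor-assoc
          }
        ; identity = zipWith-identityˡ xor-identityˡ , zipWith-identityʳ xor-identityʳ
        }
      ; inverse = self-inverse , self-inverse
      ; ⁻¹-cong = cong id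
      }
    ; comm = zipWith-comm xor-comm
    }
  }
  where
  self-inverse : ∀ {m} (x : Vec Bool m) → zipWith _xor_ x x ≡ replicate m false
  self-inverse []      = refl
  self-inverse (b ∷ x) = cong₂ _∷_ (xor-same b) (self-inverse x)

-- Every element of F₂ⁿ, listed exactly once.
elements : ∀ n → List (Vec Bool n)
elements zero    = [] ∷ []
elements (suc n) = cartesianProductWith _∷_ (false ∷ true ∷ []) (elements n)

∈-elements : ∀ {n} (x : Vec Bool n) → x ∈ elements n
∈-elements []      = here refl
∈-elements (b ∷ x) = ∈-cartesianProductWith⁺ _∷_ (∈-bools b) (∈-elements x)
  where
  ∈-bools : ∀ b → b ∈ false ∷ true ∷ []
  ∈-bools false = here refl
  ∈-bools true  = there (here refl)

-- Classically every predicate is decidable, so requiring decidability does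
-- not restrict which subgroups are allowed.
record Subgroup (G : AbelianGroup 0ℓ 0ℓ) : Set (lsuc 0ℓ) where
  open AbelianGroup G
  field
    member    : Pred Carrier 0ℓ
    member?   : Decidable member
    ε-closed  : member ε
    ∙-closed  : ∀ {x y} → member x → member y → member (x ∙ y)
    ⁻¹-closed : ∀ {x} → member x → member (x ⁻¹)
    resp-≈    : ∀ {x y} → x ≈ y → member x → member y

order : ∀ {n} → Subgroup (F₂^ n) → ℕ
order {n} H = length (filter (Subgroup.member? H) (elements n))

module OverReals (ℝ : CompleteOrderedField) where
  open CompleteOrderedField ℝ
    renaming (refl to ≈-refl; sym to ≈-sym; trans to ≈-trans)
  open IsDecTotalOrder isDecTotalOrder
    using (_≤?_; antisym; total; ≤-respˡ-≈; ≤-respʳ-≈)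
    renaming (_≟_ to _≟ʳ_; refl to ≤-refl; trans to ≤-trans; reflexive to ≤-reflexive)
  open RingProperties ring using (-‿distribʳ-*; -‿distribˡ-*; -‿involutive)
  import Relation.Binary.Reasoning.Setoid setoid as ≈-Reasoning

  infix 4 _<_
  _<_ : Rel Carrier 0ℓ
  x < y = ¬ (y ≤ x)

  fromℕ : ℕ → Carrier
  fromℕ zero    = 0#
  fromℕ (suc k) = 1# + fromℕ k

  -- Totalised by 0⁻¹ = 0.
  infix 8 _⁻¹
  _⁻¹ : Carrier → Carrier
  x ⁻¹ with x ≟ʳ 0#
  ... | yes _   = 0#
  ... | no  x≉0 = proj₁ (inverse x x≉0)

  ½ : Carrier
  ½ = fromℕ 2 ⁻¹

  ----------------------------------------------------------------------
  -- Facts about the field used in the definitions below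

  <⇒≤ : ∀ {x y} → x < y → x ≤ y
  <⇒≤ {x} {y} x<y with total x y
  ... | inj₁ x≤y = x≤y
  ... | inj₂ y≤x = contradiction y≤x x<y

  <-≤-trans : ∀ {x y z} → x < y → y ≤ z → x < z
  <-≤-trans x<y y≤z z≤x = x<y (≤-trans y≤z z≤x)

  >⇒≉ : ∀ {x} → 0# < x → ¬ (x ≈ 0#)
  >⇒≉ 0<x x≈0 = 0<x (≤-reflexive x≈0)

  ⁻¹-inverseʳ : ∀ {x} → ¬ (x ≈ 0#) → x * x ⁻¹ ≈ 1#
  ⁻¹-inverseʳ {x} x≉0 with x ≟ʳ 0#
  ... | yes x≈0 = contradiction x≈0 x≉0
  ... | no  x≉0 = proj₂ (inverse x x≉0)

  +-mono : ∀ {w x y z} → w ≤ x → y ≤ z → w + y ≤ x + z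
  +-mono {w} {x} {y} {z} w≤x y≤z = ≤-trans (+-monoʳ w y≤z)
    (≤-respˡ-≈ (+-comm z w) (≤-respʳ-≈ (+-comm z x) (+-monoʳ z w≤x)))

  x≤y⇒0≤y-x : ∀ {x y} → x ≤ y → 0# ≤ y - x
  x≤y⇒0≤y-x {x} {y} x≤y =
    ≤-respˡ-≈ (-‿inverseˡ x) (≤-respʳ-≈ (+-comm (- x) y) (+-monoʳ (- x) x≤y))

  y-x+x≈y : ∀ x y → (y - x) + x ≈ y
  y-x+x≈y x y = ≈-trans (+-assoc y (- x) x)
    (≈-trans (+-congˡ (-‿inverseˡ x)) (+-identityʳ y))

  0≤y-x⇒x≤y : ∀ {x y} → 0# ≤ y - x → x ≤ y
  0≤y-x⇒x≤y {x} {y} h =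
    ≤-respˡ-≈ (+-identityˡ x) (≤-respʳ-≈ (y-x+x≈y x y) (+-mono h ≤-refl))

  *-monoˡ : ∀ {x y z} → 0# ≤ x → y ≤ z → x * y ≤ x * z
  *-monoˡ {x} {y} {z} 0≤x y≤z = 0≤y-x⇒x≤y
    (≤-respʳ-≈ (≈-trans (distribˡ x z (- y)) (+-congˡ (≈-sym (-‿distribʳ-* x y))))
      (*-pos 0≤x (x≤y⇒0≤y-x y≤z)))

  0<1 : 0# < 1#
  0<1 1≤0 = 0≉1 (antisym 0≤1 1≤0)
    where
    0≤-1 : 0# ≤ - 1#
    0≤-1 = ≤-respʳ-≈ (+-identityˡ (- 1#)) (x≤y⇒0≤y-x 1≤0)
    0≤1 : 0# ≤ 1#
    0≤1 = ≤-respʳ-≈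
      (≈-trans (≈-sym (-‿distribˡ-* 1# (- 1#)))
        (≈-trans (-‿cong (*-identityˡ (- 1#))) (-‿involutive 1#)))
      (*-pos 0≤-1 0≤-1)

  ⁻¹-nonNeg : ∀ {x} → 0# < x → 0# ≤ x ⁻¹
  ⁻¹-nonNeg {x} 0<x with total 0# (x ⁻¹)
  ... | inj₁ 0≤x⁻¹ = 0≤x⁻¹
  ... | inj₂ x⁻¹≤0 = contradiction
    (≤-respˡ-≈ (⁻¹-inverseʳ (>⇒≉ 0<x)) (≤-respʳ-≈ (zeroʳ x) (*-monoˡ (<⇒≤ 0<x) x⁻¹≤0)))
    0<1

  ⁻¹-antitone : ∀ {x y} → 0# < x → x ≤ y → y ⁻¹ ≤ x ⁻¹
  ⁻¹-antitone {x} {y} 0<x x≤y =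
    ≤-respˡ-≈ lhs (≤-respʳ-≈ rhs
      (*-monoˡ (*-pos (⁻¹-nonNeg 0<y) (⁻¹-nonNeg 0<x)) x≤y))
    where
    0<y = <-≤-trans 0<x x≤y
    open ≈-Reasoning
    lhs : (y ⁻¹ * x ⁻¹) * x ≈ y ⁻¹
    lhs = begin
      (y ⁻¹ * x ⁻¹) * x  ≈⟨ *-assoc _ _ _ ⟩
      y ⁻¹ * (x ⁻¹ * x)  ≈⟨ *-congˡ (≈-trans (*-comm _ _) (⁻¹-inverseʳ (>⇒≉ 0<x))) ⟩
      y ⁻¹ * 1#          ≈⟨ *-identityʳ _ ⟩
      y ⁻¹               ∎
    rhs : (y ⁻¹ * x ⁻¹) * y ≈ x ⁻¹
    rhs = begin
      (y ⁻¹ * x ⁻¹) * y  ≈⟨ *-comm _ _ ⟩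
      y * (y ⁻¹ * x ⁻¹)  ≈⟨ *-assoc _ _ _ ⟨
      (y * y ⁻¹) * x ⁻¹  ≈⟨ *-congʳ (⁻¹-inverseʳ (>⇒≉ 0<y)) ⟩
      1# * x ⁻¹          ≈⟨ *-identityˡ _ ⟩
      x ⁻¹               ∎

  fromℕ-nonNeg : ∀ k → 0# ≤ fromℕ k
  fromℕ-nonNeg zero    = ≤-refl
  fromℕ-nonNeg (suc k) =
    ≤-respˡ-≈ (+-identityˡ 0#) (+-mono (<⇒≤ 0<1) (fromℕ-nonNeg k))

  fromℕ-suc-pos : ∀ k → 0# < fromℕ (suc k)
  fromℕ-suc-pos k = <-≤-trans 0<1
    (≤-respˡ-≈ (+-identityʳ 1#) (+-monoʳ 1# (fromℕ-nonNeg k)))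

  ----------------------------------------------------------------------
  -- The natural logarithm, log x = ∫₁ˣ dt / t

  -- The lower Darboux sum of t ↦ 1/t over an increasing list of points: on
  -- [s , t] the infimum is attained at the right endpoint.
  lowerSum : List Carrier → Carrier
  lowerSum []           = 0#
  lowerSum (s ∷ [])     = 0#
  lowerSum (s ∷ t ∷ ts) = (t - s) * t ⁻¹ + lowerSum (t ∷ ts)

  IsLowerSum : Carrier → Carrier → Pred Carrier 0ℓ
  IsLowerSum a b σ = ∃ λ ts →
    Linked _≤_ (a ∷ ts ++ b ∷ []) × σ ≈ lowerSum (a ∷ ts ++ b ∷ [])

  lowerSum-bound : ∀ {a} → 0# < a → ∀ s ts b → a ≤ s →
                   Linked _≤_ (s ∷ ts ++ b ∷ []) →
                   lowerSum (s ∷ ts ++ b ∷ []) ≤ (b - s) * a ⁻¹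
  lowerSum-bound {a} 0<a s [] b a≤s (s≤b ∷ _) = ≤-respˡ-≈ (≈-sym (+-identityʳ _))
    (*-monoˡ (x≤y⇒0≤y-x s≤b) (⁻¹-antitone 0<a (≤-trans a≤s s≤b)))
  lowerSum-bound {a} 0<a s (t ∷ ts) b a≤s (s≤t ∷ t≤ts) =
    ≤-respʳ-≈ telescope
      (+-mono (*-monoˡ (x≤y⇒0≤y-x s≤t) (⁻¹-antitone 0<a a≤t))
              (lowerSum-bound 0<a t ts b a≤t t≤ts))
    where
    a≤t = ≤-trans a≤s s≤t
    open ≈-Reasoning
    telescope : (t - s) * a ⁻¹ + (b - t) * a ⁻¹ ≈ (b - s) * a ⁻¹
    telescope = begin
      (t - s) * a ⁻¹ + (b - t) * a ⁻¹  ≈⟨ distribʳ _ _ _ ⟨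
      ((t - s) + (b - t)) * a ⁻¹       ≈⟨ *-congʳ (+-comm _ _) ⟩
      ((b - t) + (t - s)) * a ⁻¹       ≈⟨ *-congʳ (+-assoc _ _ _) ⟨
      (((b - t) + t) - s) * a ⁻¹       ≈⟨ *-congʳ (+-congʳ (y-x+x≈y t b)) ⟩
      (b - s) * a ⁻¹                   ∎

  -- ∫ₐᵇ dt / t for 0 < a ≤ b.
  integral : ∀ a b → 0# < a → a ≤ b → Carrier
  integral a b 0<a a≤b = proj₁ (complete (IsLowerSum a b)
    (_ , [] , a≤b ∷ [-] , ≈-refl)
    ((b - a) * a ⁻¹ , λ { σ (ts , linked , σ≈) →
      ≤-respˡ-≈ (≈-sym σ≈) (lowerSum-bound 0<a a ts b ≤-refl linked) }))

  -- Totalised by log x = 0 for x ≤ 0.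
  log : Carrier → Carrier
  log x with x ≤? 0# | total 1# x
  ... | yes _  | _        = 0#
  ... | no 0<x | inj₁ 1≤x = integral 1# x 0<1 1≤x
  ... | no 0<x | inj₂ x≤1 = - integral x 1# 0<x x≤1

  ----------------------------------------------------------------------
  -- Random variables and entropy

  sum : List Carrier → Carrier
  sum []       = 0#
  sum (x ∷ xs) = x + sum xs

  Σ[_] : ∀ n → (Vec Bool n → Carrier) → Carrier
  Σ[ n ] f = sum (map f (elements n))

  -- A random variable with values in F₂ⁿ is given by its probability mass
  -- function: entropy and Ruzsa distance depend only on the distribution.
  record RandomVariable (n : ℕ) : Set where
    field
      pmf        : Vec Bool n → Carrier
      nonNeg     : ∀ x → 0# ≤ pmf x
      normalised : Σ[ n ] pmf ≈ 1#

  open RandomVariable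

  entropyTerm : Carrier → Carrier
  entropyTerm p with p ≤? 0#
  ... | yes _ = 0#
  ... | no  _ = p * log (p ⁻¹)

  entropy : ∀ {n} → (Vec Bool n → Carrier) → Carrier
  entropy {n} p = Σ[ n ] (λ x → entropyTerm (p x))

  𝐇[_] : ∀ {n} → RandomVariable n → Carrier
  𝐇[ X ] = entropy (pmf X)

  -- The mass function of X′ - Y′ for independent copies X′, Y′ of X, Y: the
  -- push-forward of the product distribution along subtraction.
  differencePmf : ∀ {n} → RandomVariable n → RandomVariable n → Vec Bool n → Carrier
  differencePmf {n} X Y z = Σ[ n ] λ x → Σ[ n ] λ y → mass x y
    where
    open Algebra.Structures.IsAbelianGroup (AbelianGroup.isAbelianGroup (F₂^ n))
      using () renaming (_-_ to _-ᴳ_)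
    mass : Vec Bool n → Vec Bool n → Carrier
    mass x y with ≡-dec _≟ᵇ_ (x -ᴳ y) z
    ... | yes _ = pmf X x * pmf Y y
    ... | no  _ = 0#

  d[_⨾_] : ∀ {n} → RandomVariable n → RandomVariable n → Carrier
  d[ X ⨾ Y ] = entropy (differencePmf X Y) - ½ * 𝐇[ X ] - ½ * 𝐇[ Y ]

  ----------------------------------------------------------------------
  -- The uniform distribution on a subgroup

  module _ {n : ℕ} (H : Subgroup (F₂^ n)) where
    open Subgroup H
    uniformPmf : Vec Bool n → Carrier
    uniformPmf x with member? x
    ... | yes _ = fromℕ (order H) ⁻¹
    ... | no  _ = 0#

    private
      c : Carrier
      c = fromℕ (order H) ⁻¹

      order-pos : 0# < fromℕ (order H)
      order-pos = go (∈-filter⁺ member? (∈-elements (AbelianGroup.ε (F₂^ n))) ε-closed)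
        where
        go : ∀ {x} {xs : List (Vec Bool n)} → x ∈ xs → 0# < fromℕ (length xs)
        go {xs = _ ∷ xs} _ = fromℕ-suc-pos (length xs)

      uniform-nonNeg : ∀ x → 0# ≤ uniformPmf x
      uniform-nonNeg x with member? x
      ... | yes _ = ⁻¹-nonNeg order-pos
      ... | no  _ = ≤-refl

      uniform-sum : ∀ xs → sum (map uniformPmf xs) ≈ fromℕ (length (filter member? xs)) * c
      uniform-sum []       = ≈-sym (zeroˡ c)
      uniform-sum (x ∷ xs) with member? x
      ... | yes _ = ≈-trans (+-cong (≈-sym (*-identityˡ c)) (uniform-sum xs))
                            (≈-sym (distribʳ c 1# _))
      ... | no  _ = ≈-trans (+-identityˡ _) (uniform-sum xs)

    U : RandomVariable n
    U = record
      { pmf        = uniformPmf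
      ; nonNeg     = uniform-nonNeg
      ; normalised = ≈-trans (uniform-sum (elements n)) (⁻¹-inverseʳ (>⇒≉ order-pos))
      }

-- The entropic argument of Gowers, Green, Manners and Tao. Put η = 1/9 and let
-- τ[X ; Y] = d[X ; Y] + η d[X₁⁰ ; X] + η d[X₂⁰ ; Y]. Let (X , Y) be a pair for which τ is
-- within ε of its infimum, let X′, Y′ be further independent copies, and put U = X + Y,
-- V = X′ + Y, W = X + X′ and S = X + X′ + Y + Y′. Comparing τ[X ; Y] with τ at pairs of
-- sums and of conditioned variables bounds the mutual informations of U, V and W given
-- S. Since U + V + W = 0, the entropic Balog–Szemerédi–Gowers lemma turns them into a
-- further competitor of (X , Y), and together these inequalities force d[X ; Y] = O(ε).
--
-- When d[X ; Y] is tiny, the atoms of X of non-negligible mass form a coset of a subgroup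
-- H and d[X ; U_H] is small, by a bound which may depend on n. Comparison of τ[X ; Y] with
-- τ[X₂⁰ ; X₁⁰] then gives d[X₁⁰ ; U_H] + d[X₂⁰ ; U_H] ≤ 11 d[X₁⁰ ; X₂⁰] + o(1). As there are
-- finitely many subgroups, the error can be dropped, and no compactness is needed.

module Submission where

open import Data.Bool.Base using (Bool; true; false; not; _∧_; _xor_; if_then_else_)
import Data.Bool.Properties as Bool
open import Data.Empty using (⊥; ⊥-elim)
open import Data.Fin.Base using (Fin; zero; suc; toℕ)
open import Data.List.Base using (List; _++_; map; length; cartesianProductWith)
open import Data.List.Membership.Propositional using (_∈_)
open import Data.List.Membership.Propositional.Properties using (∈-filter⁺; ∈-cartesianProductWith⁺)
import Data.List.Properties as ListProperties
import Data.List.Relation.Unary.All as All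
open import Data.List.Relation.Unary.Any as Any using (Any; here; there)
open import Data.List.Relation.Unary.Linked using (Linked)
open import Data.Nat.Base as ℕ using (ℕ; zero; suc; NonZero)
import Data.Nat.Properties as ℕ
open import Data.Product.Base using (∃; _×_; _,_; proj₁; proj₂)
open import Data.Sum.Base using (_⊎_; inj₁; inj₂; [_,_]′)
open import Data.Unit.Base using (⊤; tt)
open import Data.Vec.Base as Vec using (Vec; []; _∷_; lookup; allFin; zipWith; replicate)
open import Data.Vec.N-ary using (N-ary; ∀ⁿ; _$ⁿ_; curryⁿ)
import Data.Vec.Properties as Vec
import Data.Vec.Relation.Unary.All as Allᵛ
open import Function.Base using (_∘_; it)
open import Level using (0ℓ)
open import Relation.Binary.Definitions using (DecidableEquality)
open import Relation.Binary.PropositionalEquality as ≡ using (_≡_; refl)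
open import Relation.Binary.Structures using (IsDecTotalOrder)
open import Relation.Nullary using (¬_; Dec; yes; no; contradiction; does)
open import Relation.Nullary.Decidable using (True; toWitness; dec-true; map′; _×-dec_; _→-dec_)
open import Relation.Unary using (Pred; Decidable)
open import Defs

-- Random variables are F₂-linear forms in the coordinates of a tuple of
-- elements of F₂ⁿ; a form is the vector of its coefficients.

-- The constant 11 is 1/η + 2, because at the pair (X₂⁰ , X₁⁰) all three distances in τ equal
-- d[X₁⁰ ; X₂⁰]; the constant 6 is (11 + 1)/2, by the triangle inequality. Distances are doubled and
-- `τ` is multiplied by 18, so that all coefficients are integers. The entropies in the argument are
-- those of families of F₂-linear forms. That two families carry the same information is a question
-- about spans, decided by computation, and the inequalities are integer combinations whose
-- multipliers are checked by `linear`. A tiny d[X ; Y] forces a coset because, with p the mass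
-- function of X and r that of X + X′, the difference H[X + X′] - H[X] is a sum of nonnegative
-- terms, equal to p(x) p(y) (t - 1 - log t) with t = r(x + y)/p(x) where p(x) and p(y) are
-- positive. If the sum is tiny, t is close to 1 or larger at all pairs of heavy points. The error
-- is dropped by contradiction: either some subgroup meets the bound, or all of them miss it by a
-- common γ > 0, and then ε is chosen from γ and the size of the group.

infixl 6 _⊕_
_⊕_ : ∀ {m} → Vec Bool m → Vec Bool m → Vec Bool m
_⊕_ = zipWith _xor_

𝟎 : ∀ {m} → Vec Bool m
𝟎 = replicate _ false

⊕-assoc : ∀ {m} (x y z : Vec Bool m) → (x ⊕ y) ⊕ z ≡ x ⊕ (y ⊕ z)
⊕-assoc = Vec.zipWith-assoc Bool.xor-assoc

⊕-comm : ∀ {m} (x y : Vec Bool m) → x ⊕ y ≡ y ⊕ x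
⊕-comm = Vec.zipWith-comm Bool.xor-comm

⊕-identityˡ : ∀ {m} (x : Vec Bool m) → 𝟎 ⊕ x ≡ x
⊕-identityˡ = Vec.zipWith-identityˡ Bool.xor-identityˡ

⊕-identityʳ : ∀ {m} (x : Vec Bool m) → x ⊕ 𝟎 ≡ x
⊕-identityʳ = Vec.zipWith-identityʳ Bool.xor-identityʳ

⊕-same : ∀ {m} (x : Vec Bool m) → x ⊕ x ≡ 𝟎
⊕-same []      = refl
⊕-same (b ∷ x) = ≡.cong₂ _∷_ (Bool.xor-same b) (⊕-same x)

⊕-cancelˡ : ∀ {m} (x y : Vec Bool m) → x ⊕ (x ⊕ y) ≡ y
⊕-cancelˡ x y = ≡.trans (≡.sym (⊕-assoc x x y))
  (≡.trans (≡.cong (_⊕ y) (⊕-same x)) (⊕-identityˡ y))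

⊕-cancelʳ : ∀ {m} (x y : Vec Bool m) → (x ⊕ y) ⊕ y ≡ x
⊕-cancelʳ x y = ≡.trans (⊕-assoc x y y)
  (≡.trans (≡.cong (x ⊕_) (⊕-same y)) (⊕-identityʳ x))

⊕-swap : ∀ {m} {x y z : Vec Bool m} → x ⊕ y ≡ z → y ≡ x ⊕ z
⊕-swap {x = x} {y} refl = ≡.sym (⊕-cancelˡ x y)

Form : ℕ → Set
Form = Vec Bool

-- A form is itself a Boolean vector, so this serves both to evaluate a form at a tuple and to
-- substitute forms into a form; `⟨⟨⟩⟩` says that the two uses are compatible.
⟨_,_⟩ : ∀ {r m} → Form r → Vec (Vec Bool m) r → Vec Bool m
⟨ []        , []    ⟩ = 𝟎
⟨ true  ∷ a , x ∷ ω ⟩ = x ⊕ ⟨ a , ω ⟩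
⟨ false ∷ a , x ∷ ω ⟩ = ⟨ a , ω ⟩

evalAll : ∀ {r s m} → Vec (Form r) s → Vec (Vec Bool m) r → Vec (Vec Bool m) s
evalAll []      ω = []
evalAll (a ∷ A) ω = ⟨ a , ω ⟩ ∷ evalAll A ω

⟨𝟎⟩ : ∀ {r m} (ω : Vec (Vec Bool m) r) → ⟨ 𝟎 , ω ⟩ ≡ 𝟎
⟨𝟎⟩ []      = refl
⟨𝟎⟩ (x ∷ ω) = ⟨𝟎⟩ ω

⟨⊕⟩ : ∀ {r m} (a b : Form r) (ω : Vec (Vec Bool m) r) → ⟨ a ⊕ b , ω ⟩ ≡ ⟨ a , ω ⟩ ⊕ ⟨ b , ω ⟩
⟨⊕⟩ []          []          []      = ≡.sym (⊕-same 𝟎)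
⟨⊕⟩ (false ∷ a) (false ∷ b) (x ∷ ω) = ⟨⊕⟩ a b ω
⟨⊕⟩ (true ∷ a)  (false ∷ b) (x ∷ ω) = ≡.trans (≡.cong (x ⊕_) (⟨⊕⟩ a b ω)) (≡.sym (⊕-assoc x _ _))
⟨⊕⟩ (false ∷ a) (true ∷ b)  (x ∷ ω) = begin
  x ⊕ ⟨ a ⊕ b , ω ⟩            ≡⟨ ≡.cong (x ⊕_) (⟨⊕⟩ a b ω) ⟩
  x ⊕ (⟨ a , ω ⟩ ⊕ ⟨ b , ω ⟩)  ≡⟨ ⊕-assoc x _ _ ⟨
  (x ⊕ ⟨ a , ω ⟩) ⊕ ⟨ b , ω ⟩  ≡⟨ ≡.cong (_⊕ ⟨ b , ω ⟩) (⊕-comm x _) ⟩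
  (⟨ a , ω ⟩ ⊕ x) ⊕ ⟨ b , ω ⟩  ≡⟨ ⊕-assoc _ x _ ⟩
  ⟨ a , ω ⟩ ⊕ (x ⊕ ⟨ b , ω ⟩)  ∎
  where open ≡.≡-Reasoning
⟨⊕⟩ (true ∷ a)  (true ∷ b)  (x ∷ ω) = begin
  ⟨ a ⊕ b , ω ⟩                      ≡⟨ ⟨⊕⟩ a b ω ⟩
  ⟨ a , ω ⟩ ⊕ ⟨ b , ω ⟩              ≡⟨ ≡.cong (⟨ a , ω ⟩ ⊕_) (⊕-cancelˡ x _) ⟨
  ⟨ a , ω ⟩ ⊕ (x ⊕ (x ⊕ ⟨ b , ω ⟩))  ≡⟨ ⊕-assoc _ x _ ⟨
  (⟨ a , ω ⟩ ⊕ x) ⊕ (x ⊕ ⟨ b , ω ⟩)  ≡⟨ ≡.cong (_⊕ (x ⊕ ⟨ b , ω ⟩)) (⊕-comm _ x) ⟩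
  (x ⊕ ⟨ a , ω ⟩) ⊕ (x ⊕ ⟨ b , ω ⟩)  ∎
  where open ≡.≡-Reasoning

⟨⟨⟩⟩ : ∀ {r s m} (c : Form s) (A : Vec (Form r) s) (ω : Vec (Vec Bool m) r) →
       ⟨ ⟨ c , A ⟩ , ω ⟩ ≡ ⟨ c , evalAll A ω ⟩
⟨⟨⟩⟩ []          []      ω = ⟨𝟎⟩ ω
⟨⟨⟩⟩ (true ∷ c)  (a ∷ A) ω = ≡.trans (⟨⊕⟩ a _ ω) (≡.cong (⟨ a , ω ⟩ ⊕_) (⟨⟨⟩⟩ c A ω))
⟨⟨⟩⟩ (false ∷ c) (a ∷ A) ω = ⟨⟨⟩⟩ c A ω

infix 4 _⊒_ _⊒?_
-- The forms B lie in the span of the forms A.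
_⊒_ : ∀ {r s t} → Vec (Form r) s → Vec (Form r) t → Set
_⊒_ {s = s} A B = Allᵛ.All (λ b → Any (λ c → ⟨ c , A ⟩ ≡ b) (elements s)) B

_⊒?_ : ∀ {r s t} (A : Vec (Form r) s) (B : Vec (Form r) t) → Dec (A ⊒ B)
_⊒?_ {s = s} A B = Allᵛ.all? (λ b → Any.any? (λ c → Vec.≡-dec Bool._≟_ ⟨ c , A ⟩ b) (elements s)) B

module _ where
  open Allᵛ using ([]; _∷_)

  -- Each `b` is a combination of `A`, so its value is the same combination of the values of `A`.
  ⊒-sound : ∀ {r s t m} (A : Vec (Form r) s) (B : Vec (Form r) t) → A ⊒ B →
            ∀ (ω ω′ : Vec (Vec Bool m) r) → evalAll A ω ≡ evalAll A ω′ → evalAll B ω ≡ evalAll B ω′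
  ⊒-sound A []      []       ω ω′ eq = refl
  ⊒-sound A (b ∷ B) (p ∷ ps) ω ω′ eq = ≡.cong₂ _∷_ (via (Any.satisfied p)) (⊒-sound A B ps ω ω′ eq)
    where
    via : (∃ λ c → ⟨ c , A ⟩ ≡ b) → ⟨ b , ω ⟩ ≡ ⟨ b , ω′ ⟩
    via (c , refl) = ≡.trans (⟨⟨⟩⟩ c A ω) (≡.trans (≡.cong ⟨ c ,_⟩ eq) (≡.sym (⟨⟨⟩⟩ c A ω′)))

Agree : ∀ {A : Set} {r} → Vec Bool r → Vec A r → Vec A r → Set
Agree []          []      []        = ⊤
Agree (true  ∷ t) (x ∷ ω) (x′ ∷ ω′) = x ≡ x′ × Agree t ω ω′
Agree (false ∷ t) (x ∷ ω) (x′ ∷ ω′) = Agree t ω ω′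

agree-refl : ∀ {A : Set} {r} (t : Vec Bool r) (ω : Vec A r) → Agree t ω ω
agree-refl []          []      = tt
agree-refl (true  ∷ t) (x ∷ ω) = refl , agree-refl t ω
agree-refl (false ∷ t) (x ∷ ω) = agree-refl t ω

-- The equation `masked t A ≡ A` states that `A` involves only the coordinates selected by `t`; for
-- concrete forms it holds by `refl`.
masked : ∀ {r s} → Vec Bool r → Vec (Form r) s → Vec (Form r) s
masked t = Vec.map (zipWith _∧_ t)

⟨masked⟩ : ∀ {r m} (t : Vec Bool r) (a : Form r) {ω ω′ : Vec (Vec Bool m) r} → Agree t ω ω′ →
           ⟨ zipWith _∧_ t a , ω ⟩ ≡ ⟨ zipWith _∧_ t a , ω′ ⟩
⟨masked⟩ []          []          {[]}    {[]}    _           = refl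
⟨masked⟩ (true  ∷ t) (true  ∷ a) {x ∷ _} {_ ∷ _} (refl , eq) = ≡.cong (x ⊕_) (⟨masked⟩ t a eq)
⟨masked⟩ (true  ∷ t) (false ∷ a) {_ ∷ _} {_ ∷ _} (_ , eq)    = ⟨masked⟩ t a eq
⟨masked⟩ (false ∷ t) (_     ∷ a) {_ ∷ _} {_ ∷ _} eq          = ⟨masked⟩ t a eq

evalAll-masked : ∀ {r s m} (t : Vec Bool r) (A : Vec (Form r) s) → masked t A ≡ A →
                 ∀ {ω ω′ : Vec (Vec Bool m) r} → Agree t ω ω′ → evalAll A ω ≡ evalAll A ω′
evalAll-masked t A masked≡ {ω} {ω′} eq = ≡.subst (λ B → evalAll B ω ≡ evalAll B ω′) masked≡ (go A)
  where
  go : ∀ {s} (A : Vec (Form _) s) → evalAll (masked t A) ω ≡ evalAll (masked t A) ω′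
  go []      = refl
  go (a ∷ A) = ≡.cong₂ _∷_ (⟨masked⟩ t a eq) (go A)

lift : ∀ {r s} → Vec (Form r) s → Vec (Form (suc r)) s
lift = Vec.map (false ∷_)

-- Subgroups as Boolean functions, and their enumeration

record Closed {n : ℕ} (f : Vec Bool n → Bool) : Set where
  constructor closed
  field
    contains-𝟎 : f 𝟎 ≡ true
    contains-⊕ : ∀ x y → f x ≡ true → f y ≡ true → f (x ⊕ y) ≡ true

subgroup : ∀ {n} (f : Vec Bool n → Bool) → Closed f → Subgroup (F₂^ n)
subgroup f f-closed = record
  { member    = λ x → f x ≡ true
  ; member?   = λ x → f x Bool.≟ true
  ; ε-closed  = Closed.contains-𝟎 f-closed
  ; ∙-closed  = Closed.contains-⊕ f-closed _ _
  ; ⁻¹-closed = λ fx → fx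
  ; resp-≈    = λ { refl fx → fx }
  }

branch : ∀ {n} → (Vec Bool n → Bool) → (Vec Bool n → Bool) → Vec Bool (suc n) → Bool
branch f g (false ∷ x) = f x
branch f g (true  ∷ x) = g x

module _ where
  open List using ([]; _∷_)

  functions : ∀ n → List (Vec Bool n → Bool)
  functions zero    = (λ _ → false) ∷ (λ _ → true) ∷ []
  functions (suc n) = cartesianProductWith branch (functions n) (functions n)

  -- A given `f` is exchanged for the listed `g` with the same values, so that a statement about the
  -- finite list covers every subgroup.
  functions-complete : ∀ {n} (f : Vec Bool n → Bool) → ∃ λ g → g ∈ functions n × (∀ x → g x ≡ f x)
  functions-complete {zero}  f with f [] in f[]
  ... | false = _ , here refl , λ { [] → ≡.sym f[] }
  ... | true  = _ , there (here refl) , λ { [] → ≡.sym f[] }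
  functions-complete {suc n} f =
    let (g , g∈ , g≗) = functions-complete (λ x → f (false ∷ x))
        (k , k∈ , k≗) = functions-complete (λ x → f (true ∷ x)) in
    branch g k , ∈-cartesianProductWith⁺ branch g∈ k∈ , λ { (false ∷ x) → g≗ x ; (true ∷ x) → k≗ x }

∀? : ∀ {n} {P : Pred (Vec Bool n) 0ℓ} → Decidable P → Dec (∀ x → P x)
∀? {n} P? = map′ (λ all x → All.lookup all (∈-elements x)) (λ p → All.tabulate λ {x} _ → p x) (All.all? P? (elements n))

closed? : ∀ {n} (f : Vec Bool n → Bool) → Dec (Closed f)
closed? f = map′ (λ (z , s) → closed z s) (λ (closed z s) → z , s)
  ((f 𝟎 Bool.≟ true) ×-dec ∀? λ x → ∀? λ y → (f x Bool.≟ true) →-dec ((f y Bool.≟ true) →-dec (f (x ⊕ y) Bool.≟ true)))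

module PFR (ℝ : CompleteOrderedField) where
  open CompleteOrderedField ℝ renaming (refl to ≈-refl)
  open OverReals ℝ
  open IsDecTotalOrder isDecTotalOrder
    using (_≤?_; antisym; total; ≤-respˡ-≈; ≤-respʳ-≈)
    renaming (_≟_ to _≟ʳ_; refl to ≤-refl; trans to ≤-trans; reflexive to ≤-reflexive)
  open import Algebra.Properties.Ring ring
    using (-‿distribˡ-*; -‿distribʳ-*; -‿involutive; -‿+-comm; -0#≈0#)
  open import Relation.Binary.Reasoning.Setoid setoid

  -- Identities and inequalities in an ordered field

  module _ where
    open List using ([]; _∷_)

    fromℕ-+ : ∀ j k → fromℕ (j ℕ.+ k) ≈ fromℕ j + fromℕ k
    fromℕ-+ zero    k = sym (+-identityˡ _)
    fromℕ-+ (suc j) k = trans (+-congˡ (fromℕ-+ j k)) (sym (+-assoc _ _ _))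

    fromℕ-* : ∀ j k → fromℕ (j ℕ.* k) ≈ fromℕ j * fromℕ k
    fromℕ-* zero    k = sym (zeroˡ _)
    fromℕ-* (suc j) k = begin
      fromℕ (k ℕ.+ j ℕ.* k)            ≈⟨ fromℕ-+ k (j ℕ.* k) ⟩
      fromℕ k + fromℕ (j ℕ.* k)        ≈⟨ +-cong (sym (*-identityˡ _)) (fromℕ-* j k) ⟩
      1# * fromℕ k + fromℕ j * fromℕ k ≈⟨ distribʳ _ _ _ ⟨
      (1# + fromℕ j) * fromℕ k         ∎

    +-interchange : ∀ w x y z → (w + x) + (y + z) ≈ (w + y) + (x + z)
    +-interchange w x y z = begin
      (w + x) + (y + z) ≈⟨ +-assoc _ _ _ ⟩
      w + (x + (y + z))
        ≈⟨ +-congˡ (trans (sym (+-assoc _ _ _)) (trans (+-congʳ (+-comm x y)) (+-assoc _ _ _))) ⟩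
      w + (y + (x + z)) ≈⟨ +-assoc _ _ _ ⟨
      (w + y) + (x + z) ∎

    *-interchange : ∀ w x y z → (w * x) * (y * z) ≈ (w * y) * (x * z)
    *-interchange w x y z = begin
      (w * x) * (y * z) ≈⟨ *-assoc _ _ _ ⟩
      w * (x * (y * z))
        ≈⟨ *-congˡ (trans (sym (*-assoc _ _ _)) (trans (*-congʳ (*-comm x y)) (*-assoc _ _ _))) ⟩
      w * (y * (x * z)) ≈⟨ *-assoc _ _ _ ⟨
      (w * y) * (x * z) ∎

    +-cancelʳ : ∀ {x y} z → x + z ≈ y + z → x ≈ y
    +-cancelʳ {x} {y} z eq = begin
      x             ≈⟨ +-identityʳ x ⟨
      x + 0#        ≈⟨ +-congˡ (-‿inverseʳ z) ⟨
      x + (z - z)   ≈⟨ +-assoc _ _ _ ⟨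
      (x + z) - z   ≈⟨ +-congʳ eq ⟩
      (y + z) - z   ≈⟨ +-assoc _ _ _ ⟩
      y + (z - z)   ≈⟨ +-congˡ (-‿inverseʳ z) ⟩
      y + 0#        ≈⟨ +-identityʳ y ⟩
      y             ∎

    cross-sums⇒differences : ∀ p n p′ n′ → p + n′ ≈ p′ + n → p - n ≈ p′ - n′
    cross-sums⇒differences p n p′ n′ eq = +-cancelʳ (n + n′) (begin
      (p - n) + (n + n′)   ≈⟨ +-interchange p (- n) n n′ ⟩
      (p + n) + (- n + n′) ≈⟨ +-congˡ (+-comm _ _) ⟩
      (p + n) + (n′ - n)   ≈⟨ +-interchange p n n′ (- n) ⟩
      (p + n′) + (n - n)   ≈⟨ +-cong eq (trans (-‿inverseʳ n) (sym (-‿inverseʳ n′))) ⟩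
      (p′ + n) + (n′ - n′) ≈⟨ +-interchange p′ n n′ (- n′) ⟩
      (p′ + n′) + (n - n′) ≈⟨ +-congˡ (+-comm _ _) ⟩
      (p′ + n′) + (- n′ + n) ≈⟨ +-interchange p′ n′ (- n′) n ⟩
      (p′ - n′) + (n′ + n) ≈⟨ +-congˡ (+-comm _ _) ⟩
      (p′ - n′) + (n + n′) ∎)

    -- Polynomial identities and positive combinations of inequalities

    infixl 6 _:+_ _:-_
    infixl 7 _:*_
    infix  8 :-_
    data Expr (v : ℕ) : Set where
      var            : Fin v → Expr v
      con            : ℕ → Expr v
      :1             : Expr v
      _:+_ _:-_ _:*_ : (e f : Expr v) → Expr v
      :-_            : (e : Expr v) → Expr v

    ⟦_⟧ : ∀ {v} → Expr v → Vec Carrier v → Carrier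
    ⟦ var i ⟧  ρ = lookup ρ i
    ⟦ con k ⟧  ρ = fromℕ k
    ⟦ :1 ⟧     ρ = 1#
    ⟦ e :+ f ⟧ ρ = ⟦ e ⟧ ρ + ⟦ f ⟧ ρ
    ⟦ e :- f ⟧ ρ = ⟦ e ⟧ ρ - ⟦ f ⟧ ρ
    ⟦ e :* f ⟧ ρ = ⟦ e ⟧ ρ * ⟦ f ⟧ ρ
    ⟦ :- e ⟧   ρ = - ⟦ e ⟧ ρ

    private
      -- A monomial is a sorted list of indices of variables, a polynomial a
      -- sorted list of monomials with multiplicities.
      Mono Poly : Set
      Mono = List ℕ
      Poly = List (Mono × ℕ)

      infix 4 _<ᵐ_
      _<ᵐ_ : Mono → Mono → Bool
      []      <ᵐ []      = false
      []      <ᵐ (_ ∷ _) = true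
      (_ ∷ _) <ᵐ []      = false
      (i ∷ m) <ᵐ (j ∷ n) = if i ℕ.<ᵇ j then true else if j ℕ.<ᵇ i then false else m <ᵐ n

      insertᵐ : ℕ → Mono → Mono
      insertᵐ i []      = i ∷ []
      insertᵐ i (j ∷ m) = if i ℕ.<ᵇ j then i ∷ j ∷ m else j ∷ insertᵐ i m

      _*ᵐ_ : Mono → Mono → Mono
      []      *ᵐ n = n
      (i ∷ m) *ᵐ n = insertᵐ i (m *ᵐ n)

      insertᵖ : Mono → ℕ → Poly → Poly
      insertᵖ m j []            = (m , j) ∷ []
      insertᵖ m j ((n , k) ∷ p) with ListProperties.≡-dec ℕ._≟_ m n
      ... | yes _ = (m , j ℕ.+ k) ∷ p
      ... | no  _ = if m <ᵐ n then (m , j) ∷ (n , k) ∷ p else (n , k) ∷ insertᵖ m j p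

      _+ᵖ_ : Poly → Poly → Poly
      []            +ᵖ q = q
      ((m , j) ∷ p) +ᵖ q = insertᵖ m j (p +ᵖ q)

      scaleᵖ : Mono → ℕ → Poly → Poly
      scaleᵖ m j []            = []
      scaleᵖ m j ((n , k) ∷ p) = insertᵖ (m *ᵐ n) (j ℕ.* k) (scaleᵖ m j p)

      _*ᵖ_ : Poly → Poly → Poly
      []            *ᵖ q = []
      ((m , j) ∷ p) *ᵖ q = scaleᵖ m j q +ᵖ (p *ᵖ q)

      -- The pair (p , q) stands for p - q.
      normalise : ∀ {v} → Expr v → Poly × Poly
      normalise (var i)  = ((toℕ i ∷ [] , 1) ∷ []) , []
      -- A monomial of multiplicity zero would make normal forms ambiguous.
      normalise (con 0)  = [] , []
      normalise (con k@(suc _)) = (([] , k) ∷ []) , []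
      normalise :1       = (([] , 1) ∷ []) , []
      normalise (e :+ f) = let (p , q) = normalise e ; (p′ , q′) = normalise f in
        (p +ᵖ p′) , (q +ᵖ q′)
      normalise (e :- f) = let (p , q) = normalise e ; (p′ , q′) = normalise f in
        (p +ᵖ q′) , (q +ᵖ p′)
      normalise (e :* f) = let (p , q) = normalise e ; (p′ , q′) = normalise f in
        ((p *ᵖ p′) +ᵖ (q *ᵖ q′)) , ((p *ᵖ q′) +ᵖ (q *ᵖ p′))
      normalise (:- e)   = let (p , q) = normalise e in q , p

    -- Cross sums compare the differences `p - q` and `p′ - q′` while all coefficients stay natural
    -- numbers.
    Equal : ∀ {v} → Expr v → Expr v → Set
    Equal e f = let (p , q) = normalise e ; (p′ , q′) = normalise f in p +ᵖ q′ ≡ p′ +ᵖ q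

    private module Semantics {v : ℕ} (ρ : Vec Carrier v) where

      at : ∀ {u} → Vec Carrier u → ℕ → Carrier
      at []      _       = 0#
      at (x ∷ _) zero    = x
      at (_ ∷ σ) (suc i) = at σ i

      at-toℕ : ∀ {u} (σ : Vec Carrier u) (i : Fin u) → at σ (toℕ i) ≡ lookup σ i
      at-toℕ (x ∷ σ) zero    = refl
      at-toℕ (x ∷ σ) (suc i) = at-toℕ σ i

      ⟦_⟧ᵐ : Mono → Carrier
      ⟦ [] ⟧ᵐ    = 1#
      ⟦ i ∷ m ⟧ᵐ = at ρ i * ⟦ m ⟧ᵐ

      ⟦_⟧ᵖ : Poly → Carrier
      ⟦ [] ⟧ᵖ          = 0#
      ⟦ (m , k) ∷ p ⟧ᵖ = fromℕ k * ⟦ m ⟧ᵐ + ⟦ p ⟧ᵖ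

      insertᵐ-sound : ∀ i m → ⟦ insertᵐ i m ⟧ᵐ ≈ at ρ i * ⟦ m ⟧ᵐ
      insertᵐ-sound i []      = ≈-refl
      insertᵐ-sound i (j ∷ m) with i ℕ.<ᵇ j
      ... | true  = ≈-refl
      ... | false = begin
        at ρ j * ⟦ insertᵐ i m ⟧ᵐ      ≈⟨ *-congˡ (insertᵐ-sound i m) ⟩
        at ρ j * (at ρ i * ⟦ m ⟧ᵐ)     ≈⟨ *-assoc _ _ _ ⟨
        (at ρ j * at ρ i) * ⟦ m ⟧ᵐ     ≈⟨ *-congʳ (*-comm _ _) ⟩
        (at ρ i * at ρ j) * ⟦ m ⟧ᵐ     ≈⟨ *-assoc _ _ _ ⟩
        at ρ i * (at ρ j * ⟦ m ⟧ᵐ)     ∎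

      *ᵐ-sound : ∀ m n → ⟦ m *ᵐ n ⟧ᵐ ≈ ⟦ m ⟧ᵐ * ⟦ n ⟧ᵐ
      *ᵐ-sound []      n = sym (*-identityˡ _)
      *ᵐ-sound (i ∷ m) n = trans (insertᵐ-sound i (m *ᵐ n))
        (trans (*-congˡ (*ᵐ-sound m n)) (sym (*-assoc _ _ _)))

      insertᵖ-sound : ∀ m j p → ⟦ insertᵖ m j p ⟧ᵖ ≈ fromℕ j * ⟦ m ⟧ᵐ + ⟦ p ⟧ᵖ
      insertᵖ-sound m j []            = ≈-refl
      insertᵖ-sound m j ((n , k) ∷ p) with ListProperties.≡-dec ℕ._≟_ m n
      ... | yes refl = begin
        fromℕ (j ℕ.+ k) * ⟦ m ⟧ᵐ + ⟦ p ⟧ᵖ               ≈⟨ +-congʳ (*-congʳ (fromℕ-+ j k)) ⟩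
        (fromℕ j + fromℕ k) * ⟦ m ⟧ᵐ + ⟦ p ⟧ᵖ           ≈⟨ +-congʳ (distribʳ _ _ _) ⟩
        (fromℕ j * ⟦ m ⟧ᵐ + fromℕ k * ⟦ m ⟧ᵐ) + ⟦ p ⟧ᵖ  ≈⟨ +-assoc _ _ _ ⟩
        fromℕ j * ⟦ m ⟧ᵐ + (fromℕ k * ⟦ m ⟧ᵐ + ⟦ p ⟧ᵖ)  ∎
      ... | no _ with m <ᵐ n
      ...   | true  = ≈-refl
      ...   | false = begin
        fromℕ k * ⟦ n ⟧ᵐ + ⟦ insertᵖ m j p ⟧ᵖ            ≈⟨ +-congˡ (insertᵖ-sound m j p) ⟩
        fromℕ k * ⟦ n ⟧ᵐ + (fromℕ j * ⟦ m ⟧ᵐ + ⟦ p ⟧ᵖ)   ≈⟨ +-assoc _ _ _ ⟨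
        (fromℕ k * ⟦ n ⟧ᵐ + fromℕ j * ⟦ m ⟧ᵐ) + ⟦ p ⟧ᵖ   ≈⟨ +-congʳ (+-comm _ _) ⟩
        (fromℕ j * ⟦ m ⟧ᵐ + fromℕ k * ⟦ n ⟧ᵐ) + ⟦ p ⟧ᵖ   ≈⟨ +-assoc _ _ _ ⟩
        fromℕ j * ⟦ m ⟧ᵐ + (fromℕ k * ⟦ n ⟧ᵐ + ⟦ p ⟧ᵖ)   ∎

      +ᵖ-sound : ∀ p q → ⟦ p +ᵖ q ⟧ᵖ ≈ ⟦ p ⟧ᵖ + ⟦ q ⟧ᵖ
      +ᵖ-sound []            q = sym (+-identityˡ _)
      +ᵖ-sound ((m , j) ∷ p) q = trans (insertᵖ-sound m j (p +ᵖ q))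
        (trans (+-congˡ (+ᵖ-sound p q)) (sym (+-assoc _ _ _)))

      scaleᵖ-sound : ∀ m j q → ⟦ scaleᵖ m j q ⟧ᵖ ≈ (fromℕ j * ⟦ m ⟧ᵐ) * ⟦ q ⟧ᵖ
      scaleᵖ-sound m j []            = sym (zeroʳ _)
      scaleᵖ-sound m j ((n , k) ∷ q) = begin
        ⟦ insertᵖ (m *ᵐ n) (j ℕ.* k) (scaleᵖ m j q) ⟧ᵖ
          ≈⟨ insertᵖ-sound (m *ᵐ n) (j ℕ.* k) (scaleᵖ m j q) ⟩
        fromℕ (j ℕ.* k) * ⟦ m *ᵐ n ⟧ᵐ + ⟦ scaleᵖ m j q ⟧ᵖ
          ≈⟨ +-cong (*-cong (fromℕ-* j k) (*ᵐ-sound m n)) (scaleᵖ-sound m j q) ⟩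
        (fromℕ j * fromℕ k) * (⟦ m ⟧ᵐ * ⟦ n ⟧ᵐ) + (fromℕ j * ⟦ m ⟧ᵐ) * ⟦ q ⟧ᵖ
          ≈⟨ +-congʳ (*-interchange _ _ _ _) ⟩
        (fromℕ j * ⟦ m ⟧ᵐ) * (fromℕ k * ⟦ n ⟧ᵐ) + (fromℕ j * ⟦ m ⟧ᵐ) * ⟦ q ⟧ᵖ
          ≈⟨ distribˡ _ _ _ ⟨
        (fromℕ j * ⟦ m ⟧ᵐ) * (fromℕ k * ⟦ n ⟧ᵐ + ⟦ q ⟧ᵖ)                    ∎

      *ᵖ-sound : ∀ p q → ⟦ p *ᵖ q ⟧ᵖ ≈ ⟦ p ⟧ᵖ * ⟦ q ⟧ᵖ
      *ᵖ-sound []            q = sym (zeroˡ _)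
      *ᵖ-sound ((m , j) ∷ p) q = trans (+ᵖ-sound (scaleᵖ m j q) (p *ᵖ q))
        (trans (+-cong (scaleᵖ-sound m j q) (*ᵖ-sound p q)) (sym (distribʳ _ _ _)))

      ⟦_⟧ᵈ : Poly × Poly → Carrier
      ⟦ p , q ⟧ᵈ = ⟦ p ⟧ᵖ - ⟦ q ⟧ᵖ

      single : ∀ m → ⟦ ((m , 1) ∷ []) , [] ⟧ᵈ ≈ ⟦ m ⟧ᵐ
      single m = begin
        ((1# + 0#) * ⟦ m ⟧ᵐ + 0#) - 0#  ≈⟨ +-congˡ -0#≈0# ⟩
        ((1# + 0#) * ⟦ m ⟧ᵐ + 0#) + 0#  ≈⟨ +-identityʳ _ ⟩
        (1# + 0#) * ⟦ m ⟧ᵐ + 0#         ≈⟨ +-identityʳ _ ⟩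
        (1# + 0#) * ⟦ m ⟧ᵐ              ≈⟨ *-congʳ (+-identityʳ 1#) ⟩
        1# * ⟦ m ⟧ᵐ                     ≈⟨ *-identityˡ _ ⟩
        ⟦ m ⟧ᵐ                          ∎

      diff-+ : ∀ a b c d → (a + c) - (b + d) ≈ (a - b) + (c - d)
      diff-+ a b c d = trans (+-congˡ (sym (-‿+-comm b d))) (+-interchange a c (- b) (- d))

      neg-diff : ∀ a b → - (a - b) ≈ b - a
      neg-diff a b = trans (sym (-‿+-comm a (- b)))
        (trans (+-congˡ (-‿involutive b)) (+-comm _ _))

      diff-* : ∀ a b c d → (a * c + b * d) - (a * d + b * c) ≈ (a - b) * (c - d)
      diff-* a b c d = begin
        (a * c + b * d) - (a * d + b * c)         ≈⟨ diff-+ _ _ _ _ ⟩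
        (a * c - a * d) + (b * d - b * c)         ≈⟨ +-cong (minus a c d) (minus b d c) ⟩
        a * (c - d) + b * (d - c)                 ≈⟨ +-congˡ (*-congˡ (neg-diff c d)) ⟨
        a * (c - d) + b * (- (c - d))             ≈⟨ +-congˡ (-‿distribʳ-* b (c - d)) ⟨
        a * (c - d) - b * (c - d)                 ≈⟨ +-congˡ (-‿distribˡ-* b (c - d)) ⟩
        a * (c - d) + (- b) * (c - d)             ≈⟨ distribʳ _ _ _ ⟨
        (a - b) * (c - d)                         ∎
        where
        minus : ∀ x y z → x * y - x * z ≈ x * (y - z)
        minus x y z = trans (+-congˡ (-‿distribʳ-* x z)) (sym (distribˡ x y (- z)))

      normalise-sound : ∀ e → ⟦ normalise e ⟧ᵈ ≈ ⟦ e ⟧ ρ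
      normalise-sound (var i)  = trans (single (toℕ i ∷ [])) (trans (*-identityʳ _) (reflexive (at-toℕ ρ i)))
      normalise-sound (con 0)  = trans (+-congˡ -0#≈0#) (+-identityʳ _)
      normalise-sound (con (suc k)) = trans (+-congˡ -0#≈0#)
        (trans (+-identityʳ _) (trans (+-identityʳ _) (*-identityʳ _)))
      normalise-sound :1       = single []
      normalise-sound (e :+ f) = let (p , q) = normalise e ; (p′ , q′) = normalise f in
        trans (+-cong (+ᵖ-sound p p′) (-‿cong (+ᵖ-sound q q′)))
          (trans (diff-+ _ _ _ _) (+-cong (normalise-sound e) (normalise-sound f)))
      normalise-sound (e :- f) = let (p , q) = normalise e ; (p′ , q′) = normalise f in
        trans (+-cong (+ᵖ-sound p q′) (-‿cong (+ᵖ-sound q p′)))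
          (trans (diff-+ _ _ _ _) (+-cong (normalise-sound e)
            (trans (sym (neg-diff _ _)) (-‿cong (normalise-sound f)))))
      normalise-sound (e :* f) = let (p , q) = normalise e ; (p′ , q′) = normalise f in
        trans (+-cong (trans (+ᵖ-sound (p *ᵖ p′) (q *ᵖ q′)) (+-cong (*ᵖ-sound p p′) (*ᵖ-sound q q′)))
                        (-‿cong (trans (+ᵖ-sound (p *ᵖ q′) (q *ᵖ p′)) (+-cong (*ᵖ-sound p q′) (*ᵖ-sound q p′)))))
          (trans (diff-* _ _ _ _) (*-cong (normalise-sound e) (normalise-sound f)))
      normalise-sound (:- e)   = trans (sym (neg-diff _ _)) (-‿cong (normalise-sound e))

      equal-sound : ∀ e f → Equal e f → ⟦ e ⟧ ρ ≈ ⟦ f ⟧ ρ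
      equal-sound e f eq = let (p , q) = normalise e ; (p′ , q′) = normalise f in
        trans (sym (normalise-sound e)) (trans
          (cross-sums⇒differences _ _ _ _ (trans (sym (+ᵖ-sound p q′))
            (trans (reflexive (≡.cong ⟦_⟧ᵖ eq)) (+ᵖ-sound p′ q))))
          (normalise-sound f))

    infix 4 _:=_
    _:=_ : ∀ {v} → Expr v → Expr v → Expr v × Expr v
    _:=_ = _,_

    private
      vars : ∀ v → Vec (Expr v) v
      vars v = Vec.map var (allFin v)

      generalise : ∀ {a} {A : Set} v (P : Vec A v → Set a) → (∀ ρ → P ρ) → ∀ⁿ v (curryⁿ P)
      generalise zero    P p   = p []
      generalise (suc v) P p x = generalise v (λ ρ → P (x ∷ ρ)) (λ ρ → p (x ∷ ρ))

    solve : ∀ v (f : N-ary v (Expr v) (Expr v × Expr v)) →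
            let (l , r) = f $ⁿ vars v in
            Equal l r → ∀ⁿ v (curryⁿ λ ρ → ⟦ l ⟧ ρ ≈ ⟦ r ⟧ ρ)
    solve v f eq = let (l , r) = f $ⁿ vars v in
      generalise v (λ ρ → ⟦ l ⟧ ρ ≈ ⟦ r ⟧ ρ) (λ ρ → Semantics.equal-sound ρ l r eq)

    infix 4 _:≤_
    infix 3 _×≤_
    infixr 2 _⟹_ ⊢_

    record Inequality (v : ℕ) : Set where
      constructor _:≤_
      field lower upper : Expr v

    record Scaled (v : ℕ) : Set where
      constructor _×≤_
      field
        factor     : ℕ
        inequality : Inequality v

    -- The factors are numerals, but the expressions may have any degree: a hypothesis that has to
    -- be multiplied by a variable is supplied already multiplied.
    data Problem (v : ℕ) : Set where
      ⊢_   : Scaled v → Problem v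
      _⟹_ : Scaled v → Problem v → Problem v

    private
      Holds : ∀ {v} → Inequality v → Vec Carrier v → Set
      Holds (l :≤ r) ρ = ⟦ l ⟧ ρ ≤ ⟦ r ⟧ ρ

      Claim : ∀ {v} → Problem v → Vec Carrier v → Set
      Claim (⊢ (_ ×≤ i))       ρ = Holds i ρ
      Claim ((_ ×≤ i) ⟹ p) ρ = Holds i ρ → Claim p ρ

      Certificate : ∀ {v} → Expr v → Problem v → Set
      -- The factor of the conclusion is cancelled at the end, so it must not be zero.
      Certificate acc (⊢ (zero ×≤ _))               = ⊥
      Certificate acc (⊢ (k@(suc _) ×≤ (l :≤ r))) = Equal acc (con k :* (r :- l))
      Certificate acc ((k ×≤ (l :≤ r)) ⟹ p) = Certificate (acc :+ con k :* (r :- l)) p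

    *-cancel-pos : ∀ k {x} → 0# ≤ fromℕ (suc k) * x → 0# ≤ x
    *-cancel-pos k {x} h with total 0# x
    ... | inj₁ 0≤x = 0≤x
    ... | inj₂ x≤0 = ≤-reflexive (sym (begin
      x                                        ≈⟨ *-identityˡ x ⟨
      1# * x                                   ≈⟨ *-congʳ (trans (*-comm _ _) (⁻¹-inverseʳ c≉0)) ⟨
      (fromℕ (suc k) ⁻¹ * fromℕ (suc k)) * x   ≈⟨ *-assoc _ _ _ ⟩
      fromℕ (suc k) ⁻¹ * (fromℕ (suc k) * x)
        ≈⟨ *-congˡ (antisym (≤-respʳ-≈ (zeroʳ _) (*-monoˡ (fromℕ-nonNeg (suc k)) x≤0)) h) ⟩
      fromℕ (suc k) ⁻¹ * 0#                    ≈⟨ zeroʳ _ ⟩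
      0#                                       ∎))
      where
      c≉0 : ¬ (fromℕ (suc k) ≈ 0#)
      c≉0 = >⇒≉ (fromℕ-suc-pos k)

    private
      combine : ∀ {v} (ρ : Vec Carrier v) (acc : Expr v) (p : Problem v) →
                Certificate acc p → 0# ≤ ⟦ acc ⟧ ρ → Claim p ρ
      combine ρ acc (⊢ (suc k ×≤ (l :≤ r))) eq h = 0≤y-x⇒x≤y (*-cancel-pos k
        (≤-respʳ-≈ (Semantics.equal-sound ρ acc (con (suc k) :* (r :- l)) eq) h))
      combine ρ acc ((k ×≤ (l :≤ r)) ⟹ p) eq h l≤r = combine ρ (acc :+ con k :* (r :- l)) p eq
        (≤-respˡ-≈ (+-identityˡ 0#) (+-mono h (*-pos (fromℕ-nonNeg k) (x≤y⇒0≤y-x l≤r))))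

    -- Farkas: the certificate checks that the hypotheses, multiplied by their factors,
    -- add up to the conclusion multiplied by its factor.
    linear : ∀ v (f : N-ary v (Expr v) (Problem v)) → let p = f $ⁿ vars v in
             Certificate (con 0) p → ∀ⁿ v (curryⁿ (Claim p))
    linear v f eq = let p = f $ⁿ vars v in
      generalise v (Claim p) (λ ρ → combine ρ (con 0) p eq ≤-refl)

  -- Inverses, the integral of 1/t and the logarithm

  module _ where
    open List using ([]; _∷_)
    open Linked using ([-]; _∷_)

    pos-resp-≈ : ∀ {x y} → x ≈ y → 0# < x → 0# < y
    pos-resp-≈ x≈y 0<x y≤0 = 0<x (≤-respˡ-≈ (sym x≈y) y≤0)

    ⁻¹-inverseˡ : ∀ {x} → 0# < x → x ⁻¹ * x ≈ 1#
    ⁻¹-inverseˡ 0<x = trans (*-comm _ _) (⁻¹-inverseʳ (>⇒≉ 0<x))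

    *-cancel-⁻¹ : ∀ {x} y → 0# < x → x ⁻¹ * (x * y) ≈ y
    *-cancel-⁻¹ y 0<x = trans (sym (*-assoc _ _ _))
      (trans (*-congʳ (⁻¹-inverseˡ 0<x)) (*-identityˡ y))

    *-cancel-≤ : ∀ {x y z} → 0# < x → x * y ≤ x * z → y ≤ z
    *-cancel-≤ {x} {y} {z} 0<x h = ≤-respˡ-≈ (*-cancel-⁻¹ y 0<x)
      (≤-respʳ-≈ (*-cancel-⁻¹ z 0<x) (*-monoˡ (⁻¹-nonNeg 0<x) h))

    *-pos-strict : ∀ {x y} → 0# < x → 0# < y → 0# < x * y
    *-pos-strict 0<x 0<y h = 0<y (*-cancel-≤ 0<x (≤-respʳ-≈ (sym (zeroʳ _)) h))

    ⁻¹-pos : ∀ {x} → 0# < x → 0# < x ⁻¹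
    ⁻¹-pos {x} 0<x h = 0<1 (≤-respˡ-≈ (⁻¹-inverseʳ (>⇒≉ 0<x))
      (≤-respʳ-≈ (zeroʳ x) (*-monoˡ (<⇒≤ 0<x) h)))

    ⁻¹-nonNeg-total : ∀ {x} → 0# ≤ x → 0# ≤ x ⁻¹
    ⁻¹-nonNeg-total {x} 0≤x = by (x ≤? 0#)
      where
      zero-case : x ≈ 0# → 0# ≤ x ⁻¹
      zero-case x≈0 with x ≟ʳ 0#
      ... | yes _  = ≤-refl
      ... | no x≉0 = contradiction x≈0 x≉0
      by : Dec (x ≤ 0#) → 0# ≤ x ⁻¹
      by (yes x≤0) = zero-case (antisym x≤0 0≤x)
      by (no  0<x) = ⁻¹-nonNeg 0<x

    ⁻¹-unique : ∀ {x y} → 0# < x → x * y ≈ 1# → y ≈ x ⁻¹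
    ⁻¹-unique {x} {y} 0<x xy≈1 = begin
      y               ≈⟨ *-cancel-⁻¹ y 0<x ⟨
      x ⁻¹ * (x * y)  ≈⟨ *-congˡ xy≈1 ⟩
      x ⁻¹ * 1#       ≈⟨ *-identityʳ _ ⟩
      x ⁻¹            ∎

    normalise-≈ : ∀ {w} x → 0# < w → w * (x * w ⁻¹) ≈ x
    normalise-≈ {w} x 0<w = begin
      w * (x * w ⁻¹)  ≈⟨ solve 3 (λ w x i → w :* (x :* i) := x :* (w :* i)) refl w x (w ⁻¹) ⟩
      x * (w * w ⁻¹)  ≈⟨ *-congˡ (⁻¹-inverseʳ (>⇒≉ 0<w)) ⟩
      x * 1#          ≈⟨ *-identityʳ x ⟩
      x               ∎

    -- The integral of 1/t

    lowerSum-≤ : ∀ {a b} 0<a a≤b ts → Linked _≤_ (a ∷ ts ++ b ∷ []) →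
                 lowerSum (a ∷ ts ++ b ∷ []) ≤ integral a b 0<a a≤b
    lowerSum-≤ 0<a a≤b ts linked = proj₁ (proj₂ (complete _ _ _)) _ (ts , linked , ≈-refl)

    integral-≤ : ∀ {a b} 0<a a≤b u →
                 (∀ ts → Linked _≤_ (a ∷ ts ++ b ∷ []) → lowerSum (a ∷ ts ++ b ∷ []) ≤ u) →
                 integral a b 0<a a≤b ≤ u
    integral-≤ 0<a a≤b u h = proj₂ (proj₂ (complete _ _ _)) u
      λ { σ (ts , linked , σ≈) → ≤-respˡ-≈ (sym σ≈) (h ts linked) }

    private
      linked-++ : ∀ s ts {b} us {c} → Linked _≤_ (s ∷ ts ++ b ∷ []) →
                  Linked _≤_ (b ∷ us ++ c ∷ []) → Linked _≤_ (s ∷ (ts ++ b ∷ us) ++ c ∷ [])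
      linked-++ s []       us (s≤b ∷ _) l = s≤b ∷ l
      linked-++ s (t ∷ ts) us (s≤t ∷ k) l = s≤t ∷ linked-++ t ts us k l

      lowerSum-++ : ∀ s ts b us c → lowerSum (s ∷ (ts ++ b ∷ us) ++ c ∷ []) ≈
                    lowerSum (s ∷ ts ++ b ∷ []) + lowerSum (b ∷ us ++ c ∷ [])
      lowerSum-++ s []       b us c = +-congʳ (sym (+-identityʳ _))
      lowerSum-++ s (t ∷ ts) b us c = trans (+-congˡ (lowerSum-++ t ts b us c)) (sym (+-assoc _ _ _))

    integral-nonNeg : ∀ {a b} 0<a a≤b → 0# ≤ integral a b 0<a a≤b
    integral-nonNeg {a} {b} 0<a a≤b = ≤-trans
      (≤-respʳ-≈ (sym (+-identityʳ _))
        (*-pos (x≤y⇒0≤y-x a≤b) (⁻¹-nonNeg (<-≤-trans 0<a a≤b))))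
      (lowerSum-≤ 0<a a≤b [] (a≤b ∷ [-]))

    integral-bound : ∀ {a b} 0<a a≤b → integral a b 0<a a≤b ≤ (b - a) * a ⁻¹
    integral-bound {a} {b} 0<a a≤b = integral-≤ 0<a a≤b _
      λ ts → lowerSum-bound 0<a a ts b ≤-refl

    integral-degenerate : ∀ {a b} 0<a a≤b → b ≤ a → integral a b 0<a a≤b ≈ 0#
    integral-degenerate {a} {b} 0<a a≤b b≤a = antisym
      (≤-trans (integral-bound 0<a a≤b) (≤-reflexive (begin
        (b - a) * a ⁻¹  ≈⟨ *-congʳ (+-congʳ (antisym b≤a a≤b)) ⟩
        (a - a) * a ⁻¹  ≈⟨ *-congʳ (-‿inverseʳ a) ⟩
        0# * a ⁻¹       ≈⟨ zeroˡ _ ⟩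
        0#              ∎)))
      (integral-nonNeg 0<a a≤b)

    -- Prepending `s` to a partition of `[t , b]` gives a partition of `[s , b]` whose first
    -- rectangle is `(t - s) / t`.
    integral-prefix : ∀ {s t b} 0<s s≤t 0<t t≤b s≤b →
                      (t - s) * t ⁻¹ + integral t b 0<t t≤b ≤ integral s b 0<s s≤b
    integral-prefix {s} {t} {b} 0<s s≤t 0<t t≤b s≤b =
      linear 3 (λ i j k → 1 ×≤ j :≤ k :- i ⟹ ⊢ 1 ×≤ i :+ j :≤ k) refl _ _ _
        (integral-≤ 0<t t≤b _ λ ts linked →
          linear 3 (λ i j k → 1 ×≤ i :+ j :≤ k ⟹ ⊢ 1 ×≤ j :≤ k :- i) refl _ _ _
            (lowerSum-≤ 0<s s≤b (t ∷ ts) (s≤t ∷ linked)))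

    -- Concatenation of partitions gives one inequality. For the other, follow a partition of
    -- `[a , c]` to the step from `s` to `t` that passes `b` and cut it there: the piece over
    -- `[s , b]` has height `1 / t ≤ 1 / b`, and the rest is a lower sum over `[b , c]`.
    integral-split : ∀ {a b c} 0<a 0<b a≤b b≤c a≤c →
                     integral a c 0<a a≤c ≈ integral a b 0<a a≤b + integral b c 0<b b≤c
    integral-split {a} {b} {c} 0<a 0<b a≤b b≤c a≤c = antisym
      (integral-≤ 0<a a≤c _ λ ts → upper a ts 0<a a≤b)
      (linear 3 (λ x y z → 1 ×≤ x :≤ z :- y ⟹ ⊢ 1 ×≤ x :+ y :≤ z) refl _ _ _
        (integral-≤ 0<a a≤b _ λ ts tsL →
          linear 3 (λ x y z → 1 ×≤ y :≤ z :- x ⟹ ⊢ 1 ×≤ x :≤ z :- y) refl _ _ _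
            (integral-≤ 0<b b≤c _ λ us usL →
              linear 4 (λ x y z w → 1 ×≤ w :≤ z ⟹ 1 ×≤ x :+ y :≤ w ⟹ ⊢ 1 ×≤ y :≤ z :- x) refl _ _ _ _
                (lowerSum-≤ 0<a a≤c (ts ++ b ∷ us) (linked-++ a ts us tsL usL))
                (≤-reflexive (sym (lowerSum-++ a ts b us c))))))
      where
      upper : ∀ s ts 0<s s≤b → Linked _≤_ (s ∷ ts ++ c ∷ []) →
              lowerSum (s ∷ ts ++ c ∷ []) ≤ integral s b 0<s s≤b + integral b c 0<b b≤c
      upper s [] 0<s s≤b _ =
        linear 7 (λ s b c b′ c′ i j → 1 ×≤ (b :- s) :* c′ :≤ (b :- s) :* b′
                                    ⟹ 1 ×≤ (b :- s) :* b′ :+ con 0 :≤ i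
                                    ⟹ 1 ×≤ (c :- b) :* c′ :+ con 0 :≤ j
                                    ⟹ ⊢ 1 ×≤ (c :- s) :* c′ :+ con 0 :≤ i :+ j) refl
          _ _ _ _ _ _ _
          (*-monoˡ (x≤y⇒0≤y-x s≤b) (⁻¹-antitone 0<b b≤c))
          (lowerSum-≤ 0<s s≤b [] (s≤b ∷ [-]))
          (lowerSum-≤ 0<b b≤c [] (b≤c ∷ [-]))
      upper s (t ∷ ts) 0<s s≤b (s≤t ∷ linked) with total b t
      ... | inj₁ b≤t =
        linear 8 (λ s b t b′ t′ i j l → 1 ×≤ (b :- s) :* t′ :≤ (b :- s) :* b′
                                    ⟹ 1 ×≤ (b :- s) :* b′ :+ con 0 :≤ i
                                    ⟹ 1 ×≤ (t :- b) :* t′ :+ l :≤ j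
                                    ⟹ ⊢ 1 ×≤ (t :- s) :* t′ :+ l :≤ i :+ j) refl
          _ _ _ _ _ _ _ _
          (*-monoˡ (x≤y⇒0≤y-x s≤b) (⁻¹-antitone 0<b b≤t))
          (lowerSum-≤ 0<s s≤b [] (s≤b ∷ [-]))
          (lowerSum-≤ 0<b b≤c (t ∷ ts) (b≤t ∷ linked))
      ... | inj₂ t≤b =
        linear 5 (λ x l i i′ j → 1 ×≤ l :≤ i′ :+ j ⟹ 1 ×≤ x :+ i′ :≤ i ⟹ ⊢ 1 ×≤ x :+ l :≤ i :+ j) refl
          _ _ _ _ _
          (upper t ts 0<t t≤b linked) (integral-prefix 0<s s≤t 0<t t≤b s≤b)
        where 0<t = <-≤-trans 0<s s≤t

    -- Scaling a partition by `k` leaves each quotient `(t - s) / t`, hence the lower sum,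
    -- unchanged.
    integral-scale-≤ : ∀ {a b a′ b′ k} 0<a a≤b 0<a′ a′≤b′ → 0# < k → a′ ≈ k * a → b′ ≈ k * b →
                       integral a b 0<a a≤b ≤ integral a′ b′ 0<a′ a′≤b′
    integral-scale-≤ {a} {b} {a′} {b′} {k} 0<a a≤b 0<a′ a′≤b′ 0<k a′≈ b′≈ =
      integral-≤ 0<a a≤b _ λ ts linked →
        let (eq , linked′) = scale a a′ ts 0<a a′≈ linked in
        ≤-respˡ-≈ eq (lowerSum-≤ 0<a′ a′≤b′ (map (k *_) ts) linked′)
      where
      term : ∀ {s t s′ t′} → 0# < t → s′ ≈ k * s → t′ ≈ k * t → (t′ - s′) * t′ ⁻¹ ≈ (t - s) * t ⁻¹
      term {s} {t} {s′} {t′} 0<t s′≈ t′≈ = begin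
        (t′ - s′) * t′ ⁻¹              ≈⟨ *-congʳ (+-cong t′≈ (-‿cong s′≈)) ⟩
        (k * t - k * s) * t′ ⁻¹        ≈⟨ *-congʳ (*-identityʳ _) ⟨
        (k * t - k * s) * 1# * t′ ⁻¹   ≈⟨ *-congʳ (*-congˡ (⁻¹-inverseˡ 0<t)) ⟨
        (k * t - k * s) * (t ⁻¹ * t) * t′ ⁻¹
          ≈⟨ solve 5 (λ k s t i j → (k :* t :- k :* s) :* (i :* t) :* j :=
               ((t :- s) :* i) :* ((k :* t) :* j)) refl k s t (t ⁻¹) (t′ ⁻¹) ⟩
        ((t - s) * t ⁻¹) * ((k * t) * t′ ⁻¹)  ≈⟨ *-congˡ (*-congʳ t′≈) ⟨
        ((t - s) * t ⁻¹) * (t′ * t′ ⁻¹)  ≈⟨ *-congˡ (⁻¹-inverseʳ (>⇒≉ 0<t′)) ⟩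
        ((t - s) * t ⁻¹) * 1#            ≈⟨ *-identityʳ _ ⟩
        (t - s) * t ⁻¹                   ∎
        where 0<t′ = pos-resp-≈ (sym t′≈) (*-pos-strict 0<k 0<t)
      le : ∀ {s t s′ t′} → s ≤ t → s′ ≈ k * s → t′ ≈ k * t → s′ ≤ t′
      le s≤t s′≈ t′≈ = ≤-respˡ-≈ (sym s′≈) (≤-respʳ-≈ (sym t′≈) (*-monoˡ (<⇒≤ 0<k) s≤t))
      scale : ∀ s s′ ts → 0# < s → s′ ≈ k * s → Linked _≤_ (s ∷ ts ++ b ∷ []) →
              lowerSum (s′ ∷ map (k *_) ts ++ b′ ∷ []) ≈ lowerSum (s ∷ ts ++ b ∷ []) ×
              Linked _≤_ (s′ ∷ map (k *_) ts ++ b′ ∷ [])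
      scale s s′ []       0<s s′≈ (s≤b ∷ _) =
        +-congʳ (term (<-≤-trans 0<s s≤b) s′≈ b′≈) , le s≤b s′≈ b′≈ ∷ [-]
      scale s s′ (t ∷ ts) 0<s s′≈ (s≤t ∷ linked) =
        let (eq , linked′) = scale t (k * t) ts (<-≤-trans 0<s s≤t) ≈-refl linked in
        +-cong (term (<-≤-trans 0<s s≤t) s′≈ ≈-refl) eq , le s≤t s′≈ ≈-refl ∷ linked′

    integral-scale : ∀ {a b a′ b′ k} 0<a a≤b 0<a′ a′≤b′ → 0# < k → a′ ≈ k * a → b′ ≈ k * b →
                     integral a b 0<a a≤b ≈ integral a′ b′ 0<a′ a′≤b′
    integral-scale {k = k} 0<a a≤b 0<a′ a′≤b′ 0<k a′≈ b′≈ = antisym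
      (integral-scale-≤ 0<a a≤b 0<a′ a′≤b′ 0<k a′≈ b′≈)
      (integral-scale-≤ 0<a′ a′≤b′ 0<a a≤b (⁻¹-pos 0<k) (back a′≈) (back b′≈))
      where
      back : ∀ {x x′} → x′ ≈ k * x → x ≈ k ⁻¹ * x′
      back {x} x′≈ = sym (trans (*-congˡ x′≈) (*-cancel-⁻¹ x 0<k))

    -- The logarithm

    -- This replaces the case distinction in `log` by one integral from `a` to `b`; monotonicity and
    -- the functional equation follow from it.
    log-difference : ∀ {a b} 0<a a≤b → log b - log a ≈ integral a b 0<a a≤b
    log-difference {a} {b} 0<a a≤b with a ≤? 0# | total 1# a | b ≤? 0# | total 1# b
    ... | yes a≤0 | _        | _      | _        = contradiction a≤0 0<a
    ... | no _    | _        | yes b≤0 | _       = contradiction (≤-trans a≤b b≤0) 0<a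
    ... | no _    | inj₁ 1≤a | no _   | inj₁ 1≤b = trans
      (+-congʳ (integral-split 0<1 0<a 1≤a a≤b 1≤b))
      (solve 2 (λ x y → (x :+ y) :- x := y) refl _ _)
    -- Here `1 ≤ a ≤ b ≤ 1`, and all integrals vanish.
    ... | no _    | inj₁ 1≤a | no 0<b | inj₂ b≤1 = begin
      - integral b 1# 0<b b≤1 - integral 1# a 0<1 1≤a
        ≈⟨ +-cong (-‿cong (integral-degenerate 0<b b≤1 (≤-trans 1≤a a≤b)))
                  (-‿cong (integral-degenerate 0<1 1≤a (≤-trans a≤b b≤1))) ⟩
      - 0# - 0#  ≈⟨ solve 0 (:- con 0 :- con 0 := con 0) refl ⟩
      0#         ≈⟨ integral-degenerate 0<a a≤b (≤-trans b≤1 1≤a) ⟨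
      integral a b 0<a a≤b ∎
    ... | no 0<a′ | inj₂ a≤1 | no _   | inj₁ 1≤b = begin
      integral 1# b 0<1 1≤b - - integral a 1# 0<a′ a≤1
        ≈⟨ solve 2 (λ x y → x :- (:- y) := y :+ x) refl _ _ ⟩
      integral a 1# 0<a′ a≤1 + integral 1# b 0<1 1≤b  ≈⟨ integral-split 0<a′ 0<1 a≤1 1≤b a≤b ⟨
      integral a b 0<a′ a≤b
        -- Scaling by one exchanges the proof `0<a′` found in the definition of `log` for the given
        -- `0<a`.
        ≈⟨ integral-scale 0<a′ a≤b 0<a a≤b 0<1 (sym (*-identityˡ a)) (sym (*-identityˡ b)) ⟩
      integral a b 0<a a≤b                            ∎
    ... | no 0<a′ | inj₂ a≤1 | no 0<b | inj₂ b≤1 = begin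
      - integral b 1# 0<b b≤1 - - integral a 1# 0<a′ a≤1
        ≈⟨ +-congˡ (-‿cong (-‿cong (integral-split 0<a′ 0<b a≤b b≤1 a≤1))) ⟩
      - integral b 1# 0<b b≤1 - - (integral a b 0<a′ a≤b + integral b 1# 0<b b≤1)
        ≈⟨ solve 2 (λ x y → :- x :- (:- (y :+ x)) := y) refl _ _ ⟩
      integral a b 0<a′ a≤b
        ≈⟨ integral-scale 0<a′ a≤b 0<a a≤b 0<1 (sym (*-identityˡ a)) (sym (*-identityˡ b)) ⟩
      integral a b 0<a a≤b                            ∎

    log-1 : log 1# ≈ 0#
    log-1 with 1# ≤? 0# | total 1# 1#
    ... | yes 1≤0 | _        = contradiction 1≤0 0<1
    ... | no 0<1′ | inj₁ 1≤1 = integral-degenerate 0<1 1≤1 1≤1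
    ... | no 0<1′ | inj₂ 1≤1 = trans (-‿cong (integral-degenerate 0<1′ 1≤1 1≤1)) -0#≈0#

    log-cong : ∀ {x y} → 0# < x → x ≈ y → log x ≈ log y
    log-cong {x} {y} 0<x x≈y = sym (begin
      log y                      ≈⟨ solve 2 (λ x y → y := (y :- x) :+ x) refl (log x) (log y) ⟩
      (log y - log x) + log x    ≈⟨ +-congʳ (log-difference 0<x x≤y) ⟩
      integral x y 0<x x≤y + log x  ≈⟨ +-congʳ (integral-degenerate 0<x x≤y (≤-reflexive (sym x≈y))) ⟩
      0# + log x                 ≈⟨ +-identityˡ _ ⟩
      log x                      ∎)
      where x≤y = ≤-reflexive x≈y

    log-mono : ∀ {x y} → 0# < x → x ≤ y → log x ≤ log y
    log-mono 0<x x≤y = 0≤y-x⇒x≤y (≤-respʳ-≈ (sym (log-difference 0<x x≤y)) (integral-nonNeg 0<x x≤y))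

    -- The integral from `x` to `x y` is the integral from 1 to `y` scaled by `x`; for `y ≤ 1` the
    -- endpoints change places.
    log-* : ∀ {x y} → 0# < x → 0# < y → log (x * y) ≈ log x + log y
    log-* {x} {y} 0<x 0<y = [ large , small ]′ (total 1# y)
      where
      large : 1# ≤ y → log (x * y) ≈ log x + log y
      large 1≤y = begin
        log (x * y)                        ≈⟨ solve 2 (λ a b → a := b :+ (a :- b)) refl _ _ ⟩
        log x + (log (x * y) - log x)      ≈⟨ +-congˡ (log-difference 0<x x≤xy) ⟩
        log x + integral x (x * y) 0<x x≤xy
          ≈⟨ +-congˡ (integral-scale 0<1 1≤y 0<x x≤xy 0<x (sym (*-identityʳ x)) ≈-refl) ⟨
        log x + integral 1# y 0<1 1≤y      ≈⟨ +-congˡ (log-difference 0<1 1≤y) ⟨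
        log x + (log y - log 1#)           ≈⟨ +-congˡ (+-congˡ (-‿cong log-1)) ⟩
        log x + (log y - 0#)               ≈⟨ solve 2 (λ a b → a :+ (b :- con 0) := a :+ b) refl _ _ ⟩
        log x + log y                      ∎
        where
        x≤xy : x ≤ x * y
        x≤xy = ≤-respˡ-≈ (*-identityʳ x) (*-monoˡ (<⇒≤ 0<x) 1≤y)
      small : y ≤ 1# → log (x * y) ≈ log x + log y
      small y≤1 = begin
        log (x * y)                        ≈⟨ solve 2 (λ a b → a := b :- (b :- a)) refl _ _ ⟩
        log x - (log x - log (x * y))      ≈⟨ +-congˡ (-‿cong (log-difference 0<xy xy≤x)) ⟩
        log x - integral (x * y) x 0<xy xy≤x
          ≈⟨ +-congˡ (-‿cong (integral-scale 0<y y≤1 0<xy xy≤x 0<x ≈-refl (sym (*-identityʳ x)))) ⟨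
        log x - integral y 1# 0<y y≤1      ≈⟨ +-congˡ (-‿cong (log-difference 0<y y≤1)) ⟨
        log x - (log 1# - log y)           ≈⟨ +-congˡ (-‿cong (+-congʳ log-1)) ⟩
        log x - (0# - log y)               ≈⟨ solve 2 (λ a b → a :- (con 0 :- b) := a :+ b) refl _ _ ⟩
        log x + log y                      ∎
        where
        0<xy = *-pos-strict 0<x 0<y
        xy≤x : x * y ≤ x
        xy≤x = ≤-respʳ-≈ (*-identityʳ x) (*-monoˡ (<⇒≤ 0<x) y≤1)

    log-⁻¹ : ∀ {x} → 0# < x → log (x ⁻¹) ≈ - log x
    log-⁻¹ {x} 0<x = begin
      log (x ⁻¹)                     ≈⟨ solve 2 (λ a b → a := (b :+ a) :- b) refl _ _ ⟩
      (log x + log (x ⁻¹)) - log x   ≈⟨ +-congʳ (log-* 0<x (⁻¹-pos 0<x)) ⟨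
      log (x * x ⁻¹) - log x
        ≈⟨ +-congʳ (log-cong (*-pos-strict 0<x (⁻¹-pos 0<x)) (⁻¹-inverseʳ (>⇒≉ 0<x))) ⟩
      log 1# - log x                 ≈⟨ +-congʳ log-1 ⟩
      0# - log x                     ≈⟨ +-identityˡ _ ⟩
      - log x                        ∎

    1⁻¹≈1 : 1# ⁻¹ ≈ 1#
    1⁻¹≈1 = sym (⁻¹-unique 0<1 (*-identityˡ 1#))

    -- For `x ≥ 1` the integrand is at most one; for `x ≤ 1` the single rectangle of height one over
    -- `[x , 1]` is already a lower sum.
    log≤x-1 : ∀ {x} → 0# < x → log x ≤ x - 1#
    log≤x-1 {x} 0<x with x ≤? 0# | total 1# x
    ... | yes x≤0 | _        = contradiction x≤0 0<x
    ... | no _    | inj₁ 1≤x = ≤-trans (integral-bound 0<1 1≤x)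
      (≤-reflexive (trans (*-congˡ 1⁻¹≈1) (*-identityʳ _)))
    ... | no 0<x′ | inj₂ x≤1 =
      linear 2 (λ i x → 1 ×≤ (:1 :- x) :+ con 0 :≤ i ⟹ ⊢ 1 ×≤ :- i :≤ x :- :1) refl _ _
        (≤-respˡ-≈ (+-congʳ (trans (*-congˡ 1⁻¹≈1) (*-identityʳ _)))
          (lowerSum-≤ 0<x′ x≤1 [] (x≤1 ∷ [-])))

  -- Finite sums and image measures

  module _ where
    open List using ([]; _∷_)

    ∑ᴸ : ∀ {A : Set} → List A → (A → Carrier) → Carrier
    ∑ᴸ xs f = sum (map f xs)

    module _ {A : Set} where

      ∑ᴸ-cong : ∀ xs {f g : A → Carrier} → (∀ x → f x ≈ g x) → ∑ᴸ xs f ≈ ∑ᴸ xs g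
      ∑ᴸ-cong []       h = ≈-refl
      ∑ᴸ-cong (x ∷ xs) h = +-cong (h x) (∑ᴸ-cong xs h)

      ∑ᴸ-mono : ∀ xs {f g : A → Carrier} → (∀ x → f x ≤ g x) → ∑ᴸ xs f ≤ ∑ᴸ xs g
      ∑ᴸ-mono []       h = ≤-refl
      ∑ᴸ-mono (x ∷ xs) h = +-mono (h x) (∑ᴸ-mono xs h)

      ∑ᴸ-0 : ∀ (xs : List A) → ∑ᴸ xs (λ _ → 0#) ≈ 0#
      ∑ᴸ-0 []       = ≈-refl
      ∑ᴸ-0 (x ∷ xs) = trans (+-identityˡ _) (∑ᴸ-0 xs)

      ∑ᴸ-+ : ∀ xs (f g : A → Carrier) → ∑ᴸ xs (λ x → f x + g x) ≈ ∑ᴸ xs f + ∑ᴸ xs g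
      ∑ᴸ-+ []       f g = sym (+-identityˡ 0#)
      ∑ᴸ-+ (x ∷ xs) f g = trans (+-congˡ (∑ᴸ-+ xs f g)) (+-interchange _ _ _ _)

      ∑ᴸ-*ˡ : ∀ xs c (f : A → Carrier) → ∑ᴸ xs (λ x → c * f x) ≈ c * ∑ᴸ xs f
      ∑ᴸ-*ˡ []       c f = sym (zeroʳ c)
      ∑ᴸ-*ˡ (x ∷ xs) c f = trans (+-congˡ (∑ᴸ-*ˡ xs c f)) (sym (distribˡ _ _ _))

      ∑ᴸ-++ : ∀ xs ys (f : A → Carrier) → ∑ᴸ (xs ++ ys) f ≈ ∑ᴸ xs f + ∑ᴸ ys f
      ∑ᴸ-++ []       ys f = sym (+-identityˡ _)
      ∑ᴸ-++ (x ∷ xs) ys f = trans (+-congˡ (∑ᴸ-++ xs ys f)) (sym (+-assoc _ _ _))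

    ∑ᴸ-map : ∀ {A B : Set} (g : A → B) xs (f : B → Carrier) → ∑ᴸ (map g xs) f ≡ ∑ᴸ xs (f ∘ g)
    ∑ᴸ-map g []       f = refl
    ∑ᴸ-map g (x ∷ xs) f = ≡.cong (f (g x) +_) (∑ᴸ-map g xs f)

    ∑ᴸ-product : ∀ {A B C : Set} (g : A → B → C) xs ys (f : C → Carrier) →
                 ∑ᴸ (cartesianProductWith g xs ys) f ≈ ∑ᴸ xs (λ x → ∑ᴸ ys (λ y → f (g x y)))
    ∑ᴸ-product g []       ys f = ≈-refl
    ∑ᴸ-product g (x ∷ xs) ys f = trans (∑ᴸ-++ (map (g x) ys) _ f)
      (+-cong (reflexive (∑ᴸ-map (g x) ys f)) (∑ᴸ-product g xs ys f))

    ∑ᴸ-swap : ∀ {A B : Set} (xs : List A) (ys : List B) (f : A → B → Carrier) →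
              ∑ᴸ xs (λ x → ∑ᴸ ys (f x)) ≈ ∑ᴸ ys (λ y → ∑ᴸ xs (λ x → f x y))
    ∑ᴸ-swap []       ys f = sym (∑ᴸ-0 ys)
    ∑ᴸ-swap (x ∷ xs) ys f = trans (+-congˡ (∑ᴸ-swap xs ys f))
      (sym (∑ᴸ-+ ys (f x) (λ y → ∑ᴸ xs (λ x → f x y))))

    indicator : ∀ {P : Set} → Dec P → Carrier
    indicator (yes _) = 1#
    indicator (no  _) = 0#

    -- collapse says that every element is listed exactly once.
    record Finite (A : Set) : Set where
      infix 4 _≟_
      field
        elems    : List A
        _≟_      : DecidableEquality A
        collapse : ∀ x (f : A → Carrier) → ∑ᴸ elems (λ y → indicator (x ≟ y) * f y) ≈ f x

    open Finite {{...}} using (_≟_) public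

    opaque
      δ : ∀ {A : Set} {{_ : Finite A}} → A → A → Carrier
      δ x y = indicator (x ≟ y)

      ∑ : ∀ {A : Set} {{_ : Finite A}} → (A → Carrier) → Carrier
      ∑ {{fin}} = ∑ᴸ (Finite.elems fin)

    syntax ∑ (λ x → e) = ∑[ x ] e
    infix 5 ∑

    opaque
      unfolding δ ∑

      δ-yes : ∀ {A : Set} {{_ : Finite A}} {x y : A} → x ≡ y → δ x y ≈ 1#
      δ-yes {x = x} {y} x≡y with x ≟ y
      ... | yes _   = ≈-refl
      ... | no  x≢y = contradiction x≡y x≢y

      δ-no : ∀ {A : Set} {{_ : Finite A}} {x y : A} → ¬ (x ≡ y) → δ x y ≈ 0#
      δ-no {x = x} {y} x≢y with x ≟ y
      ... | yes x≡y = contradiction x≡y x≢y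
      ... | no  _   = ≈-refl

    δ-iff : ∀ {A B : Set} {{_ : Finite A}} {{_ : Finite B}} {x y : A} {u v : B} →
            (x ≡ y → u ≡ v) → (u ≡ v → x ≡ y) → δ x y ≈ δ u v
    δ-iff {x = x} {y} {u} {v} to from with x ≟ y
    ... | yes x≡y = trans (δ-yes x≡y) (sym (δ-yes (to x≡y)))
    ... | no  x≢y = trans (δ-no x≢y) (sym (δ-no (x≢y ∘ from)))

    δ-sym : ∀ {A : Set} {{_ : Finite A}} (x y : A) → δ x y ≈ δ y x
    δ-sym x y = δ-iff ≡.sym ≡.sym

    opaque
      unfolding δ ∑

      δ-nonNeg : ∀ {A : Set} {{_ : Finite A}} (x y : A) → 0# ≤ δ x y
      δ-nonNeg x y with x ≟ y
      ... | yes _ = <⇒≤ 0<1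
      ... | no  _ = ≤-refl

      δ≤1 : ∀ {A : Set} {{_ : Finite A}} (x y : A) → δ x y ≤ 1#
      δ≤1 x y with x ≟ y
      ... | yes _ = ≤-refl
      ... | no  _ = <⇒≤ 0<1

    *-monoʳ : ∀ {x y z} → 0# ≤ x → y ≤ z → y * x ≤ z * x
    *-monoʳ 0≤x y≤z = ≤-respˡ-≈ (*-comm _ _) (≤-respʳ-≈ (*-comm _ _) (*-monoˡ 0≤x y≤z))

    module _ {A : Set} {{_ : Finite A}} where

      opaque
        unfolding δ ∑

        ∑-cong : ∀ {f g : A → Carrier} → (∀ x → f x ≈ g x) → ∑ f ≈ ∑ g
        ∑-cong = ∑ᴸ-cong (Finite.elems it)

        ∑-mono : ∀ {f g : A → Carrier} → (∀ x → f x ≤ g x) → ∑ f ≤ ∑ g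
        ∑-mono = ∑ᴸ-mono (Finite.elems it)

        ∑-0 : ∑ {A} (λ _ → 0#) ≈ 0#
        ∑-0 = ∑ᴸ-0 (Finite.elems it)

        ∑-+ : ∀ (f g : A → Carrier) → ∑ (λ x → f x + g x) ≈ ∑ f + ∑ g
        ∑-+ = ∑ᴸ-+ (Finite.elems it)

        ∑-*ˡ : ∀ c (f : A → Carrier) → ∑ (λ x → c * f x) ≈ c * ∑ f
        ∑-*ˡ = ∑ᴸ-*ˡ (Finite.elems it)

        ∑-δˡ : ∀ x (f : A → Carrier) → ∑ (λ y → δ x y * f y) ≈ f x
        ∑-δˡ = Finite.collapse it

      ∑-≈0 : ∀ {f : A → Carrier} → (∀ x → f x ≈ 0#) → ∑ f ≈ 0#
      ∑-≈0 h = trans (∑-cong h) ∑-0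

      ∑-nonNeg : ∀ {f : A → Carrier} → (∀ x → 0# ≤ f x) → 0# ≤ ∑ f
      ∑-nonNeg h = ≤-respˡ-≈ ∑-0 (∑-mono h)

      ∑-*ʳ : ∀ c (f : A → Carrier) → ∑ (λ x → f x * c) ≈ ∑ f * c
      ∑-*ʳ c f = trans (∑-cong λ x → *-comm _ _) (trans (∑-*ˡ c f) (*-comm _ _))

      ∑-neg : ∀ (f : A → Carrier) → ∑ (λ x → - f x) ≈ - ∑ f
      ∑-neg f = begin
        ∑ (λ x → - f x)       ≈⟨ ∑-cong (λ x → solve 1 (λ a → :- a := (:- :1) :* a) refl (f x)) ⟩
        ∑ (λ x → (- 1#) * f x) ≈⟨ ∑-*ˡ (- 1#) f ⟩
        (- 1#) * ∑ f          ≈⟨ solve 1 (λ a → (:- :1) :* a := :- a) refl (∑ f) ⟩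
        - ∑ f                 ∎

      ∑-δʳ : ∀ x (f : A → Carrier) → ∑ (λ y → f y * δ x y) ≈ f x
      ∑-δʳ x f = trans (∑-cong λ y → *-comm _ _) (∑-δˡ x f)

      ∑-δ : ∀ (x : A) → ∑ (λ y → δ x y) ≈ 1#
      ∑-δ x = trans (∑-cong λ y → sym (*-identityʳ _)) (∑-δˡ x (λ _ → 1#))

      term≤∑ : ∀ {f : A → Carrier} → (∀ x → 0# ≤ f x) → ∀ x → f x ≤ ∑ f
      term≤∑ {f} 0≤f x = ≤-respˡ-≈ (∑-δˡ x f) (∑-mono λ y →
        ≤-respʳ-≈ (*-identityˡ _) (*-monoʳ (0≤f y) (δ≤1 x y)))

      ∑≈0⇒≈0 : ∀ {f : A → Carrier} → (∀ x → 0# ≤ f x) → ∑ f ≤ 0# → ∀ x → f x ≈ 0#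
      ∑≈0⇒≈0 0≤f ∑≤0 x = antisym (≤-trans (term≤∑ 0≤f x) ∑≤0) (0≤f x)

    opaque
      unfolding ∑

      ∑-swap : ∀ {A B : Set} {{_ : Finite A}} {{_ : Finite B}} (f : A → B → Carrier) →
               ∑ (λ x → ∑ (f x)) ≈ ∑ (λ y → ∑ (λ x → f x y))
      ∑-swap {{fin}} {{fin′}} f = ∑ᴸ-swap (Finite.elems fin) (Finite.elems fin′) f

    words : ∀ {A : Set} → List A → ∀ s → List (Vec A s)
    words xs zero    = [] ∷ []
    words xs (suc s) = cartesianProductWith _∷_ xs (words xs s)

    private
     opaque
      unfolding δ ∑

      indicator-∷ : ∀ {A : Set} {{_ : Finite A}} {s} (x y : A) (u v : Vec A s) →
                    indicator (Vec.≡-dec _≟_ (x ∷ u) (y ∷ v)) ≈ δ x y * indicator (Vec.≡-dec _≟_ u v)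
      indicator-∷ x y u v with x ≟ y | Vec.≡-dec _≟_ u v
      ... | yes refl | yes _ = sym (*-identityˡ _)
      ... | yes refl | no  _ = sym (zeroʳ _)
      ... | no  _    | yes _ = sym (zeroˡ _)
      ... | no  _    | no  _ = sym (zeroˡ _)

      words-collapse : ∀ {A : Set} {{_ : Finite A}} {s} (u : Vec A s) (f : Vec A s → Carrier) →
        ∑ᴸ (words (Finite.elems it) s) (λ v → indicator (Vec.≡-dec _≟_ u v) * f v) ≈ f u
      words-collapse []      f = trans (+-identityʳ _) (*-identityˡ _)
      words-collapse {A} {{fin}} {suc s} (x ∷ u) f = begin
        ∑ᴸ (words (Finite.elems fin) (suc s)) (λ v → indicator (Vec.≡-dec _≟_ (x ∷ u) v) * f v)
          ≈⟨ ∑ᴸ-product _∷_ (Finite.elems fin) (words (Finite.elems fin) s) _ ⟩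
        ∑ (λ y → ∑ᴸ (words (Finite.elems fin) s) (λ v → indicator (Vec.≡-dec _≟_ (x ∷ u) (y ∷ v)) * f (y ∷ v)))
          ≈⟨ ∑-cong (λ y → ∑ᴸ-cong (words (Finite.elems fin) s) λ v → trans (*-congʳ (indicator-∷ x y u v)) (*-assoc _ _ _)) ⟩
        ∑ (λ y → ∑ᴸ (words (Finite.elems fin) s) (λ v → δ x y * (indicator (Vec.≡-dec _≟_ u v) * f (y ∷ v))))
          ≈⟨ ∑-cong (λ y → ∑ᴸ-*ˡ (words (Finite.elems fin) s) (δ x y) _) ⟩
        ∑ (λ y → δ x y * ∑ᴸ (words (Finite.elems fin) s) (λ v → indicator (Vec.≡-dec _≟_ u v) * f (y ∷ v)))
          ≈⟨ ∑-δˡ x _ ⟩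
        ∑ᴸ (words (Finite.elems fin) s) (λ v → indicator (Vec.≡-dec _≟_ u v) * f (x ∷ v))
          ≈⟨ words-collapse u (λ v → f (x ∷ v)) ⟩
        f (x ∷ u) ∎

    instance
      Bool-finite : Finite Bool
      Bool-finite = record
        { elems    = false ∷ true ∷ []
        ; _≟_      = Bool._≟_
        ; collapse = λ
          { false f → solve 2 (λ a b → :1 :* a :+ (con 0 :* b :+ con 0) := a) refl (f false) (f true)
          ; true  f → solve 2 (λ a b → con 0 :* a :+ (:1 :* b :+ con 0) := b) refl (f false) (f true) }
        }

      Vec-finite : ∀ {A : Set} {{_ : Finite A}} {s} → Finite (Vec A s)
      Vec-finite {{fin}} {s} = record
        { elems    = words (Finite.elems fin) s
        ; _≟_      = Vec.≡-dec _≟_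
        ; collapse = words-collapse
        }

    words-elements : ∀ n → words (false ∷ true ∷ []) n ≡ elements n
    words-elements zero    = refl
    words-elements (suc n) = ≡.cong (cartesianProductWith _∷_ (false ∷ true ∷ [])) (words-elements n)

    opaque
      unfolding δ ∑

      Σ≈∑ : ∀ n (f : Vec Bool n → Carrier) → Σ[ n ] f ≈ ∑ f
      Σ≈∑ n f = reflexive (≡.cong (λ xs → ∑ᴸ xs f) (≡.sym (words-elements n)))

      δ-∷ : ∀ {A : Set} {{_ : Finite A}} {s} (x y : A) (u v : Vec A s) →
            δ (x ∷ u) (y ∷ v) ≈ δ x y * δ u v
      δ-∷ = indicator-∷

      ∑-[] : ∀ {A : Set} {{_ : Finite A}} (f : Vec A 0 → Carrier) → ∑ f ≈ f []
      ∑-[] f = +-identityʳ _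

      ∑-∷ : ∀ {A : Set} {{_ : Finite A}} {s} (f : Vec A (suc s) → Carrier) →
            ∑ f ≈ ∑ (λ x → ∑ (λ v → f (x ∷ v)))
      ∑-∷ {{fin}} {s} f = ∑ᴸ-product _∷_ (Finite.elems fin) (words (Finite.elems fin) s) f

    -- Distributions of functions

    opaque
      push : ∀ {A B : Set} {{_ : Finite A}} {{_ : Finite B}} → (A → Carrier) → (A → B) → B → Carrier
      push μ f b = ∑ λ a → μ a * δ (f a) b

      push-def : ∀ {A B : Set} {{_ : Finite A}} {{_ : Finite B}} (μ : A → Carrier) (f : A → B) b →
                 push μ f b ≈ ∑ (λ a → μ a * δ (f a) b)
      push-def μ f b = ≈-refl

    module _ {A B : Set} {{_ : Finite A}} {{_ : Finite B}} where

      opaque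
        unfolding push

        push-cong : ∀ {μ ν : A → Carrier} {f g : A → B} → (∀ a → μ a ≈ ν a) → (∀ a → f a ≡ g a) →
                    ∀ b → push μ f b ≈ push ν g b
        push-cong {μ} {ν} {f} {g} μ≈ν f≡g b = ∑-cong λ a →
          *-cong (μ≈ν a) (reflexive (≡.cong (λ z → δ z b) (f≡g a)))

        push-nonNeg : ∀ {μ : A → Carrier} → (∀ a → 0# ≤ μ a) → ∀ (f : A → B) b → 0# ≤ push μ f b
        push-nonNeg 0≤μ f b = ∑-nonNeg λ a → *-pos (0≤μ a) (δ-nonNeg _ _)

        ∑-push : ∀ (μ : A → Carrier) (f : A → B) (φ : B → Carrier) →
                 ∑ (λ b → push μ f b * φ b) ≈ ∑ (λ a → μ a * φ (f a))
        ∑-push μ f φ = begin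
          ∑ (λ b → push μ f b * φ b)                    ≈⟨ ∑-cong (λ b → sym (∑-*ʳ (φ b) _)) ⟩
          ∑ (λ b → ∑ (λ a → (μ a * δ (f a) b) * φ b))   ≈⟨ ∑-swap _ ⟩
          ∑ (λ a → ∑ (λ b → (μ a * δ (f a) b) * φ b))   ≈⟨ ∑-cong (λ a → ∑-cong λ b → *-assoc _ _ _) ⟩
          ∑ (λ a → ∑ (λ b → μ a * (δ (f a) b * φ b)))   ≈⟨ ∑-cong (λ a → ∑-*ˡ (μ a) _) ⟩
          ∑ (λ a → μ a * ∑ (λ b → δ (f a) b * φ b))     ≈⟨ ∑-cong (λ a → *-congˡ (∑-δˡ (f a) φ)) ⟩
          ∑ (λ a → μ a * φ (f a))                       ∎

        ∑-push-mass : ∀ (μ : A → Carrier) (f : A → B) → ∑ (push μ f) ≈ ∑ μ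
        ∑-push-mass μ f = trans (∑-cong λ b → sym (*-identityʳ _))
          (trans (∑-push μ f (λ _ → 1#)) (∑-cong λ a → *-identityʳ _))

    opaque
      unfolding push

      push-push : ∀ {A B C : Set} {{_ : Finite A}} {{_ : Finite B}} {{_ : Finite C}}
                  (μ : A → Carrier) (f : A → B) (g : B → C) →
                  ∀ c → push (push μ f) g c ≈ push μ (g ∘ f) c
      push-push μ f g c = ∑-push μ f (λ b → δ (g b) c)

      push-marginal : ∀ {A B : Set} {{_ : Finite A}} {{_ : Finite B}} {s}
                      (μ : A → Carrier) (f : A → B) (g : A → Vec B s) →
                      ∀ v → ∑ (λ b → push μ (λ a → f a ∷ g a) (b ∷ v)) ≈ push μ g v
      push-marginal μ f g v = begin
        ∑ (λ b → ∑ (λ a → μ a * δ (f a ∷ g a) (b ∷ v)))  ≈⟨ ∑-swap _ ⟩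
        ∑ (λ a → ∑ (λ b → μ a * δ (f a ∷ g a) (b ∷ v)))
          ≈⟨ ∑-cong (λ a → ∑-cong λ b → *-congˡ (trans (δ-∷ (f a) b (g a) v) (*-comm _ _))) ⟩
        ∑ (λ a → ∑ (λ b → μ a * (δ (g a) v * δ (f a) b)))
          ≈⟨ ∑-cong (λ a → trans (∑-*ˡ (μ a) _) (*-congˡ (trans (∑-*ˡ (δ (g a) v) _)
               (trans (*-congˡ (∑-δ (f a))) (*-identityʳ _))))) ⟩
        ∑ (λ a → μ a * δ (g a) v) ∎

  -- Entropy of finite measures and its submodularity

  log-nonPos : ∀ {x} → x ≤ 0# → log x ≈ 0#
  log-nonPos {x} x≤0 with x ≤? 0# | total 1# x
  ... | yes _   | _ = ≈-refl
  ... | no  0<x | _ = contradiction x≤0 0<x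

  log-resp-≈ : ∀ {x y} → x ≈ y → log x ≈ log y
  log-resp-≈ {x} {y} x≈y = by (x ≤? 0#)
    where
    by : Dec (x ≤ 0#) → log x ≈ log y
    by (yes x≤0) = trans (log-nonPos x≤0) (sym (log-nonPos (≤-respˡ-≈ x≈y x≤0)))
    by (no 0<x)  = log-cong 0<x x≈y

  -- The factor `p` vanishes together with `p`, so that `h` is zero at zero without a case
  -- distinction; on nonnegative arguments it agrees with `entropyTerm`.
  h : Carrier → Carrier
  h p = - (p * log p)

  h-cong : ∀ {x y} → x ≈ y → h x ≈ h y
  h-cong x≈y = -‿cong (*-cong x≈y (log-resp-≈ x≈y))

  h-0 : h 0# ≈ 0#
  h-0 = solve 1 (λ a → :- (con 0 :* a) := con 0) refl _

  h-≈0 : ∀ {x} → x ≈ 0# → h x ≈ 0#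
  h-≈0 x≈0 = trans (h-cong x≈0) h-0

  entropyTerm≈h : ∀ {p} → 0# ≤ p → entropyTerm p ≈ h p
  entropyTerm≈h {p} 0≤p = by (p ≤? 0#)
    where
    zero-case : p ≤ 0# → entropyTerm p ≈ 0#
    zero-case p≤0 with p ≤? 0#
    ... | yes _   = ≈-refl
    ... | no  0<p = contradiction p≤0 0<p
    positive-case : 0# < p → entropyTerm p ≈ p * log (p ⁻¹)
    positive-case 0<p with p ≤? 0#
    ... | yes p≤0 = contradiction p≤0 0<p
    ... | no  _   = ≈-refl
    by : Dec (p ≤ 0#) → entropyTerm p ≈ h p
    by (yes p≤0) = trans (zero-case p≤0) (sym (h-≈0 (antisym p≤0 0≤p)))
    by (no  0<p) = trans (positive-case 0<p) (trans (*-congˡ (log-⁻¹ 0<p)) (sym (-‿distribʳ-* _ _)))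

  h-* : ∀ {p q} → 0# ≤ p → 0# ≤ q → h (p * q) ≈ p * h q + q * h p
  h-* {p} {q} 0≤p 0≤q = by (p ≤? 0#) (q ≤? 0#)
    where
    by : Dec (p ≤ 0#) → Dec (q ≤ 0#) → h (p * q) ≈ p * h q + q * h p
    by (yes p≤0) _         = begin
      h (p * q)          ≈⟨ h-≈0 (trans (*-congʳ p≈0) (zeroˡ q)) ⟩
      0#                 ≈⟨ solve 2 (λ a b → con 0 := con 0 :* a :+ b :* con 0) refl (h q) q ⟩
      0# * h q + q * 0#  ≈⟨ +-cong (*-congʳ p≈0) (*-congˡ (h-≈0 p≈0)) ⟨
      p * h q + q * h p  ∎
      where
      p≈0 : p ≈ 0#
      p≈0 = antisym p≤0 0≤p
    by (no _)    (yes q≤0) = begin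
      h (p * q)          ≈⟨ h-≈0 (trans (*-congˡ q≈0) (zeroʳ p)) ⟩
      0#                 ≈⟨ solve 2 (λ a b → con 0 := b :* con 0 :+ con 0 :* a) refl (h p) p ⟩
      p * 0# + 0# * h p  ≈⟨ +-cong (*-congˡ (h-≈0 q≈0)) (*-congʳ q≈0) ⟨
      p * h q + q * h p  ∎
      where
      q≈0 : q ≈ 0#
      q≈0 = antisym q≤0 0≤q
    by (no 0<p)  (no 0<q)  = trans (-‿cong (*-congˡ (log-* 0<p 0<q)))
      (solve 4 (λ p q a b → :- ((p :* q) :* (a :+ b)) :=
           p :* (:- (q :* b)) :+ q :* (:- (p :* a))) refl p q (log p) (log q))

  -- This is `log t ≤ t - 1` for `t = a b / (c p)`, multiplied by `p`. In use `p` is an entry of a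
  -- joint distribution, `a` and `b` are its marginals and `c` is the total mass; the order
  -- hypotheses make all of them positive as soon as `p` is.
  gibbs : ∀ {p a b c} → 0# ≤ p → 0# ≤ a → 0# ≤ b → 0# ≤ c → p ≤ a → p ≤ b → a ≤ c →
          (p + h p) + p * (- log c) ≤ (p * (- log a) + p * (- log b)) + (a * b) * c ⁻¹
  gibbs {p} {a} {b} {c} 0≤p 0≤a 0≤b 0≤c p≤a p≤b a≤c = by (p ≤? 0#)
    where
    by : Dec (p ≤ 0#) → (p + h p) + p * (- log c) ≤ (p * (- log a) + p * (- log b)) + (a * b) * c ⁻¹
    by (yes p≤0) = ≤-trans (≤-reflexive (begin
      (p + h p) + p * (- log c)  ≈⟨ +-cong (+-cong p≈0 (h-≈0 p≈0)) (*-congʳ p≈0) ⟩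
      (0# + 0#) + 0# * (- log c)
        ≈⟨ solve 3 (λ i j k → (con 0 :+ con 0) :+ con 0 :* i :=
             con 0 :* j :+ con 0 :* k) refl _ (- log a) (- log b) ⟩
      0# * (- log a) + 0# * (- log b) ≈⟨ +-cong (*-congʳ p≈0) (*-congʳ p≈0) ⟨
      p * (- log a) + p * (- log b) ∎))
      (≤-respˡ-≈ (+-identityʳ _) (+-monoʳ _ (*-pos (*-pos 0≤a 0≤b) (⁻¹-nonNeg-total 0≤c))))
      where
      p≈0 : p ≈ 0#
      p≈0 = antisym p≤0 0≤p
    by (no 0<p) =
      linear 8 (λ p lp la lb lc lt pt r →
          1 ×≤ p :* lt :≤ p :* (pt :- :1)
        ⟹ 1 ×≤ p :* ((la :+ lb) :+ ((:- lc) :+ (:- lp))) :≤ p :* lt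
        ⟹ 1 ×≤ p :* pt :≤ r
        ⟹ ⊢ 1 ×≤ (p :+ :- (p :* lp)) :+ p :* (:- lc) :≤ (p :* (:- la) :+ p :* (:- lb)) :+ r) refl
        p (log p) (log a) (log b) (log c) (log t) t ((a * b) * c ⁻¹)
        (*-monoˡ 0≤p (log≤x-1 0<t))
        (≤-reflexive (*-congˡ (sym log-t)))
        (≤-reflexive p*t)
      where
      0<a = <-≤-trans 0<p p≤a
      0<b = <-≤-trans 0<p p≤b
      0<c = <-≤-trans 0<a a≤c
      t = (a * b) * (c ⁻¹ * p ⁻¹)
      0<t : 0# < t
      0<t = *-pos-strict (*-pos-strict 0<a 0<b) (*-pos-strict (⁻¹-pos 0<c) (⁻¹-pos 0<p))
      log-t : log t ≈ (log a + log b) + (- log c + - log p)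
      log-t = trans (log-* (*-pos-strict 0<a 0<b) (*-pos-strict (⁻¹-pos 0<c) (⁻¹-pos 0<p)))
        (+-cong (log-* 0<a 0<b) (trans (log-* (⁻¹-pos 0<c) (⁻¹-pos 0<p))
          (+-cong (log-⁻¹ 0<c) (log-⁻¹ 0<p))))
      p*t : p * t ≈ (a * b) * c ⁻¹
      p*t = begin
        p * ((a * b) * (c ⁻¹ * p ⁻¹))
          ≈⟨ solve 4 (λ p m i j → p :* (m :* (i :* j)) := (m :* i) :* (p :* j)) refl p (a * b) (c ⁻¹) (p ⁻¹) ⟩
        ((a * b) * c ⁻¹) * (p * p ⁻¹)  ≈⟨ *-congˡ (⁻¹-inverseʳ (>⇒≉ 0<p)) ⟩
        ((a * b) * c ⁻¹) * 1#          ≈⟨ *-identityʳ _ ⟩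
        (a * b) * c ⁻¹                 ∎

  E : ∀ {B : Set} {{_ : Finite B}} → (B → Carrier) → Carrier
  E p = ∑ λ b → h (p b)

  E-cong : ∀ {B : Set} {{_ : Finite B}} {p q : B → Carrier} → (∀ b → p b ≈ q b) → E p ≈ E q
  E-cong p≈q = ∑-cong λ b → h-cong (p≈q b)

  h-∑ : ∀ {A : Set} {{_ : Finite A}} (f : A → Carrier) → h (∑ f) ≈ ∑ (λ x → f x * - log (∑ f))
  h-∑ f = trans (-‿distribʳ-* _ _) (sym (∑-*ʳ _ f))

  module _ {B C : Set} {{_ : Finite B}} {{_ : Finite C}} (p : B → C → Carrier) (0≤p : ∀ b c → 0# ≤ p b c) where
    private
      row : B → Carrier
      row b = ∑ (p b)
      col : C → Carrier
      col c = ∑ λ b → p b c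
      tot : Carrier
      tot = ∑ row

      ∑∑ : (B → C → Carrier) → Carrier
      ∑∑ f = ∑ λ b → ∑ (f b)

      ∑∑-+ : ∀ f g → ∑∑ (λ b c → f b c + g b c) ≈ ∑∑ f + ∑∑ g
      ∑∑-+ f g = trans (∑-cong λ b → ∑-+ (f b) (g b)) (∑-+ _ _)

      rows : ∑∑ (λ b c → p b c * - log (row b)) ≈ E row
      rows = ∑-cong λ b → sym (h-∑ (p b))

      cols : ∑∑ (λ b c → p b c * - log (col c)) ≈ E col
      cols = trans (∑-swap _) (∑-cong λ c → sym (h-∑ λ b → p b c))

      total-h : ∑∑ (λ b c → p b c * - log tot) ≈ h tot
      total-h = trans (∑-cong λ b → ∑-*ʳ _ (p b)) (sym (h-∑ row))

      products : ∑∑ (λ b c → (row b * col c) * tot ⁻¹) ≈ tot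
      products = begin
        ∑∑ (λ b c → (row b * col c) * tot ⁻¹)  ≈⟨ ∑-cong (λ b → trans (∑-*ʳ _ _) (*-congʳ (∑-*ˡ (row b) col))) ⟩
        ∑ (λ b → (row b * ∑ col) * tot ⁻¹)     ≈⟨ trans (∑-*ʳ _ _) (*-congʳ (∑-*ʳ _ row)) ⟩
        (tot * ∑ col) * tot ⁻¹                 ≈⟨ *-congʳ (*-congˡ (∑-swap _)) ⟩
        (tot * tot) * tot ⁻¹                   ≈⟨ *-assoc _ _ _ ⟩
        tot * (tot * tot ⁻¹)                   ≈⟨ by (tot ≟ʳ 0#) ⟩
        tot                                    ∎
        where
        by : Dec (tot ≈ 0#) → tot * (tot * tot ⁻¹) ≈ tot
        by (yes t≈0) = trans (*-congʳ t≈0) (trans (zeroˡ _) (sym t≈0))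
        by (no t≉0)  = trans (*-congˡ (⁻¹-inverseʳ t≉0)) (*-identityʳ _)

      0≤row : ∀ b → 0# ≤ row b
      0≤row b = ∑-nonNeg (0≤p b)
      0≤col : ∀ c → 0# ≤ col c
      0≤col c = ∑-nonNeg λ b → 0≤p b c

    -- Nonnegativity of mutual information, for a measure of any total mass.
    marginals : ∑∑ (λ b c → h (p b c)) + h tot ≤ E row + E col
    marginals = linear 6 (λ t hp ht r c q →
              1 ×≤ (t :+ hp) :+ ht :≤ (r :+ c) :+ q
            ⟹ 1 ×≤ q :≤ t
            ⟹ ⊢ 1 ×≤ hp :+ ht :≤ r :+ c) refl
      _ _ _ _ _ _
      (≤-respˡ-≈ (trans (∑∑-+ _ _) (+-cong (∑∑-+ _ _) total-h))
        (≤-respʳ-≈ (trans (∑∑-+ _ _) (+-congʳ (trans (∑∑-+ _ _) (+-cong rows cols))))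
          (∑-mono λ b → ∑-mono λ c → gibbs (0≤p b c) (0≤row b) (0≤col c) (∑-nonNeg 0≤row)
            (term≤∑ (0≤p b) c) (term≤∑ (λ b → 0≤p b c) b) (term≤∑ 0≤row b))))
      (≤-reflexive products)

  E-∷ : ∀ {A : Set} {{_ : Finite A}} {s} (p : Vec A (suc s) → Carrier) →
        E p ≈ ∑ λ v → ∑ λ x → h (p (x ∷ v))
  E-∷ p = trans (∑-∷ _) (∑-swap _)

  module _ {A : Set} {{_ : Finite A}} {μ : A → Carrier} (0≤μ : ∀ a → 0# ≤ μ a) where

    E-push : ∀ {B : Set} {{_ : Finite B}} (f : A → B) →
             E (push μ f) ≈ ∑ λ a → μ a * - log (push μ f (f a))
    E-push f = trans (∑-cong λ b → -‿distribʳ-* _ _) (∑-push μ f (λ b → - log (push μ f b)))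

    -- Both entropies average, over `a`, minus the logarithm of the mass of the fibre through `a`,
    -- and `f` and `g` have the same fibres.
    E-equivalent : ∀ {B C : Set} {{_ : Finite B}} {{_ : Finite C}} (f : A → B) (g : A → C) →
                   (∀ a a′ → f a ≡ f a′ → g a ≡ g a′) → (∀ a a′ → g a ≡ g a′ → f a ≡ f a′) →
                   E (push μ f) ≈ E (push μ g)
    E-equivalent f g to from = begin
      E (push μ f)                              ≈⟨ E-push f ⟩
      ∑ (λ a → μ a * - log (push μ f (f a)))    ≈⟨ ∑-cong (λ a → *-congˡ (-‿cong (log-resp-≈ (same a)))) ⟩
      ∑ (λ a → μ a * - log (push μ g (g a)))    ≈⟨ E-push g ⟨
      E (push μ g)                              ∎
      where
      same : ∀ a → push μ f (f a) ≈ push μ g (g a)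
      same a = trans (push-def μ f _) (trans (∑-cong λ a′ → *-congˡ (δ-iff (to a′ a) (from a′ a)))
        (sym (push-def μ g _)))

    -- For each value `v` of `Z` the joint law of `X` and `Y` on the fibre is a measure of mass
    -- `push μ Z v`, to which `marginals` applies without normalisation; the result is summed over
    -- `v`.
    submodular : ∀ {B : Set} {{_ : Finite B}} {s} (X Y : A → B) (Z : A → Vec B s) →
      E (push μ (λ a → X a ∷ Y a ∷ Z a)) + E (push μ Z) ≤
      E (push μ (λ a → X a ∷ Z a)) + E (push μ (λ a → Y a ∷ Z a))
    submodular {B} {s = s} X Y Z = ≤-respˡ-≈ (sym lhs) (≤-respʳ-≈ rhs
      (∑-mono λ v → marginals (λ x y → P x y v) λ x y → push-nonNeg 0≤μ _ _))
      where
      P : B → B → Vec B s → Carrier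
      P x y v = push μ (λ a → X a ∷ Y a ∷ Z a) (x ∷ y ∷ v)
      second : ∀ x v → ∑ (λ y → P x y v) ≈ push μ (λ a → X a ∷ Z a) (x ∷ v)
      second x v = trans
        (∑-cong λ y → trans (push-def μ _ _) (trans (∑-cong λ a → *-congˡ (δ-iff exchange exchange)) (sym (push-def μ _ _))))
        (push-marginal μ Y (λ a → X a ∷ Z a) (x ∷ v))
        where
        exchange : ∀ {x y x′ y′ : B} {v v′ : Vec B s} → x ∷ y ∷ v ≡ x′ ∷ y′ ∷ v′ → y ∷ x ∷ v ≡ y′ ∷ x′ ∷ v′
        exchange refl = refl
      first : ∀ y v → ∑ (λ x → P x y v) ≈ push μ (λ a → Y a ∷ Z a) (y ∷ v)
      first y v = push-marginal μ X (λ a → Y a ∷ Z a) (y ∷ v)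
      both : ∀ v → ∑ (λ x → ∑ (λ y → P x y v)) ≈ push μ Z v
      both v = trans (∑-cong λ x → second x v) (push-marginal μ X Z v)
      lhs : E (push μ (λ a → X a ∷ Y a ∷ Z a)) + E (push μ Z) ≈
            ∑ (λ v → ∑ (λ x → ∑ (λ y → h (P x y v))) + h (∑ (λ x → ∑ (λ y → P x y v))))
      lhs = sym (trans (∑-+ _ _) (+-cong
        (trans (∑-cong λ v → ∑-swap _) (trans (∑-swap _) (trans (∑-cong λ y → ∑-swap _)
          (trans (∑-swap _) (sym (trans (∑-∷ _) (∑-cong λ x → ∑-∷ _)))))))
        (∑-cong λ v → h-cong (both v))))
      rhs : ∑ (λ v → E (λ x → ∑ (λ y → P x y v)) + E (λ y → ∑ (λ x → P x y v))) ≈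
            E (push μ (λ a → X a ∷ Z a)) + E (push μ (λ a → Y a ∷ Z a))
      rhs = trans (∑-+ _ _) (+-cong
        (trans (∑-cong λ v → ∑-cong λ x → h-cong (second x v)) (sym (E-∷ _)))
        (trans (∑-cong λ v → ∑-cong λ y → h-cong (first y v)) (sym (E-∷ _))))

  -- Entropies of families of linear forms

  module _ {n : ℕ} where

    H : ∀ {r s} → (Vec (Vec Bool n) r → Carrier) → Vec (Form r) s → Carrier
    H μ A = E (push μ (evalAll A))

    module _ {r} {μ : Vec (Vec Bool n) r → Carrier} (0≤μ : ∀ ω → 0# ≤ μ ω) where

      -- Families with the same span determine each other. Both inclusions are decided by
      -- computation, so that a use only has to name the families.
      H-≡ : ∀ {s t} (A : Vec (Form r) s) (B : Vec (Form r) t) →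
            {_ : True (A ⊒? B)} {_ : True (B ⊒? A)} → H μ A ≈ H μ B
      H-≡ A B {p} {q} = E-equivalent 0≤μ (evalAll A) (evalAll B)
        (⊒-sound A B (toWitness p)) (⊒-sound B A (toWitness q))

      H-single : ∀ a → H μ (a ∷ []) ≈ E (push μ ⟨ a ,_⟩)
      H-single a = E-equivalent 0≤μ _ _ (λ _ _ eq → Vec.∷-injectiveˡ eq) (λ _ _ → ≡.cong (_∷ []))

      -- The families X, Y, Z and W stand in the place of (a,C), (b,C), (a,b,C) and C.
      H-submodular : ∀ {s t u v w} (a b : Form r) (C : Vec (Form r) s) →
        (X : Vec (Form r) t) (Y : Vec (Form r) u) (Z : Vec (Form r) v) (W : Vec (Form r) w) →
        {_ : True (a ∷ C ⊒? X)} {_ : True (X ⊒? a ∷ C)} {_ : True (b ∷ C ⊒? Y)} {_ : True (Y ⊒? b ∷ C)}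
        {_ : True (a ∷ b ∷ C ⊒? Z)} {_ : True (Z ⊒? a ∷ b ∷ C)} {_ : True (C ⊒? W)} {_ : True (W ⊒? C)} →
        H μ Z + H μ W ≤ H μ X + H μ Y
      H-submodular a b C X Y Z W {p} {p′} {q} {q′} {x} {x′} {y} {y′} =
        ≤-respˡ-≈ (+-cong (H-≡ (a ∷ b ∷ C) Z {x} {x′}) (H-≡ C W {y} {y′}))
          (≤-respʳ-≈ (+-cong (H-≡ (a ∷ C) X {p} {p′}) (H-≡ (b ∷ C) Y {q} {q′}))
            (submodular 0≤μ ⟨ a ,_⟩ ⟨ b ,_⟩ (evalAll C)))

  -- Products of independent random variables

  open RandomVariable

  module _ {n : ℕ} where

    infixr 7 _⊗_
    _⊗_ : ∀ {r} → RandomVariable n → (Vec (Vec Bool n) r → Carrier) → Vec (Vec Bool n) (suc r) → Carrier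
    (X ⊗ μ) (x ∷ ω) = pmf X x * μ ω

    ∏ : ∀ {r} → Vec (RandomVariable n) r → Vec (Vec Bool n) r → Carrier
    ∏ []       _ = 1#
    ∏ (X ∷ Xs)   = X ⊗ ∏ Xs

    pmf-mass : ∀ (X : RandomVariable n) → ∑ (pmf X) ≈ 1#
    pmf-mass X = trans (sym (Σ≈∑ n (pmf X))) (normalised X)

    ⊗-nonNeg : ∀ {r} (X : RandomVariable n) {μ : Vec (Vec Bool n) r → Carrier} →
               (∀ ω → 0# ≤ μ ω) → ∀ ω → 0# ≤ (X ⊗ μ) ω
    ⊗-nonNeg X 0≤μ (x ∷ ω) = *-pos (nonNeg X x) (0≤μ ω)

    ∏-nonNeg : ∀ {r} (Xs : Vec (RandomVariable n) r) ω → 0# ≤ ∏ Xs ω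
    ∏-nonNeg []       ω = <⇒≤ 0<1
    ∏-nonNeg (X ∷ Xs) ω = ⊗-nonNeg X (∏-nonNeg Xs) ω

    ⊗-∑ : ∀ {r} (X : RandomVariable n) (μ : Vec (Vec Bool n) r → Carrier) (φ : Vec (Vec Bool n) (suc r) → Carrier) →
          ∑ (λ ω → (X ⊗ μ) ω * φ ω) ≈ ∑ (λ x → pmf X x * ∑ (λ ω → μ ω * φ (x ∷ ω)))
    ⊗-∑ X μ φ = trans (∑-∷ _) (∑-cong λ x → trans (∑-cong λ ω → *-assoc _ _ _) (∑-*ˡ _ _))

    ∑-mass : ∀ (X : RandomVariable n) c → ∑ (λ x → pmf X x * c) ≈ c
    ∑-mass X c = trans (∑-*ʳ c _) (trans (*-congʳ (pmf-mass X)) (*-identityˡ c))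

    ∏-mass : ∀ {r} (Xs : Vec (RandomVariable n) r) → ∑ (∏ Xs) ≈ 1#
    ∏-mass []       = ∑-[] _
    ∏-mass (X ∷ Xs) = trans (∑-cong λ ω → sym (*-identityʳ _)) (trans (⊗-∑ X (∏ Xs) (λ _ → 1#))
      (trans (∑-cong λ x → *-congˡ (trans (∑-cong λ ω → *-identityʳ _) (∏-mass Xs))) (∑-mass X 1#)))

    𝔼 : ∀ {r} → Vec (RandomVariable n) r → (Vec (Vec Bool n) r → Carrier) → Carrier
    𝔼 Xs φ = ∑ λ ω → ∏ Xs ω * φ ω

    -- Fubini, one coordinate at a time. The factor that does not depend on the coordinate is frozen
    -- at the value `𝟎` there and taken out of the sum.
    independent : ∀ {r} (Xs : Vec (RandomVariable n) r) (t : Vec Bool r) φ ψ →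
                  (∀ {ω ω′} → Agree t ω ω′ → φ ω ≈ φ ω′) → (∀ {ω ω′} → Agree (Vec.map not t) ω ω′ → ψ ω ≈ ψ ω′) →
                  𝔼 Xs (λ ω → φ ω * ψ ω) ≈ 𝔼 Xs φ * 𝔼 Xs ψ
    independent [] [] φ ψ _ _ = trans (∑-[] _) (trans
      (solve 2 (λ a b → :1 :* (a :* b) := (:1 :* a) :* (:1 :* b)) refl _ _)
      (sym (*-cong (∑-[] _) (∑-[] _))))
    independent (X ∷ Xs) (true ∷ t) φ ψ φ-resp ψ-resp = begin
      𝔼 (X ∷ Xs) (λ ω → φ ω * ψ ω)                                        ≈⟨ ⊗-∑ X (∏ Xs) _ ⟩
      ∑ (λ x → pmf X x * 𝔼 Xs (λ ω → φ (x ∷ ω) * ψ (x ∷ ω)))               ≈⟨ ∑-cong (λ x → *-congˡ (step x)) ⟩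
      ∑ (λ x → pmf X x * (𝔼 Xs (λ ω → φ (x ∷ ω)) * 𝔼 Xs (λ ω → ψ (𝟎 ∷ ω))))
        ≈⟨ ∑-cong (λ x → sym (*-assoc _ _ _)) ⟩
      ∑ (λ x → (pmf X x * 𝔼 Xs (λ ω → φ (x ∷ ω))) * 𝔼 Xs (λ ω → ψ (𝟎 ∷ ω))) ≈⟨ ∑-*ʳ _ _ ⟩
      ∑ (λ x → pmf X x * 𝔼 Xs (λ ω → φ (x ∷ ω))) * 𝔼 Xs (λ ω → ψ (𝟎 ∷ ω))   ≈⟨ *-cong (⊗-∑ X (∏ Xs) φ) constant ⟨
      𝔼 (X ∷ Xs) φ * 𝔼 (X ∷ Xs) ψ                                         ∎
      where
      step : ∀ x → 𝔼 Xs (λ ω → φ (x ∷ ω) * ψ (x ∷ ω)) ≈ 𝔼 Xs (λ ω → φ (x ∷ ω)) * 𝔼 Xs (λ ω → ψ (𝟎 ∷ ω))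
      step x = trans (∑-cong λ ω → *-congˡ (*-congˡ (ψ-resp (agree-refl (Vec.map not t) ω))))
        (independent Xs t (λ ω → φ (x ∷ ω)) (λ ω → ψ (𝟎 ∷ ω)) (λ eq → φ-resp (refl , eq)) ψ-resp)
      constant : 𝔼 (X ∷ Xs) ψ ≈ 𝔼 Xs (λ ω → ψ (𝟎 ∷ ω))
      constant = trans (⊗-∑ X (∏ Xs) ψ) (trans
        (∑-cong λ x → *-congˡ (∑-cong λ ω → *-congˡ (ψ-resp (agree-refl (Vec.map not t) ω)))) (∑-mass X _))
    independent (X ∷ Xs) (false ∷ t) φ ψ φ-resp ψ-resp = begin
      𝔼 (X ∷ Xs) (λ ω → φ ω * ψ ω)                                        ≈⟨ ⊗-∑ X (∏ Xs) _ ⟩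
      ∑ (λ x → pmf X x * 𝔼 Xs (λ ω → φ (x ∷ ω) * ψ (x ∷ ω)))               ≈⟨ ∑-cong (λ x → *-congˡ (step x)) ⟩
      ∑ (λ x → pmf X x * (𝔼 Xs (λ ω → φ (𝟎 ∷ ω)) * 𝔼 Xs (λ ω → ψ (x ∷ ω))))
        ≈⟨ ∑-cong (λ x → solve 3 (λ p a b → p :* (a :* b) := a :* (p :* b)) refl _ _ _) ⟩
      ∑ (λ x → 𝔼 Xs (λ ω → φ (𝟎 ∷ ω)) * (pmf X x * 𝔼 Xs (λ ω → ψ (x ∷ ω)))) ≈⟨ ∑-*ˡ _ _ ⟩
      𝔼 Xs (λ ω → φ (𝟎 ∷ ω)) * ∑ (λ x → pmf X x * 𝔼 Xs (λ ω → ψ (x ∷ ω)))   ≈⟨ *-cong constant (⊗-∑ X (∏ Xs) ψ) ⟨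
      𝔼 (X ∷ Xs) φ * 𝔼 (X ∷ Xs) ψ                                         ∎
      where
      step : ∀ x → 𝔼 Xs (λ ω → φ (x ∷ ω) * ψ (x ∷ ω)) ≈ 𝔼 Xs (λ ω → φ (𝟎 ∷ ω)) * 𝔼 Xs (λ ω → ψ (x ∷ ω))
      step x = trans (∑-cong λ ω → *-congˡ (*-congʳ (φ-resp (agree-refl t ω))))
        (independent Xs t (λ ω → φ (𝟎 ∷ ω)) (λ ω → ψ (x ∷ ω)) φ-resp (λ eq → ψ-resp (refl , eq)))
      constant : 𝔼 (X ∷ Xs) φ ≈ 𝔼 Xs (λ ω → φ (𝟎 ∷ ω))
      constant = trans (⊗-∑ X (∏ Xs) φ) (trans
        (∑-cong λ x → *-congˡ (∑-cong λ ω → *-congˡ (φ-resp (agree-refl t ω)))) (∑-mass X _))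

    independent-forms : ∀ {r s u} (Xs : Vec (RandomVariable n) r) (t : Vec Bool r)
      (A : Vec (Form r) s) (B : Vec (Form r) u) → masked t A ≡ A → masked (Vec.map not t) B ≡ B → ∀ x y →
      𝔼 Xs (λ ω → δ (evalAll A ω) x * δ (evalAll B ω) y) ≈ push (∏ Xs) (evalAll A) x * push (∏ Xs) (evalAll B) y
    independent-forms Xs t A B A≡ B≡ x y = trans
      (independent Xs t _ _ (λ eq → reflexive (≡.cong (λ z → δ z x) (evalAll-masked t A A≡ eq)))
                            (λ eq → reflexive (≡.cong (λ z → δ z y) (evalAll-masked _ B B≡ eq))))
      (sym (*-cong (push-def _ _ _) (push-def _ _ _)))

    E-product : ∀ {s} (p : Vec Bool n → Carrier) (q : Vec (Vec Bool n) s → Carrier) →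
                (∀ x → 0# ≤ p x) → (∀ v → 0# ≤ q v) → ∑ p ≈ 1# → ∑ q ≈ 1# →
                ∑ (λ x → ∑ (λ v → h (p x * q v))) ≈ E p + E q
    E-product p q 0≤p 0≤q ∑p ∑q = begin
      ∑ (λ x → ∑ (λ v → h (p x * q v)))                ≈⟨ ∑-cong (λ x → ∑-cong λ v → h-* (0≤p x) (0≤q v)) ⟩
      ∑ (λ x → ∑ (λ v → p x * h (q v) + q v * h (p x)))
        ≈⟨ ∑-cong (λ x → trans (∑-+ _ _) (+-cong (∑-*ˡ _ _) (∑-*ʳ _ _))) ⟩
      ∑ (λ x → p x * E q + ∑ q * h (p x))              ≈⟨ trans (∑-+ _ _) (+-cong (∑-*ʳ _ _) (∑-*ˡ _ _)) ⟩
      ∑ p * E q + ∑ q * E p                            ≈⟨ +-cong (*-congʳ ∑p) (*-congʳ ∑q) ⟩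
      1# * E q + 1# * E p                              ≈⟨ solve 2 (λ a b → :1 :* b :+ :1 :* a := a :+ b) refl _ _ ⟩
      E p + E q                                        ∎

    H-independent : ∀ {r s} (Xs : Vec (RandomVariable n) r) (t : Vec Bool r) (a : Form r) (C : Vec (Form r) s) →
                    masked t (a ∷ []) ≡ a ∷ [] → masked (Vec.map not t) C ≡ C →
                    H (∏ Xs) (a ∷ C) ≈ H (∏ Xs) (a ∷ []) + H (∏ Xs) C
    H-independent Xs t a C a≡ C≡ = begin
      H (∏ Xs) (a ∷ C)
        ≈⟨ trans (∑-∷ _) (∑-cong λ x → ∑-cong λ v → h-cong (joint x v)) ⟩
      ∑ (λ x → ∑ (λ v → h (P (x ∷ []) * Q v)))
        ≈⟨ E-product (λ x → P (x ∷ [])) Q (λ x → push-nonNeg (∏-nonNeg Xs) _ _) (push-nonNeg (∏-nonNeg Xs) _)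
                                                         (trans (sym (single P)) massP) (trans (∑-push-mass _ _) (∏-mass Xs)) ⟩
      E (λ x → P (x ∷ [])) + E Q                    ≈⟨ +-congʳ (single (h ∘ P)) ⟨
      H (∏ Xs) (a ∷ []) + H (∏ Xs) C                ∎
      where
      P = push (∏ Xs) (evalAll (a ∷ []))
      Q = push (∏ Xs) (evalAll C)
      massP : ∑ P ≈ 1#
      massP = trans (∑-push-mass _ _) (∏-mass Xs)
      single : ∀ (f : Vec (Vec Bool n) 1 → Carrier) → ∑ f ≈ ∑ (λ x → f (x ∷ []))
      single f = trans (∑-∷ f) (∑-cong λ x → ∑-[] _)
      joint : ∀ x v → push (∏ Xs) (evalAll (a ∷ C)) (x ∷ v) ≈ P (x ∷ []) * Q v
      joint x v = trans (push-def _ _ _) (trans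
        (∑-cong λ ω → *-congˡ (trans (δ-∷ _ _ _ _) (*-congʳ (δ-iff (λ { refl → refl }) (λ { refl → refl })))))
        (independent-forms Xs t (a ∷ []) C a≡ C≡ (x ∷ []) v))

    -- Distributions of sums of independent variables

    -- The distribution of a form computes to an expression in the list of selected
    -- variables; forms that select the same list have convertible distributions.
    law : ∀ {r} → Vec (RandomVariable n) r → Form r → Vec Bool n → Carrier
    law []       []          g = δ 𝟎 g
    law (X ∷ Xs) (true  ∷ a) g = ∑ λ x → pmf X x * law Xs a (x ⊕ g)
    law (X ∷ Xs) (false ∷ a) g = law Xs a g

    δ-⊕ : ∀ (x y g : Vec Bool n) → δ (x ⊕ y) g ≈ δ y (x ⊕ g)
    δ-⊕ x y g = δ-iff ⊕-swap (λ eq → ≡.trans (≡.cong (x ⊕_) eq) (⊕-cancelˡ x g))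

    𝔼-law : ∀ {r} (Xs : Vec (RandomVariable n) r) a g → 𝔼 Xs (λ ω → δ ⟨ a , ω ⟩ g) ≈ law Xs a g
    𝔼-law []       []          g = trans (∑-[] _) (*-identityˡ _)
    𝔼-law (X ∷ Xs) (true  ∷ a) g = trans (⊗-∑ X (∏ Xs) _) (∑-cong λ x → *-congˡ
      (trans (∑-cong λ ω → *-congˡ (δ-⊕ x _ g)) (𝔼-law Xs a (x ⊕ g))))
    𝔼-law (X ∷ Xs) (false ∷ a) g = trans (⊗-∑ X (∏ Xs) _) (trans (∑-cong λ x → *-congˡ (𝔼-law Xs a g)) (∑-mass X _))

    H-law : ∀ {r} (Xs : Vec (RandomVariable n) r) a → H (∏ Xs) (a ∷ []) ≈ E (law Xs a)
    H-law Xs a = begin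
      H (∏ Xs) (a ∷ [])        ≈⟨ H-single (∏-nonNeg Xs) a ⟩
      E (push (∏ Xs) ⟨ a ,_⟩)  ≈⟨ E-cong (λ g → trans (push-def _ _ g) (𝔼-law Xs a g)) ⟩
      E (law Xs a)             ∎

    δ-⊕-zero : ∀ (x g : Vec Bool n) → δ 𝟎 (x ⊕ g) ≈ δ g x
    δ-⊕-zero x g = δ-iff (λ eq → ≡.trans (≡.sym (⊕-cancelˡ x g)) (≡.trans (≡.cong (x ⊕_) (≡.sym eq)) (⊕-identityʳ x)))
                         (λ { refl → ≡.sym (⊕-same g) })

    law-single : ∀ X g → law (X ∷ []) (true ∷ []) g ≈ pmf X g
    law-single X g = trans (∑-cong λ x → *-congˡ (δ-⊕-zero x g)) (∑-δʳ g (pmf X))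

    convolution : RandomVariable n → RandomVariable n → Vec Bool n → Carrier
    convolution X Y g = ∑ λ x → pmf X x * pmf Y (x ⊕ g)

    law-double : ∀ X Y g → law (X ∷ Y ∷ []) (true ∷ true ∷ []) g ≈ convolution X Y g
    law-double X Y g = ∑-cong λ x → *-congˡ (law-single Y (x ⊕ g))

    convolution-nonNeg : ∀ X Y g → 0# ≤ convolution X Y g
    convolution-nonNeg X Y g = ∑-nonNeg λ x → *-pos (nonNeg X x) (nonNeg Y _)

    ∑-⊕ : ∀ x (f : Vec Bool n → Carrier) → ∑ (λ g → f (x ⊕ g)) ≈ ∑ f
    ∑-⊕ x f = begin
      ∑ (λ g → f (x ⊕ g))                       ≈⟨ ∑-cong (λ g → ∑-δˡ (x ⊕ g) f) ⟨
      ∑ (λ g → ∑ (λ y → δ (x ⊕ g) y * f y))     ≈⟨ ∑-swap _ ⟩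
      ∑ (λ y → ∑ (λ g → δ (x ⊕ g) y * f y))     ≈⟨ ∑-cong (λ y → ∑-*ʳ _ _) ⟩
      ∑ (λ y → ∑ (λ g → δ (x ⊕ g) y) * f y)
        ≈⟨ ∑-cong (λ y → *-congʳ (trans (∑-cong λ g → trans (δ-⊕ x g y) (δ-sym _ _)) (∑-δ (x ⊕ y)))) ⟩
      ∑ (λ y → 1# * f y)                        ≈⟨ ∑-cong (λ y → *-identityˡ _) ⟩
      ∑ f                                       ∎

    convolution-comm : ∀ X Y g → convolution X Y g ≈ convolution Y X g
    convolution-comm X Y g = trans (sym (∑-⊕ g _)) (∑-cong λ x → trans (*-comm _ _)
      (*-cong (reflexive (≡.cong (pmf Y) (≡.trans (≡.cong (_⊕ g) (⊕-comm g x)) (⊕-cancelʳ x g))))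
              (reflexive (≡.cong (pmf X) (⊕-comm g x)))))

    -- The underscore stands for the summand in the definition of
    -- differencePmf, which has no name outside of it.
    mutual
      differencePmf≈convolution : ∀ X Y g → differencePmf X Y g ≈ convolution X Y g
      differencePmf≈convolution X Y g = trans (Σ≈∑ n _) (∑-cong λ x → trans (Σ≈∑ n _)
        (trans (∑-cong λ y → mass-δ X Y g x y) (trans (∑-*ˡ (pmf X x) _)
          (*-congˡ (∑-δʳ (x ⊕ g) (pmf Y))))))

      mass-δ : ∀ X Y g x y → _ ≈ pmf X x * (pmf Y y * δ (x ⊕ g) y)
      mass-δ X Y g x y with Vec.≡-dec Bool._≟_ (x ⊕ y) g
      ... | yes x⊕y≡g = sym (*-congˡ (trans (*-congˡ (δ-yes (≡.sym (⊕-swap x⊕y≡g)))) (*-identityʳ _)))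
      ... | no  x⊕y≢g = sym (trans (*-congˡ (trans (*-congˡ (δ-no λ { refl → x⊕y≢g (⊕-cancelˡ x g) })) (zeroʳ _))) (zeroʳ _))

    -- Twice the Ruzsa distance, so that no halves occur.
    dist : RandomVariable n → RandomVariable n → Carrier
    dist X Y = fromℕ 2 * E (convolution X Y) - E (pmf X) - E (pmf Y)

    entropy≈E : ∀ (p : Vec Bool n → Carrier) → (∀ x → 0# ≤ p x) → entropy p ≈ E p
    entropy≈E p 0≤p = trans (Σ≈∑ n _) (∑-cong λ x → entropyTerm≈h (0≤p x))

    2*½ : fromℕ 2 * ½ ≈ 1#
    2*½ = ⁻¹-inverseʳ (>⇒≉ (fromℕ-suc-pos 1))

    2d≈dist : ∀ X Y → fromℕ 2 * d[ X ⨾ Y ] ≈ dist X Y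
    2d≈dist X Y = begin
      fromℕ 2 * (e - ½ * 𝐇[ X ] - ½ * 𝐇[ Y ])
        ≈⟨ solve 4 (λ e t a b → con 2 :* (e :- t :* a :- t :* b) :=
             con 2 :* e :- (con 2 :* t) :* a :- (con 2 :* t) :* b) refl e ½ 𝐇[ X ] 𝐇[ Y ] ⟩
      fromℕ 2 * e - (fromℕ 2 * ½) * 𝐇[ X ] - (fromℕ 2 * ½) * 𝐇[ Y ]
        ≈⟨ +-cong (+-cong (*-congˡ e≈) (-‿cong (half X))) (-‿cong (half Y)) ⟩
      dist X Y ∎
      where
      e = entropy (differencePmf X Y)
      e≈ : e ≈ E (convolution X Y)
      e≈ = trans (entropy≈E _ λ g → ≤-respʳ-≈ (sym (differencePmf≈convolution X Y g)) (convolution-nonNeg X Y g))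
        (E-cong (differencePmf≈convolution X Y))
      half : ∀ Z → (fromℕ 2 * ½) * 𝐇[ Z ] ≈ E (pmf Z)
      half Z = trans (*-congʳ 2*½) (trans (*-identityˡ _) (entropy≈E _ (nonNeg Z)))

    dist-comm : ∀ X Y → dist X Y ≈ dist Y X
    dist-comm X Y = trans (+-congʳ (+-congʳ (*-congˡ (E-cong (convolution-comm X Y)))))
      (solve 3 (λ e a b → con 2 :* e :- a :- b := con 2 :* e :- b :- a) refl _ _ _)

    -- Adding an independent variable

    -- If `p` is the law of `(A , C)`, then `Q ⋆ p` is the law of `(Q + A , C)` with `Q` independent
    -- of `(A , C)`.
    infixr 7 _⋆_
    _⋆_ : ∀ {s} → RandomVariable n → (Vec (Vec Bool n) (suc s) → Carrier) → Vec (Vec Bool n) (suc s) → Carrier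
    (Q ⋆ p) (g ∷ c) = ∑ λ y → pmf Q y * p (y ⊕ g ∷ c)

    evalAll-lift : ∀ {r s} (A : Vec (Form r) s) x (ω : Vec (Vec Bool n) r) → evalAll (lift A) (x ∷ ω) ≡ evalAll A ω
    evalAll-lift []      x ω = refl
    evalAll-lift (a ∷ A) x ω = ≡.cong (⟨ a , ω ⟩ ∷_) (evalAll-lift A x ω)

    push-lift : ∀ {r s} Q (μ : Vec (Vec Bool n) r → Carrier) (A : Vec (Form r) s) v →
                push (Q ⊗ μ) (evalAll (lift A)) v ≈ push μ (evalAll A) v
    push-lift Q μ A v = trans (push-def _ _ _) (trans (⊗-∑ Q μ _) (trans
      (∑-cong λ x → *-congˡ (trans (∑-cong λ ω → *-congˡ (reflexive (≡.cong (λ z → δ z v) (evalAll-lift A x ω))))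
        (sym (push-def _ _ _)))) (∑-mass Q _)))

    H-lift : ∀ {r s} Q (μ : Vec (Vec Bool n) r → Carrier) (A : Vec (Form r) s) → H (Q ⊗ μ) (lift A) ≈ H μ A
    H-lift Q μ A = E-cong (push-lift Q μ A)

    push-⋆ : ∀ {r s} Q (μ : Vec (Vec Bool n) r → Carrier) (a : Form r) (A : Vec (Form r) s) v →
             push (Q ⊗ μ) (evalAll ((true ∷ a) ∷ lift A)) v ≈ (Q ⋆ push μ (evalAll (a ∷ A))) v
    push-⋆ Q μ a A (g ∷ c) = trans (push-def _ _ _) (trans (⊗-∑ Q μ _)
      (∑-cong λ y → *-congˡ (trans (∑-cong λ ω → *-congˡ (shift y ω)) (sym (push-def _ _ _)))))
      where
      shift : ∀ y ω → δ (evalAll ((true ∷ a) ∷ lift A) (y ∷ ω)) (g ∷ c) ≈ δ (evalAll (a ∷ A) ω) (y ⊕ g ∷ c)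
      shift y ω = trans (δ-∷ _ _ _ _) (trans
        (*-cong (δ-⊕ y _ g) (reflexive (≡.cong (λ z → δ z c) (evalAll-lift A y ω)))) (sym (δ-∷ _ _ _ _)))

  -- The functional τ and its minimality under conditioning

  module _ {n : ℕ} where

    -- This is 18 (d[X ; Y] + η d[Q₁ ; X] + η d[Q₂ ; Y]) with η = 1/9.
    τ : (Q₁ Q₂ X Y : RandomVariable n) → Carrier
    τ Q₁ Q₂ X Y = fromℕ 9 * dist X Y + (dist Q₁ X + dist Q₂ Y)

    private
      G = Vec Bool n

    -- Chain rule for a fibre of mass `w`: by the product rule `h-*`, the entropy of `f` is `w`
    -- times that of the normalised fibre plus `h w`.
    E-scaled : ∀ (f : G → Carrier) {w} → 0# < w → (∀ x → 0# ≤ f x) → ∑ f ≈ w →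
               w * E (λ x → f x * w ⁻¹) ≈ E f - h w
    E-scaled f {w} 0<w 0≤f ∑f = begin
      w * E (λ x → f x * w ⁻¹)
        ≈⟨ solve 2 (λ a b → a := (a :+ b) :- b) refl _ (h w) ⟩
      (w * E (λ x → f x * w ⁻¹) + h w) - h w  ≈⟨ +-congʳ (sym expand) ⟩
      E f - h w ∎
      where
      expand : E f ≈ w * E (λ x → f x * w ⁻¹) + h w
      expand = begin
        E f                                                      ≈⟨ E-cong (λ x → sym (normalise-≈ (f x) 0<w)) ⟩
        E (λ x → w * (f x * w ⁻¹))
          ≈⟨ ∑-cong (λ x → h-* (<⇒≤ 0<w) (*-pos (0≤f x) (⁻¹-nonNeg 0<w))) ⟩
        ∑ (λ x → w * h (f x * w ⁻¹) + (f x * w ⁻¹) * h w)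
          ≈⟨ trans (∑-+ _ _) (+-cong (∑-*ˡ w _) (trans (∑-*ʳ _ _) (*-congʳ (∑-*ʳ _ f)))) ⟩
        w * E (λ x → f x * w ⁻¹) + (∑ f * w ⁻¹) * h w
          ≈⟨ +-congˡ (*-congʳ (trans (*-congʳ ∑f) (⁻¹-inverseʳ (>⇒≉ 0<w)))) ⟩
        w * E (λ x → f x * w ⁻¹) + 1# * h w                      ≈⟨ +-congˡ (*-identityˡ _) ⟩
        w * E (λ x → f x * w ⁻¹) + h w                           ∎

    normalised-variable : (f : G → Carrier) {w : Carrier} → 0# < w → (∀ x → 0# ≤ f x) → ∑ f ≈ w → RandomVariable n
    normalised-variable f {w} 0<w 0≤f ∑f = record
      { pmf        = λ x → f x * w ⁻¹
      ; nonNeg     = λ x → *-pos (0≤f x) (⁻¹-nonNeg 0<w)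
      ; normalised = trans (Σ≈∑ n _) (trans (∑-*ʳ _ f) (trans (*-congʳ ∑f) (⁻¹-inverseʳ (>⇒≉ 0<w))))
      }

    translates : RandomVariable n → (G → Carrier) → G → Carrier
    translates Q f g = ∑ λ y → pmf Q y * f (y ⊕ g)

    module _ {Q₁ Q₂ : RandomVariable n} {m : Carrier} (minimal : ∀ X Y → m ≤ τ Q₁ Q₂ X Y) where

      private
        e₁ e₂ : Carrier
        e₁ = E (pmf Q₁)
        e₂ = E (pmf Q₂)

      -- This is the minimality at the normalised fibres, multiplied by `w`. Every entropy loses an
      -- `h w` in the normalisation, and 18 + 2 + 2 - 10 - 10 = 2 of these remain. The last
      -- hypothesis expresses, free of division, that `k` is the law of the sum of two variables
      -- that are independent on the fibre.
      minimal-fibre : ∀ (f g k : G → Carrier) w → (∀ x → 0# ≤ f x) → (∀ x → 0# ≤ g x) → (∀ x → 0# ≤ k x) → 0# ≤ w →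
              ∑ f ≈ w → ∑ g ≈ w → ∑ k ≈ w → (∀ x → k x * w ≈ ∑ (λ a → f a * g (a ⊕ x))) →
              ((m * w + fromℕ 10 * E f) + fromℕ 10 * E g) + ((e₁ + e₂) * w + fromℕ 2 * h w) ≤
              (fromℕ 18 * E k + fromℕ 2 * E (translates Q₁ f)) + fromℕ 2 * E (translates Q₂ g)
      minimal-fibre f g k w 0≤f 0≤g 0≤k 0≤w ∑f ∑g ∑k conv = by (w ≤? 0#)
        where
        ∑-translates : ∀ Q f → ∑ (translates Q f) ≈ ∑ f
        ∑-translates Q f = trans (∑-swap _) (trans
          (∑-cong λ y → trans (∑-*ˡ _ _) (*-congˡ (∑-⊕ y f))) (∑-mass Q _))
        Goal = ((m * w + fromℕ 10 * E f) + fromℕ 10 * E g) + ((e₁ + e₂) * w + fromℕ 2 * h w) ≤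
               (fromℕ 18 * E k + fromℕ 2 * E (translates Q₁ f)) + fromℕ 2 * E (translates Q₂ g)
        by : Dec (w ≤ 0#) → Goal
        -- A fibre of mass zero cannot be normalised, but there both sides vanish.
        by (yes w≤0) = ≤-reflexive (begin
          ((m * w + fromℕ 10 * E f) + fromℕ 10 * E g) + ((e₁ + e₂) * w + fromℕ 2 * h w)
            ≈⟨ +-cong (+-cong (+-cong (*-congˡ w≈0) (*-congˡ (E≈0 0≤f ∑f))) (*-congˡ (E≈0 0≤g ∑g))) (+-cong (*-congˡ w≈0) (*-congˡ (h-≈0 w≈0))) ⟩
          ((m * 0# + fromℕ 10 * 0#) + fromℕ 10 * 0#) + ((e₁ + e₂) * 0# + fromℕ 2 * 0#)
            ≈⟨ solve 2 (λ m e → ((m :* con 0 :+ con 10 :* con 0) :+ con 10 :* con 0) :+ (e :* con 0 :+ con 2 :* con 0) :=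
                                (con 18 :* con 0 :+ con 2 :* con 0) :+ con 2 :* con 0) refl m (e₁ + e₂) ⟩
          (fromℕ 18 * 0# + fromℕ 2 * 0#) + fromℕ 2 * 0#
            ≈⟨ +-cong (+-cong (*-congˡ (E≈0 0≤k ∑k)) (*-congˡ (E≈0 (0≤trans Q₁ 0≤f) (trans (∑-translates Q₁ f) ∑f))))
                      (*-congˡ (E≈0 (0≤trans Q₂ 0≤g) (trans (∑-translates Q₂ g) ∑g))) ⟨
          (fromℕ 18 * E k + fromℕ 2 * E (translates Q₁ f)) + fromℕ 2 * E (translates Q₂ g) ∎)
          where
          w≈0 : w ≈ 0#
          w≈0 = antisym w≤0 0≤w
          E≈0 : ∀ {f : G → Carrier} → (∀ x → 0# ≤ f x) → ∑ f ≈ w → E f ≈ 0#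
          E≈0 0≤f ∑f = ∑-≈0 λ x → h-≈0 (∑≈0⇒≈0 0≤f (≤-reflexive (trans ∑f w≈0)) x)
          0≤trans : ∀ Q {f} → (∀ x → 0# ≤ f x) → ∀ x → 0# ≤ translates Q f x
          0≤trans Q 0≤f x = ∑-nonNeg λ y → *-pos (nonNeg Q y) (0≤f _)
        by (no 0<w) = linear 15 (λ m w a b c d e p q f g k t u z →
            1 ×≤ w :* m :≤ w :* (con 9 :* (con 2 :* c :- a :- b) :+ ((con 2 :* d :- p :- a) :+ (con 2 :* e :- q :- b)))
          ⟹ 18 ×≤ w :* c :≤ k :- z
          ⟹ 2 ×≤ w :* d :≤ t :- z
          ⟹ 2 ×≤ w :* e :≤ u :- z
          ⟹ 10 ×≤ f :- z :≤ w :* a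
          ⟹ 10 ×≤ g :- z :≤ w :* b
          ⟹ ⊢ 1 ×≤ ((m :* w :+ con 10 :* f) :+ con 10 :* g) :+ ((p :+ q) :* w :+ con 2 :* z)
                   :≤ (con 18 :* k :+ con 2 :* t) :+ con 2 :* u)
          refl m w (E (pmf X)) (E (pmf Y)) (E (convolution X Y)) (E (convolution Q₁ X)) (E (convolution Q₂ Y)) e₁ e₂
            (E f) (E g) (E k) (E (translates Q₁ f)) (E (translates Q₂ g)) (h w)
            (*-monoˡ 0≤w (minimal X Y))
            (≤-reflexive (trans (*-congˡ (E-cong conv-XY)) (E-scaled k 0<w 0≤k ∑k)))
            (≤-reflexive (scaled-translates Q₁ f 0≤f ∑f))
            (≤-reflexive (scaled-translates Q₂ g 0≤g ∑g))
            (≤-reflexive (sym (E-scaled f 0<w 0≤f ∑f)))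
            (≤-reflexive (sym (E-scaled g 0<w 0≤g ∑g)))
          where
          X = normalised-variable f 0<w 0≤f ∑f
          Y = normalised-variable g 0<w 0≤g ∑g
          conv-XY : ∀ x → convolution X Y x ≈ k x * w ⁻¹
          conv-XY x = begin
            ∑ (λ a → (f a * w ⁻¹) * (g (a ⊕ x) * w ⁻¹))
              ≈⟨ ∑-cong (λ a → solve 3 (λ f g i → (f :* i) :* (g :* i) := (f :* g) :* (i :* i)) refl _ _ _) ⟩
            ∑ (λ a → (f a * g (a ⊕ x)) * (w ⁻¹ * w ⁻¹))  ≈⟨ ∑-*ʳ _ _ ⟩
            ∑ (λ a → f a * g (a ⊕ x)) * (w ⁻¹ * w ⁻¹)    ≈⟨ *-congʳ (conv x) ⟨
            (k x * w) * (w ⁻¹ * w ⁻¹)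
              ≈⟨ solve 3 (λ k w i → (k :* w) :* (i :* i) := (w :* (k :* i)) :* i) refl _ _ _ ⟩
            (w * (k x * w ⁻¹)) * w ⁻¹                     ≈⟨ *-congʳ (normalise-≈ (k x) 0<w) ⟩
            k x * w ⁻¹                                    ∎
          scaled-translates : ∀ Q f (0≤f : ∀ x → 0# ≤ f x) (∑f : ∑ f ≈ w) →
                              w * E (convolution Q (normalised-variable f 0<w 0≤f ∑f)) ≈ E (translates Q f) - h w
          scaled-translates Q f 0≤f ∑f = trans
            (*-congˡ (E-cong λ g → trans (∑-cong λ y → sym (*-assoc _ _ _)) (∑-*ʳ _ _)))
            (E-scaled (translates Q f) 0<w (λ x → ∑-nonNeg λ y → *-pos (nonNeg Q y) (0≤f _)) (trans (∑-translates Q f) ∑f))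

      -- The minimality of m, averaged over the fibres of a conditioning variable c
      -- with distribution w: p, q and k are the joint distributions of c with X, Y
      -- and X + Y, where X and Y are conditionally independent given c.
      minimal-conditional : ∀ {s} (p q k : Vec G (suc s) → Carrier) (w : Vec G s → Carrier) →
        (∀ v → 0# ≤ p v) → (∀ v → 0# ≤ q v) → (∀ v → 0# ≤ k v) → (∀ c → 0# ≤ w c) → ∑ w ≈ 1# →
        (∀ c → ∑ (λ x → p (x ∷ c)) ≈ w c) → (∀ c → ∑ (λ x → q (x ∷ c)) ≈ w c) → (∀ c → ∑ (λ x → k (x ∷ c)) ≈ w c) →
        (∀ x c → k (x ∷ c) * w c ≈ ∑ (λ a → p (a ∷ c) * q (a ⊕ x ∷ c))) →
        m + fromℕ 10 * E p + fromℕ 10 * E q + (e₁ + e₂ + fromℕ 2 * E w) ≤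
        fromℕ 18 * E k + fromℕ 2 * E (Q₁ ⋆ p) + fromℕ 2 * E (Q₂ ⋆ q)
      minimal-conditional {s} p q k w 0≤p 0≤q 0≤k 0≤w ∑w ∑p ∑q ∑k conv = ≤-respˡ-≈ lhs (≤-respʳ-≈ rhs
        (∑-mono λ c → minimal-fibre (λ x → p (x ∷ c)) (λ x → q (x ∷ c)) (λ x → k (x ∷ c)) (w c)
          (λ x → 0≤p _) (λ x → 0≤q _) (λ x → 0≤k _) (0≤w c) (∑p c) (∑q c) (∑k c) (λ x → conv x c)))
        where
        scaled : ∀ j (p : Vec G (suc s) → Carrier) → ∑ (λ c → fromℕ j * E (λ x → p (x ∷ c))) ≈ fromℕ j * E p
        scaled j p = trans (∑-*ˡ _ _) (*-congˡ (sym (E-∷ p)))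
        const : ∀ x → ∑ (λ c → x * w c) ≈ x
        const x = trans (∑-*ˡ _ _) (trans (*-congˡ ∑w) (*-identityʳ x))
        lhs : ∑ (λ c → ((m * w c + fromℕ 10 * E (λ x → p (x ∷ c))) + fromℕ 10 * E (λ x → q (x ∷ c))) + ((e₁ + e₂) * w c + fromℕ 2 * h (w c))) ≈
              m + fromℕ 10 * E p + fromℕ 10 * E q + (e₁ + e₂ + fromℕ 2 * E w)
        lhs = trans (∑-+ _ _) (+-cong (trans (∑-+ _ _) (+-cong (trans (∑-+ _ _) (+-cong (const m) (scaled 10 p))) (scaled 10 q)))
          (trans (∑-+ _ _) (+-cong (const (e₁ + e₂)) (∑-*ˡ _ _))))
        rhs : ∑ (λ c → (fromℕ 18 * E (λ x → k (x ∷ c)) + fromℕ 2 * E (λ x → (Q₁ ⋆ p) (x ∷ c))) + fromℕ 2 * E (λ x → (Q₂ ⋆ q) (x ∷ c))) ≈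
              fromℕ 18 * E k + fromℕ 2 * E (Q₁ ⋆ p) + fromℕ 2 * E (Q₂ ⋆ q)
        rhs = trans (∑-+ _ _) (+-cong (trans (∑-+ _ _) (+-cong (scaled 18 k) (scaled 2 (Q₁ ⋆ p)))) (scaled 2 (Q₂ ⋆ q)))

      -- Since `(x , z)` and `(y , z′)` depend on complementary sets of coordinates, `x` and `y` are
      -- independent conditionally on `(z , z′)`. The choice `z = z′ = 𝟎` gives the unconditioned
      -- comparison.
      minimal-product : ∀ {r} (Xs : Vec (RandomVariable n) r) (t : Vec Bool r) (x y z z′ : Form r) →
        masked t (x ∷ z ∷ []) ≡ x ∷ z ∷ [] → masked (Vec.map not t) (y ∷ z′ ∷ []) ≡ y ∷ z′ ∷ [] →
        let μ = ∏ Xs ; Z = z ∷ z′ ∷ [] in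
        m + fromℕ 10 * H μ (x ∷ Z) + fromℕ 10 * H μ (y ∷ Z) + (e₁ + e₂ + fromℕ 2 * H μ Z) ≤
        fromℕ 18 * H μ (x ⊕ y ∷ Z) + fromℕ 2 * H (Q₁ ⊗ μ) ((true ∷ x) ∷ lift Z) + fromℕ 2 * H (Q₂ ⊗ μ) ((true ∷ y) ∷ lift Z)
      minimal-product Xs t x y z z′ t≡ t′≡ = ≤-respʳ-≈
        (+-cong (+-congˡ (*-congˡ (sym (E-cong (push-⋆ Q₁ μ x Z))))) (*-congˡ (sym (E-cong (push-⋆ Q₂ μ y Z)))))
        (minimal-conditional (P x) (P y) (P (x ⊕ y)) w (0≤P x) (0≤P y) (0≤P (x ⊕ y)) (push-nonNeg (∏-nonNeg Xs) _)
          (trans (∑-push-mass _ _) (∏-mass Xs)) (marginal x) (marginal y) (marginal (x ⊕ y)) conv)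
        where
        μ = ∏ Xs
        Z = z ∷ z′ ∷ []
        P : Form _ → Vec G 3 → Carrier
        P a = push μ (evalAll (a ∷ Z))
        w = push μ (evalAll Z)
        0≤P : ∀ a v → 0# ≤ P a v
        0≤P a = push-nonNeg (∏-nonNeg Xs) _
        marginal : ∀ a c → ∑ (λ g → P a (g ∷ c)) ≈ w c
        marginal a c = push-marginal μ ⟨ a ,_⟩ (evalAll Z) c
        z≡ : masked t (z ∷ []) ≡ z ∷ []
        z≡ = Vec.∷-injectiveʳ t≡
        z′≡ : masked (Vec.map not t) (z′ ∷ []) ≡ z′ ∷ []
        z′≡ = Vec.∷-injectiveʳ t′≡
        F : G → G → Carrier
        F a c = push μ (evalAll (x ∷ z ∷ [])) (a ∷ c ∷ [])
        F′ : G → G → Carrier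
        F′ a c = push μ (evalAll (y ∷ z′ ∷ [])) (a ∷ c ∷ [])
        f f′ : G → Carrier
        f c = push μ (evalAll (z ∷ [])) (c ∷ [])
        f′ c = push μ (evalAll (z′ ∷ [])) (c ∷ [])
        δ₁ : ∀ (a b : G) → δ (a ∷ []) (b ∷ []) ≈ δ a b
        δ₁ a b = δ-iff (λ { refl → refl }) (λ { refl → refl })
        w-split : ∀ c c′ → w (c ∷ c′ ∷ []) ≈ f c * f′ c′
        w-split c c′ = trans (push-def _ _ _) (trans
          (∑-cong λ ω → *-congˡ (trans (δ-∷ _ _ _ _) (*-congʳ (sym (δ₁ _ _)))))
          (independent-forms Xs t (z ∷ []) (z′ ∷ []) z≡ z′≡ (c ∷ []) (c′ ∷ [])))
        x-split : ∀ a c c′ → P x (a ∷ c ∷ c′ ∷ []) ≈ F a c * f′ c′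
        x-split a c c′ = trans (push-def _ _ _) (trans
          (∑-cong λ ω → *-congˡ (split ⟨ x , ω ⟩ ⟨ z , ω ⟩ ⟨ z′ , ω ⟩))
          (independent-forms Xs t (x ∷ z ∷ []) (z′ ∷ []) t≡ z′≡ (a ∷ c ∷ []) (c′ ∷ [])))
          where
          split : ∀ x z z′ → δ (x ∷ z ∷ z′ ∷ []) (a ∷ c ∷ c′ ∷ []) ≈ δ (x ∷ z ∷ []) (a ∷ c ∷ []) * δ (z′ ∷ []) (c′ ∷ [])
          split x z z′ = begin
            δ (x ∷ z ∷ z′ ∷ []) (a ∷ c ∷ c′ ∷ [])            ≈⟨ trans (δ-∷ _ _ _ _) (*-congˡ (δ-∷ _ _ _ _)) ⟩
            δ x a * (δ z c * δ (z′ ∷ []) (c′ ∷ []))          ≈⟨ *-assoc _ _ _ ⟨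
            (δ x a * δ z c) * δ (z′ ∷ []) (c′ ∷ [])
              ≈⟨ *-congʳ (trans (δ-∷ _ _ _ _) (*-congˡ (δ₁ z c))) ⟨
            δ (x ∷ z ∷ []) (a ∷ c ∷ []) * δ (z′ ∷ []) (c′ ∷ []) ∎
        y-split : ∀ a c c′ → P y (a ∷ c ∷ c′ ∷ []) ≈ f c * F′ a c′
        y-split a c c′ = trans (push-def _ _ _) (trans
          (∑-cong λ ω → *-congˡ (split ⟨ y , ω ⟩ ⟨ z , ω ⟩ ⟨ z′ , ω ⟩))
          (independent-forms Xs t (z ∷ []) (y ∷ z′ ∷ []) z≡ t′≡ (c ∷ []) (a ∷ c′ ∷ [])))
          where
          split : ∀ y z z′ → δ (y ∷ z ∷ z′ ∷ []) (a ∷ c ∷ c′ ∷ []) ≈ δ (z ∷ []) (c ∷ []) * δ (y ∷ z′ ∷ []) (a ∷ c′ ∷ [])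
          split y z z′ = begin
            δ (y ∷ z ∷ z′ ∷ []) (a ∷ c ∷ c′ ∷ [])            ≈⟨ trans (δ-∷ _ _ _ _) (*-congˡ (δ-∷ _ _ _ _)) ⟩
            δ y a * (δ z c * δ (z′ ∷ []) (c′ ∷ []))
              ≈⟨ solve 3 (λ i j k → i :* (j :* k) := j :* (i :* k)) refl _ _ _ ⟩
            δ z c * (δ y a * δ (z′ ∷ []) (c′ ∷ []))          ≈⟨ *-cong (δ₁ z c) (δ-∷ _ _ _ _) ⟨
            δ (z ∷ []) (c ∷ []) * δ (y ∷ z′ ∷ []) (a ∷ c′ ∷ []) ∎
        sum-split : ∀ g c c′ → P (x ⊕ y) (g ∷ c ∷ c′ ∷ []) ≈ ∑ (λ a → F a c * F′ (a ⊕ g) c′)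
        sum-split g c c′ = begin
          P (x ⊕ y) (g ∷ c ∷ c′ ∷ [])
            ≈⟨ trans (push-def _ _ _) (∑-cong λ ω → *-congˡ (split ω)) ⟩
          ∑ (λ ω → μ ω * ∑ (λ a → δ (evalAll (x ∷ z ∷ []) ω) (a ∷ c ∷ []) * δ (evalAll (y ∷ z′ ∷ []) ω) (a ⊕ g ∷ c′ ∷ [])))
            ≈⟨ ∑-cong (λ ω → sym (∑-*ˡ _ _)) ⟩
          ∑ (λ ω → ∑ (λ a → μ ω * (δ (evalAll (x ∷ z ∷ []) ω) (a ∷ c ∷ []) * δ (evalAll (y ∷ z′ ∷ []) ω) (a ⊕ g ∷ c′ ∷ []))))
            ≈⟨ ∑-swap _ ⟩
          ∑ (λ a → 𝔼 Xs (λ ω → δ (evalAll (x ∷ z ∷ []) ω) (a ∷ c ∷ []) * δ (evalAll (y ∷ z′ ∷ []) ω) (a ⊕ g ∷ c′ ∷ [])))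
            ≈⟨ ∑-cong (λ a → independent-forms Xs t (x ∷ z ∷ []) (y ∷ z′ ∷ []) t≡ t′≡ (a ∷ c ∷ []) (a ⊕ g ∷ c′ ∷ [])) ⟩
          ∑ (λ a → F a c * F′ (a ⊕ g) c′) ∎
          where
          split : ∀ ω → δ (evalAll (x ⊕ y ∷ Z) ω) (g ∷ c ∷ c′ ∷ []) ≈
                  ∑ (λ a → δ (evalAll (x ∷ z ∷ []) ω) (a ∷ c ∷ []) * δ (evalAll (y ∷ z′ ∷ []) ω) (a ⊕ g ∷ c′ ∷ []))
          split ω = begin
            δ (evalAll (x ⊕ y ∷ Z) ω) (g ∷ c ∷ c′ ∷ [])
              ≈⟨ trans (δ-∷ _ _ _ _) (*-cong (trans (reflexive (≡.cong (λ u → δ u g) (⟨⊕⟩ x y ω))) (δ-⊕ _ _ g)) (δ-∷ _ _ _ _)) ⟩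
            δ ⟨ y , ω ⟩ (⟨ x , ω ⟩ ⊕ g) * (δ ⟨ z , ω ⟩ c * δ (⟨ z′ , ω ⟩ ∷ []) (c′ ∷ []))
              ≈⟨ ∑-δˡ ⟨ x , ω ⟩ (λ a → δ ⟨ y , ω ⟩ (a ⊕ g) * (δ ⟨ z , ω ⟩ c * δ (⟨ z′ , ω ⟩ ∷ []) (c′ ∷ []))) ⟨
            ∑ (λ a → δ ⟨ x , ω ⟩ a * (δ ⟨ y , ω ⟩ (a ⊕ g) * (δ ⟨ z , ω ⟩ c * δ (⟨ z′ , ω ⟩ ∷ []) (c′ ∷ []))))
              ≈⟨ ∑-cong (λ a → trans (solve 4 (λ i j k l → i :* (j :* (k :* l)) :=
                   (i :* k) :* (j :* l)) refl _ _ _ _)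
                   (sym (*-cong (trans (δ-∷ _ _ _ _) (*-congˡ (δ₁ _ _))) (δ-∷ _ _ _ _)))) ⟩
            ∑ (λ a → δ (evalAll (x ∷ z ∷ []) ω) (a ∷ c ∷ []) * δ (evalAll (y ∷ z′ ∷ []) ω) (a ⊕ g ∷ c′ ∷ [])) ∎
        conv : ∀ g c → P (x ⊕ y) (g ∷ c) * w c ≈ ∑ (λ a → P x (a ∷ c) * P y (a ⊕ g ∷ c))
        conv g (c ∷ c′ ∷ []) = begin
          P (x ⊕ y) (g ∷ c ∷ c′ ∷ []) * w (c ∷ c′ ∷ [])            ≈⟨ *-cong (sum-split g c c′) (w-split c c′) ⟩
          ∑ (λ a → F a c * F′ (a ⊕ g) c′) * (f c * f′ c′)           ≈⟨ ∑-*ʳ _ _ ⟨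
          ∑ (λ a → (F a c * F′ (a ⊕ g) c′) * (f c * f′ c′))
            ≈⟨ ∑-cong (λ a → solve 4 (λ i j k l → (i :* j) :* (k :* l) := (i :* l) :* (k :* j)) refl _ _ _ _) ⟩
          ∑ (λ a → (F a c * f′ c′) * (f c * F′ (a ⊕ g) c′))
            ≈⟨ ∑-cong (λ a → *-cong (x-split a c c′) (y-split (a ⊕ g) c c′)) ⟨
          ∑ (λ a → P x (a ∷ c ∷ c′ ∷ []) * P y (a ⊕ g ∷ c ∷ c′ ∷ [])) ∎

  -- Entropies of sums of three independent variables

  module _ {n : ℕ} where
    private
      G = Vec Bool n

    h-1 : h 1# ≈ 0#
    h-1 = trans (-‿cong (trans (*-identityˡ _) log-1)) -0#≈0#

    push-marginalʳ : ∀ {A B C : Set} {{_ : Finite A}} {{_ : Finite B}} {s} (μ : A → Carrier) (f : A → B) (g : A → Vec B s) x →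
                     ∑ (λ v → push μ (λ a → f a ∷ g a) (x ∷ v)) ≈ push μ f x
    push-marginalʳ μ f g x = begin
      ∑ (λ v → push μ (λ a → f a ∷ g a) (x ∷ v))           ≈⟨ trans (∑-cong λ v → push-def _ _ _) (∑-swap _) ⟩
      ∑ (λ a → ∑ (λ v → μ a * δ (f a ∷ g a) (x ∷ v)))
        ≈⟨ ∑-cong (λ a → trans (∑-*ˡ _ _) (*-congˡ (trans (∑-cong λ v → δ-∷ _ _ _ _)
             (trans (∑-*ˡ _ _) (trans (*-congˡ (∑-δ (g a))) (*-identityʳ _)))))) ⟩
      ∑ (λ a → μ a * δ (f a) x)                            ≈⟨ push-def μ f x ⟨
      push μ f x                                           ∎

    module _ {r} {μ : Vec G r → Carrier} (0≤μ : ∀ ω → 0# ≤ μ ω) where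

      module _ (mass : ∑ μ ≈ 1#) where

        H-[] : H μ [] ≈ 0#
        H-[] = trans (∑-[] _) (trans (h-cong (trans (sym (∑-[] _)) (trans (∑-push-mass _ _) mass))) h-1)

        -- This is `marginals` for total mass one, where the term `h 1` vanishes.
        H-subadditive : ∀ {s} a (C : Vec (Form r) s) → H μ (a ∷ C) ≤ H μ (a ∷ []) + H μ C
        H-subadditive a C = ≤-respˡ-≈ lhs (≤-respʳ-≈ rhs
          (marginals (λ x v → P (x ∷ v)) (λ x v → push-nonNeg 0≤μ _ _)))
          where
          P = push μ (evalAll (a ∷ C))
          row : ∀ x → ∑ (λ v → P (x ∷ v)) ≈ push μ ⟨ a ,_⟩ x
          row = push-marginalʳ {C = G} μ ⟨ a ,_⟩ (evalAll C)
          lhs : ∑ (λ x → ∑ (λ v → h (P (x ∷ v)))) + h (∑ (λ x → ∑ (λ v → P (x ∷ v)))) ≈ H μ (a ∷ C)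
          lhs = trans (+-cong (sym (∑-∷ _)) (trans (h-cong (trans (∑-cong row) (trans (∑-push-mass _ _) mass))) h-1)) (+-identityʳ _)
          rhs : E (λ x → ∑ (λ v → P (x ∷ v))) + E (λ v → ∑ (λ x → P (x ∷ v))) ≈ H μ (a ∷ []) + H μ C
          rhs = +-cong (trans (E-cong row) (sym (H-single 0≤μ a))) (E-cong (push-marginal μ ⟨ a ,_⟩ (evalAll C)))

    H-push : ∀ {r s t} (μ : Vec G r → Carrier) (A : Vec (Form r) s) (C : Vec (Form s) t) →
             H (push μ (evalAll A)) C ≈ H μ (Vec.map ⟨_, A ⟩ C)
    H-push μ A C = E-cong λ v → trans (push-push μ (evalAll A) (evalAll C) v)
      (push-cong (λ _ → ≈-refl) (composed C) v)
      where
      composed : ∀ {t} (C : Vec (Form _) t) ω → evalAll C (evalAll A ω) ≡ evalAll (Vec.map ⟨_, A ⟩ C) ω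
      composed []      ω = refl
      composed (c ∷ C) ω = ≡.cong₂ _∷_ (≡.sym (⟨⟨⟩⟩ c A ω)) (composed C ω)

    module _ (Q A B : RandomVariable n) where
      private
        Xs = Q ∷ A ∷ B ∷ []
        P = ∏ Xs
        0≤P = ∏-nonNeg Xs
        q a b : Form 3
        q = true ∷ false ∷ false ∷ []
        a = false ∷ true ∷ false ∷ []
        b = false ∷ false ∷ true ∷ []

        ℓ : Form 3 → Carrier
        ℓ f = E (law Xs f)

        pair : ∀ t f g → masked t (f ∷ []) ≡ f ∷ [] → masked (Vec.map not t) (g ∷ []) ≡ g ∷ [] →
               H P (f ∷ g ∷ []) ≈ ℓ f + ℓ g
        pair t f g f≡ g≡ = trans (H-independent Xs t f (g ∷ []) f≡ g≡) (+-cong (H-law Xs f) (H-law Xs g))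

        triple : H P (q ∷ a ∷ b ∷ []) ≈ ℓ q + (ℓ a + ℓ b)
        triple = trans (H-independent Xs q q (a ∷ b ∷ []) refl refl) (+-cong (H-law Xs q) (pair a a b refl refl))

      -- The inequality of Kaimanovich and Vershik, in two versions which differ
      -- in the order of the variables.
      add-last : ℓ (q ⊕ a ⊕ b) + ℓ a ≤ ℓ (q ⊕ a) + ℓ (a ⊕ b)
      add-last = linear 7 (λ q a b qa ab qab full →
            1 ×≤ full :+ qab :≤ (b :+ qa) :+ (q :+ ab)
          ⟹ 1 ×≤ q :+ (a :+ b) :≤ full
          ⟹ ⊢ 1 ×≤ qab :+ a :≤ qa :+ ab) refl
          (ℓ q) (ℓ a) (ℓ b) (ℓ (q ⊕ a)) (ℓ (a ⊕ b)) (ℓ (q ⊕ a ⊕ b)) (H P (q ∷ a ∷ b ∷ []))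
          (≤-respˡ-≈ (+-congˡ (H-law Xs (q ⊕ a ⊕ b))) (≤-respʳ-≈
            (+-cong (pair b b (q ⊕ a) refl refl) (pair q q (a ⊕ b) refl refl))
            (H-submodular 0≤P b (a ⊕ b) (q ⊕ a ⊕ b ∷ []) (b ∷ q ⊕ a ∷ []) (q ∷ a ⊕ b ∷ [])
              (q ∷ a ∷ b ∷ []) (q ⊕ a ⊕ b ∷ []))))
          (≤-reflexive (sym triple))

      add-middle : ℓ (q ⊕ a ⊕ b) + ℓ b ≤ ℓ (q ⊕ b) + ℓ (a ⊕ b)
      add-middle = linear 7 (λ q a b qb ab qab full →
            1 ×≤ full :+ qab :≤ (a :+ qb) :+ (q :+ ab)
          ⟹ 1 ×≤ q :+ (a :+ b) :≤ full
          ⟹ ⊢ 1 ×≤ qab :+ b :≤ qb :+ ab) refl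
          (ℓ q) (ℓ a) (ℓ b) (ℓ (q ⊕ b)) (ℓ (a ⊕ b)) (ℓ (q ⊕ a ⊕ b)) (H P (q ∷ a ∷ b ∷ []))
          (≤-respˡ-≈ (+-congˡ (H-law Xs (q ⊕ a ⊕ b))) (≤-respʳ-≈
            (+-cong (pair a a (q ⊕ b) refl refl) (pair q q (a ⊕ b) refl refl))
            (H-submodular 0≤P a (a ⊕ b) (q ⊕ a ⊕ b ∷ []) (a ∷ q ⊕ b ∷ []) (q ∷ a ⊕ b ∷ [])
              (q ∷ a ∷ b ∷ []) (q ⊕ a ⊕ b ∷ []))))
          (≤-reflexive (sym triple))

      -- The Ruzsa triangle inequality. The pairs `(q + a , a + b)` and `(q , b)` both determine
      -- `q + b`, and together they determine all three variables, so submodularity applies over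
      -- `q + b`.
      triangle-middle : ℓ (q ⊕ b) + ℓ a ≤ ℓ (q ⊕ a) + ℓ (a ⊕ b)
      triangle-middle = linear 8 (λ q a b qa ab qb full two →
            1 ×≤ full :+ qb :≤ two :+ (q :+ b)
          ⟹ 1 ×≤ q :+ (a :+ b) :≤ full
          ⟹ 1 ×≤ two :≤ qa :+ ab
          ⟹ ⊢ 1 ×≤ qb :+ a :≤ qa :+ ab) refl
          (ℓ q) (ℓ a) (ℓ b) (ℓ (q ⊕ a)) (ℓ (a ⊕ b)) (ℓ (q ⊕ b)) (H P (q ∷ a ∷ b ∷ [])) (H P (q ⊕ a ∷ a ⊕ b ∷ []))
          (≤-respˡ-≈ (+-congˡ (H-law Xs (q ⊕ b))) (≤-respʳ-≈ (+-congˡ (pair q q b refl refl))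
            (H-submodular 0≤P (q ⊕ a) q (q ⊕ b ∷ []) (q ⊕ a ∷ a ⊕ b ∷ []) (q ∷ b ∷ [])
              (q ∷ a ∷ b ∷ []) (q ⊕ b ∷ []))))
          (≤-reflexive (sym triple))
          (≤-respʳ-≈ (+-cong (H-law Xs (q ⊕ a)) (H-law Xs (a ⊕ b))) (H-subadditive 0≤P (∏-mass Xs) (q ⊕ a) (a ⊕ b ∷ [])))

  -- The entropic Balog-Szemerédi-Gowers lemma

  module _ {n : ℕ} where
    private
      G = Vec Bool n

    H-identity : ∀ {r} {μ : Vec G r → Carrier} (A : Vec (Form r) r) → (∀ ω → evalAll A ω ≡ ω) → H μ A ≈ E μ
    H-identity {μ = μ} A id≡ = E-cong λ v → trans (push-def _ _ _)
      (trans (∑-cong λ ω → *-congˡ (trans (reflexive (≡.cong (λ u → δ u v) (id≡ ω))) (δ-sym ω v))) (∑-δʳ v μ))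

    module _ {r} {μ : Vec G r → Carrier} (0≤μ : ∀ ω → 0# ≤ μ ω) (mass : ∑ μ ≈ 1#) (A Z S : Form r) where

      private
        ρ ρ′ : Vec G 3 → Carrier
        ρ  = push μ (evalAll (A ∷ Z ∷ S ∷ []))
        ρ′ = push μ (evalAll (A ⊕ Z ∷ Z ∷ S ∷ []))
        w : Vec G 2 → Carrier
        w = push μ (evalAll (Z ∷ S ∷ []))

        -- Two copies of A, independent conditionally on Z and S.
        ν : Vec G 4 → Carrier
        ν (x ∷ y ∷ c) = ρ (x ∷ c) * (ρ (y ∷ c) * w c ⁻¹)

        a₁ a₂ z s : Form 4
        a₁ = true ∷ false ∷ false ∷ false ∷ []
        a₂ = false ∷ true ∷ false ∷ false ∷ []
        z  = false ∷ false ∷ true ∷ false ∷ []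
        s  = false ∷ false ∷ false ∷ true ∷ []

        κ : Vec G 3 → Carrier
        κ = push ν (evalAll (a₁ ⊕ a₂ ⊕ z ∷ z ∷ s ∷ []))

        0≤ρ : ∀ v → 0# ≤ ρ v
        0≤ρ = push-nonNeg 0≤μ _
        0≤w : ∀ c → 0# ≤ w c
        0≤w = push-nonNeg 0≤μ _

        w-cases : ∀ c {P : Set} → (0# < w c → P) → (w c ≈ 0# → P) → P
        w-cases c pos zer with w c ≤? 0#
        ... | yes w≤0 = zer (antisym w≤0 (0≤w c))
        ... | no  0<w = pos 0<w

        0≤w⁻¹ : ∀ c → 0# ≤ w c ⁻¹
        0≤w⁻¹ c = ⁻¹-nonNeg-total (0≤w c)

        ∑ρ : ∀ c → ∑ (λ x → ρ (x ∷ c)) ≈ w c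
        ∑ρ = push-marginal μ ⟨ A ,_⟩ (evalAll (Z ∷ S ∷ []))

        ρ-zero : ∀ {c} → w c ≈ 0# → ∀ x → ρ (x ∷ c) ≈ 0#
        ρ-zero {c} w≈0 = ∑≈0⇒≈0 (λ x → 0≤ρ _) (≤-reflexive (trans (∑ρ c) w≈0))

        -- Where `w c` vanishes, so does `ρ`, and the default value of the inverse of zero does no
        -- harm.
        ρ-cancel : ∀ x c → ρ (x ∷ c) * (w c * w c ⁻¹) ≈ ρ (x ∷ c)
        ρ-cancel x c = w-cases c
          (λ 0<w → trans (*-congˡ (⁻¹-inverseʳ (>⇒≉ 0<w))) (*-identityʳ _))
          (λ w≈0 → trans (*-congʳ (ρ-zero w≈0 x)) (trans (zeroˡ _) (sym (ρ-zero w≈0 x))))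

        0≤ν : ∀ ω → 0# ≤ ν ω
        0≤ν (x ∷ y ∷ c) = *-pos (0≤ρ _) (*-pos (0≤ρ _) (0≤w⁻¹ c))

        push-ν : ∀ (f : Vec G 4 → Vec G 3) (ψ : G → G → Vec G 2 → G) → (∀ x y c → f (x ∷ y ∷ c) ≡ ψ x y c ∷ c) →
                 ∀ g c → push ν f (g ∷ c) ≈ ∑ (λ x → ∑ (λ y → ν (x ∷ y ∷ c) * δ (ψ x y c) g))
        push-ν f ψ f≡ g c = begin
          push ν f (g ∷ c)
            ≈⟨ trans (push-def _ _ _) (trans (∑-∷ _) (∑-cong λ x → ∑-∷ _)) ⟩
          ∑ (λ x → ∑ (λ y → ∑ (λ c′ → ν (x ∷ y ∷ c′) * δ (f (x ∷ y ∷ c′)) (g ∷ c))))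
            ≈⟨ ∑-cong (λ x → ∑-cong λ y → ∑-cong λ c′ → *-congˡ (trans
                 (reflexive (≡.cong (λ u → δ u (g ∷ c)) (f≡ x y c′))) (trans (δ-∷ _ _ _ _) (*-congˡ (δ-sym c′ c))))) ⟩
          ∑ (λ x → ∑ (λ y → ∑ (λ c′ → ν (x ∷ y ∷ c′) * (δ (ψ x y c′) g * δ c c′))))
            ≈⟨ ∑-cong (λ x → ∑-cong λ y → trans (∑-cong λ c′ → sym (*-assoc _ _ _)) (∑-δʳ c _)) ⟩
          ∑ (λ x → ∑ (λ y → ν (x ∷ y ∷ c) * δ (ψ x y c) g)) ∎

        keep : ∀ {x z s : G} {f} → f ≡ x → f ∷ z ⊕ 𝟎 ∷ s ⊕ 𝟎 ∷ [] ≡ x ∷ z ∷ s ∷ []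
        keep {z = z} {s} refl = ≡.cong₂ (λ z s → _ ∷ z ∷ s ∷ []) (⊕-identityʳ z) (⊕-identityʳ s)

        first : ∀ v → push ν (evalAll (a₁ ∷ z ∷ s ∷ [])) v ≈ ρ v
        first (g ∷ c) = begin
          push ν (evalAll (a₁ ∷ z ∷ s ∷ [])) (g ∷ c)
            ≈⟨ push-ν _ (λ x _ _ → x) (λ { x y (z ∷ s ∷ []) → keep (⊕-identityʳ x) }) g c ⟩
          ∑ (λ x → ∑ (λ y → ν (x ∷ y ∷ c) * δ x g))
            ≈⟨ ∑-cong (λ x → trans (∑-*ʳ _ _) (*-cong (trans (∑-*ˡ _ _) (*-congˡ (trans (∑-*ʳ _ _) (*-congʳ (∑ρ c))))) (δ-sym x g))) ⟩
          ∑ (λ x → (ρ (x ∷ c) * (w c * w c ⁻¹)) * δ g x)   ≈⟨ ∑-δʳ g _ ⟩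
          ρ (g ∷ c) * (w c * w c ⁻¹)                       ≈⟨ ρ-cancel g c ⟩
          ρ (g ∷ c)                                        ∎

        second : ∀ v → push ν (evalAll (a₂ ∷ z ∷ s ∷ [])) v ≈ ρ v
        second (g ∷ c) = begin
          push ν (evalAll (a₂ ∷ z ∷ s ∷ [])) (g ∷ c)
            ≈⟨ push-ν _ (λ _ y _ → y) (λ { x y (z ∷ s ∷ []) → keep (⊕-identityʳ y) }) g c ⟩
          ∑ (λ x → ∑ (λ y → ν (x ∷ y ∷ c) * δ y g))
            ≈⟨ ∑-cong (λ x → trans (∑-cong λ y → *-congˡ (δ-sym y g)) (∑-δʳ g _)) ⟩
          ∑ (λ x → ρ (x ∷ c) * (ρ (g ∷ c) * w c ⁻¹))       ≈⟨ trans (∑-*ʳ _ _) (*-congʳ (∑ρ c)) ⟩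
          w c * (ρ (g ∷ c) * w c ⁻¹)
            ≈⟨ solve 3 (λ w r i → w :* (r :* i) := r :* (w :* i)) refl _ _ _ ⟩
          ρ (g ∷ c) * (w c * w c ⁻¹)                       ≈⟨ ρ-cancel g c ⟩
          ρ (g ∷ c)                                        ∎

        ρ′≈ρ : ∀ g z s → ρ′ (g ∷ z ∷ s ∷ []) ≈ ρ (g ⊕ z ∷ z ∷ s ∷ [])
        ρ′≈ρ g z s = trans (push-def _ _ _) (trans
          (∑-cong λ ω → *-congˡ (δ-iff (to _ (⟨⊕⟩ A Z ω)) (from _ (⟨⊕⟩ A Z ω)))) (sym (push-def _ _ _)))
          where
          to : ∀ u {x z′ s′} → u ≡ x ⊕ z′ → u ∷ z′ ∷ s′ ∷ [] ≡ g ∷ z ∷ s ∷ [] → x ∷ z′ ∷ s′ ∷ [] ≡ g ⊕ z ∷ z ∷ s ∷ []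
          to _ {x} {z′} refl refl = ≡.cong (_∷ _) (≡.sym (⊕-cancelʳ x z′))
          from : ∀ u {x z′ s′} → u ≡ x ⊕ z′ → x ∷ z′ ∷ s′ ∷ [] ≡ g ⊕ z ∷ z ∷ s ∷ [] → u ∷ z′ ∷ s′ ∷ [] ≡ g ∷ z ∷ s ∷ []
          from _ refl refl = ≡.cong (_∷ _) (⊕-cancelʳ g z)

        -- Given `(Z , S)`, the variable `a₁ + a₂ + z` is the sum of independent copies of `A` and
        -- of `A + Z`. This is the conditional independence that `minimal-conditional` asks for.
        κ-convolution : ∀ g c → κ (g ∷ c) * w c ≈ ∑ (λ x → ρ (x ∷ c) * ρ′ (x ⊕ g ∷ c))
        κ-convolution g c@(z′ ∷ s′ ∷ []) = begin
          κ (g ∷ c) * w c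
            ≈⟨ *-congʳ (push-ν _ (λ { x y (z ∷ s ∷ []) → x ⊕ (y ⊕ z) })
                 (λ { x y (z ∷ s ∷ []) → keep (≡.cong (λ u → x ⊕ (y ⊕ u)) (⊕-identityʳ z)) }) g c) ⟩
          ∑ (λ x → ∑ (λ y → ν (x ∷ y ∷ c) * δ (x ⊕ (y ⊕ z′)) g)) * w c
            ≈⟨ *-congʳ (∑-cong λ x → trans (∑-cong λ y → *-congˡ (δ-iff (to x y) (from x y))) (∑-δʳ _ _)) ⟩
          ∑ (λ x → ν (x ∷ (x ⊕ g) ⊕ z′ ∷ c)) * w c   ≈⟨ ∑-*ʳ _ _ ⟨
          ∑ (λ x → ν (x ∷ (x ⊕ g) ⊕ z′ ∷ c) * w c)
            ≈⟨ ∑-cong (λ x → solve 4 (λ a b i w → (a :* (b :* i)) :* w := a :* (b :* (w :* i))) refl _ _ _ _) ⟩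
          ∑ (λ x → ρ (x ∷ c) * (ρ ((x ⊕ g) ⊕ z′ ∷ c) * (w c * w c ⁻¹)))
            ≈⟨ ∑-cong (λ x → *-congˡ (trans (ρ-cancel _ c) (sym (ρ′≈ρ (x ⊕ g) z′ s′)))) ⟩
          ∑ (λ x → ρ (x ∷ c) * ρ′ (x ⊕ g ∷ c)) ∎
          where
          to : ∀ x y → x ⊕ (y ⊕ z′) ≡ g → (x ⊕ g) ⊕ z′ ≡ y
          to x y refl = ≡.trans (≡.cong (_⊕ z′) (⊕-cancelˡ x _)) (⊕-cancelʳ y z′)
          from : ∀ x y → (x ⊕ g) ⊕ z′ ≡ y → x ⊕ (y ⊕ z′) ≡ g
          from x _ refl = ≡.trans (≡.cong (x ⊕_) (⊕-cancelʳ _ z′)) (⊕-cancelˡ x g)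

        -- Chain rule: given `(Z , S)`, each of the two independent copies contributes the
        -- conditional entropy `E ρ - E w`.
        E-ν : E ν + E w ≈ E ρ + E ρ
        E-ν = begin
          E ν + E w
            ≈⟨ +-congʳ (trans (∑-∷ _) (trans (∑-cong λ x → trans (∑-∷ _) (∑-swap _)) (∑-swap _))) ⟩
          ∑ (λ c → ∑ (λ x → ∑ (λ y → h (ν (x ∷ y ∷ c))))) + E w  ≈⟨ ∑-+ _ _ ⟨
          ∑ (λ c → ∑ (λ x → ∑ (λ y → h (ν (x ∷ y ∷ c)))) + h (w c)) ≈⟨ ∑-cong at ⟩
          ∑ (λ c → E (λ x → ρ (x ∷ c)) + E (λ x → ρ (x ∷ c)))
            ≈⟨ trans (∑-+ _ _) (sym (+-cong (E-∷ ρ) (E-∷ ρ))) ⟩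
          E ρ + E ρ ∎
          where
          at : ∀ c → ∑ (λ x → ∑ (λ y → h (ν (x ∷ y ∷ c)))) + h (w c) ≈ E (λ x → ρ (x ∷ c)) + E (λ x → ρ (x ∷ c))
          at c = w-cases c
            (λ 0<w → begin
              ∑ (λ x → ∑ (λ y → h (ν (x ∷ y ∷ c)))) + h (w c)
                ≈⟨ +-congʳ (∑-cong λ x → trans (∑-cong λ y → h-* (0≤ρ _) (*-pos (0≤ρ _) (0≤w⁻¹ c))) (trans (∑-+ _ _) (+-cong (∑-*ˡ _ _) (∑-*ʳ _ _)))) ⟩
              ∑ (λ x → ρ (x ∷ c) * E (λ y → ρ (y ∷ c) * w c ⁻¹) + ∑ (λ y → ρ (y ∷ c) * w c ⁻¹) * h (ρ (x ∷ c))) + h (w c)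
                ≈⟨ +-congʳ (trans (∑-+ _ _) (+-cong (trans (∑-*ʳ _ _) (*-congʳ (∑ρ c))) (trans (∑-*ˡ _ _)
                     (trans (*-congʳ (trans (∑-*ʳ _ _) (trans (*-congʳ (∑ρ c)) (⁻¹-inverseʳ (>⇒≉ 0<w))))) (*-identityˡ _))))) ⟩
              (w c * E (λ y → ρ (y ∷ c) * w c ⁻¹) + E (λ x → ρ (x ∷ c))) + h (w c)
                ≈⟨ +-congʳ (+-congʳ (E-scaled (λ y → ρ (y ∷ c)) 0<w (λ y → 0≤ρ _) (∑ρ c))) ⟩
              ((E (λ y → ρ (y ∷ c)) - h (w c)) + E (λ x → ρ (x ∷ c))) + h (w c)
                ≈⟨ solve 2 (λ e w → ((e :- w) :+ e) :+ w := e :+ e) refl _ _ ⟩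
              E (λ x → ρ (x ∷ c)) + E (λ x → ρ (x ∷ c)) ∎)
            (λ w≈0 → trans (+-cong (∑-≈0 λ x → ∑-≈0 λ y → h-≈0 (trans (*-congʳ (ρ-zero w≈0 x)) (zeroˡ _))) (h-≈0 w≈0))
              (sym (+-cong (∑-≈0 λ x → h-≈0 (ρ-zero w≈0 x)) (∑-≈0 λ x → h-≈0 (ρ-zero w≈0 x)))))

        -- Either copy together with `(z , s)` is distributed as `(A , Z , S)`, so a family that
        -- sees only one of the copies has its entropy under `μ`.
        project : ∀ {t} (D : Vec (Form 4) 3) → (∀ v → push ν (evalAll D) v ≈ ρ v) → (F : Vec (Form 3) t) →
                  ∀ {F′} → Vec.map ⟨_, A ∷ Z ∷ S ∷ [] ⟩ F ≡ F′ → H ν (Vec.map ⟨_, D ⟩ F) ≈ H μ F′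
        project D law F refl = trans (sym (H-push ν D F)) (trans
          (E-cong (push-cong law (λ _ → refl))) (H-push μ (A ∷ Z ∷ S ∷ []) F))

        D₁ D₂ : Vec (Form 4) 3
        D₁ = a₁ ∷ z ∷ s ∷ []
        D₂ = a₂ ∷ z ∷ s ∷ []

        f g k : Form 3
        f = true ∷ false ∷ false ∷ []
        g = false ∷ true ∷ false ∷ []
        k = false ∷ false ∷ true ∷ []

        S≡ : ⟨ k , A ∷ Z ∷ S ∷ [] ⟩ ≡ S
        S≡ = ⊕-identityʳ S
        Z≡ : ⟨ g , A ∷ Z ∷ S ∷ [] ⟩ ≡ Z
        Z≡ = ⊕-identityʳ Z
        A≡ : ⟨ f , A ∷ Z ∷ S ∷ [] ⟩ ≡ A
        A≡ = ⊕-identityʳ A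
        B≡ : ⟨ f ⊕ g , A ∷ Z ∷ S ∷ [] ⟩ ≡ A ⊕ Z
        B≡ = ≡.cong (A ⊕_) (⊕-identityʳ Z)
        two : ∀ {x y x′ y′ : Form r} → x ≡ x′ → y ≡ y′ → x ∷ y ∷ [] ≡ x′ ∷ y′ ∷ []
        two refl refl = refl

      -- Let a₁, a₂ be the copies of A and bᵢ = aᵢ + z. Then κ is the law of (a₁ + b₂ , Z , S),
      -- and a₁ + b₂ = b₁ + a₂ is determined by (a₁ , b₂) as well as by (b₁ , a₂).
      κ-bound : E κ + (fromℕ 3 * H μ (S ∷ []) + fromℕ 2 * E ρ) ≤
                fromℕ 2 * (H μ (A ∷ S ∷ []) + H μ (A ⊕ Z ∷ S ∷ []) + H μ (Z ∷ S ∷ []))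
      κ-bound = linear 10 (λ K full Ds zs s As Bs A₁B₂ B₁A₂ R →
            1 ×≤ K :+ s :≤ Ds :+ zs
          ⟹ 1 ×≤ full :+ Ds :≤ A₁B₂ :+ B₁A₂
          ⟹ 1 ×≤ A₁B₂ :+ s :≤ As :+ Bs
          ⟹ 1 ×≤ B₁A₂ :+ s :≤ Bs :+ As
          ⟹ 1 ×≤ R :+ R :≤ full :+ zs
          ⟹ ⊢ 1 ×≤ K :+ (con 3 :* s :+ con 2 :* R) :≤ con 2 :* (As :+ Bs :+ zs)) refl
          (E κ) (E ν) (H ν (a₁ ⊕ a₂ ⊕ z ∷ s ∷ [])) (H μ (Z ∷ S ∷ [])) (H μ (S ∷ []))
          (H μ (A ∷ S ∷ [])) (H μ (A ⊕ Z ∷ S ∷ [])) (H ν (a₁ ∷ a₂ ⊕ z ∷ s ∷ [])) (H ν (a₁ ⊕ z ∷ a₂ ∷ s ∷ [])) (E ρ)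
          (≤-respˡ-≈ (+-congˡ S-entropy) (≤-respʳ-≈ (+-congˡ (project D₁ first (g ∷ k ∷ []) (two Z≡ S≡)))
            (H-submodular 0≤ν (a₁ ⊕ a₂ ⊕ z) z (s ∷ []) (a₁ ⊕ a₂ ⊕ z ∷ s ∷ []) (z ∷ s ∷ []) (a₁ ⊕ a₂ ⊕ z ∷ z ∷ s ∷ []) (s ∷ []))))
          (≤-respˡ-≈ (+-congʳ (H-identity (a₁ ∷ a₂ ∷ z ∷ s ∷ []) identity))
            (H-submodular 0≤ν a₁ (a₁ ⊕ z) (a₁ ⊕ a₂ ⊕ z ∷ s ∷ []) (a₁ ∷ a₂ ⊕ z ∷ s ∷ []) (a₁ ⊕ z ∷ a₂ ∷ s ∷ [])
              (a₁ ∷ a₂ ∷ z ∷ s ∷ []) (a₁ ⊕ a₂ ⊕ z ∷ s ∷ [])))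
          (≤-respˡ-≈ (+-congˡ S-entropy) (≤-respʳ-≈
            (+-cong (project D₁ first (f ∷ k ∷ []) (two A≡ S≡)) (project D₂ second (f ⊕ g ∷ k ∷ []) (two B≡ S≡)))
            (H-submodular 0≤ν a₁ (a₂ ⊕ z) (s ∷ []) (a₁ ∷ s ∷ []) (a₂ ⊕ z ∷ s ∷ []) (a₁ ∷ a₂ ⊕ z ∷ s ∷ []) (s ∷ []))))
          (≤-respˡ-≈ (+-congˡ S-entropy) (≤-respʳ-≈
            (+-cong (project D₁ first (f ⊕ g ∷ k ∷ []) (two B≡ S≡)) (project D₂ second (f ∷ k ∷ []) (two A≡ S≡)))
            (H-submodular 0≤ν (a₁ ⊕ z) a₂ (s ∷ []) (a₁ ⊕ z ∷ s ∷ []) (a₂ ∷ s ∷ []) (a₁ ⊕ z ∷ a₂ ∷ s ∷ []) (s ∷ []))))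
          (≤-reflexive (sym E-ν))
        where
        S-entropy : H ν (s ∷ []) ≈ H μ (S ∷ [])
        S-entropy = project D₁ first (k ∷ []) (≡.cong (_∷ []) S≡)
        identity : ∀ ω → evalAll (a₁ ∷ a₂ ∷ z ∷ s ∷ []) ω ≡ ω
        identity (x ∷ y ∷ u ∷ v ∷ []) = ≡.cong₂ _∷_ (⊕-identityʳ x) (≡.cong₂ _∷_ (⊕-identityʳ y) (two′ (⊕-identityʳ u) (⊕-identityʳ v)))
          where
          two′ : ∀ {x y x′ y′ : G} → x ≡ x′ → y ≡ y′ → x ∷ y ∷ [] ≡ x′ ∷ y′ ∷ []
          two′ refl refl = refl

      module _ {Q₁ Q₂ : RandomVariable n} {m : Carrier} (minimal : ∀ X Y → m ≤ τ Q₁ Q₂ X Y) where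

        -- The competitor is the pair of `A` and `A + Z`, both conditioned on `(Z , S)`. The entropy
        -- `E κ` of its sum enters the minimality with coefficient 18 and is eliminated by 18 times
        -- `κ-bound`.
        balog-szemerédi-gowers :
          (m + fromℕ 10 * H μ (A ∷ Z ∷ S ∷ []) + fromℕ 10 * H μ (A ⊕ Z ∷ Z ∷ S ∷ []) + (E (pmf Q₁) + E (pmf Q₂) + fromℕ 2 * H μ (Z ∷ S ∷ []))) +
            fromℕ 18 * (fromℕ 3 * H μ (S ∷ []) + fromℕ 2 * H μ (A ∷ Z ∷ S ∷ [])) ≤
          fromℕ 36 * (H μ (A ∷ S ∷ []) + H μ (A ⊕ Z ∷ S ∷ []) + H μ (Z ∷ S ∷ [])) +
            (fromℕ 2 * H (Q₁ ⊗ μ) ((true ∷ A) ∷ lift (Z ∷ S ∷ [])) + fromℕ 2 * H (Q₂ ⊗ μ) ((true ∷ A ⊕ Z) ∷ lift (Z ∷ S ∷ [])))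
        balog-szemerédi-gowers = linear 6 (λ l K q₁ q₂ s r →
            1 ×≤ l :≤ con 18 :* K :+ con 2 :* q₁ :+ con 2 :* q₂
          ⟹ 18 ×≤ K :+ s :≤ con 2 :* r
          ⟹ ⊢ 1 ×≤ l :+ con 18 :* s :≤ con 36 :* r :+ (con 2 :* q₁ :+ con 2 :* q₂)) refl _ (E κ) _ _ _ _
          (≤-respʳ-≈ (+-cong (+-congˡ (*-congˡ (sym (E-cong (push-⋆ Q₁ μ A (Z ∷ S ∷ []))))))
                             (*-congˡ (sym (E-cong (push-⋆ Q₂ μ (A ⊕ Z) (Z ∷ S ∷ []))))))
            (minimal-conditional minimal ρ ρ′ κ w 0≤ρ (push-nonNeg 0≤μ _) (push-nonNeg 0≤ν _) 0≤w
              (trans (∑-push-mass _ _) mass) ∑ρ (push-marginal μ ⟨ A ⊕ Z ,_⟩ (evalAll (Z ∷ S ∷ [])))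
              (λ c → trans (push-marginal ν ⟨ a₁ ⊕ a₂ ⊕ z ,_⟩ (evalAll (z ∷ s ∷ [])) c)
                (trans (sym (push-marginal ν ⟨ a₁ ,_⟩ (evalAll (z ∷ s ∷ [])) c)) (trans (∑-cong λ x → first (x ∷ c)) (∑ρ c))))
              κ-convolution))
          κ-bound

  -- Near-minimisers have small distance

  module _ {n : ℕ} where

    dist-law : ∀ (X Y : RandomVariable n) →
               dist X Y ≈ fromℕ 2 * E (law (X ∷ Y ∷ []) (true ∷ true ∷ [])) - E (pmf X) - E (law (Y ∷ []) (true ∷ []))
    dist-law X Y = +-cong (+-congʳ (*-congˡ (sym (E-cong (law-double X Y))))) (-‿cong (sym (E-cong (law-single Y))))

    module _ {Q₁ Q₂ : RandomVariable n} {m : Carrier} (minimal : ∀ X Y → m ≤ τ Q₁ Q₂ X Y) (X Y : RandomVariable n) where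
      private
        Xs : Vec (RandomVariable n) 4
        Xs = X ∷ X ∷ Y ∷ Y ∷ []
        μ = ∏ Xs
        0≤μ = ∏-nonNeg Xs
        mass = ∏-mass Xs

        x x′ y y′ S : Form 4
        x  = true ∷ false ∷ false ∷ false ∷ []
        x′ = false ∷ true ∷ false ∷ false ∷ []
        y  = false ∷ false ∷ true ∷ false ∷ []
        y′ = false ∷ false ∷ false ∷ true ∷ []
        S  = x ⊕ x′ ⊕ y ⊕ y′

        ℓ : Form 4 → Carrier
        ℓ f = E (law Xs f)

        ℓ+ : RandomVariable n → Form 4 → Carrier
        ℓ+ Q f = E (law (Q ∷ Xs) (true ∷ f))

        -- In the notation of the header, J is the entropy of (U , V , S) and hence of
        -- (V , W , S) and (U , W , S) as well.
        e₁ e₂ J : Carrier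
        e₁ = E (pmf Q₁)
        e₂ = E (pmf Q₂)
        J  = H μ (x ⊕ y ∷ x′ ⊕ y ∷ S ∷ [])

        pair : ∀ t f g → masked t (f ∷ []) ≡ f ∷ [] → masked (Vec.map not t) (g ∷ []) ≡ g ∷ [] →
               H μ (f ∷ g ∷ []) ≈ ℓ f + ℓ g
        pair t f g f≡ g≡ = trans (H-independent Xs t f (g ∷ []) f≡ g≡) (+-cong (H-law Xs f) (H-law Xs g))

        triple : ∀ t f s g k → masked t (f ∷ []) ≡ f ∷ [] → masked (Vec.map not t) (g ∷ k ∷ []) ≡ g ∷ k ∷ [] →
                 masked s (g ∷ []) ≡ g ∷ [] → masked (Vec.map not s) (k ∷ []) ≡ k ∷ [] →
                 H μ (f ∷ g ∷ k ∷ []) ≈ ℓ f + (ℓ g + ℓ k)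
        triple t f s g k f≡ gk≡ g≡ k≡ = trans (H-independent Xs t f (g ∷ k ∷ []) f≡ gk≡)
          (+-cong (H-law Xs f) (pair s g k g≡ k≡))

        -- Dropping the condition `C` can only raise the entropy of `Q + f`, and before that `f` may
        -- be changed by a combination of `C`.
        shifted : ∀ {s} Q f f′ (C : Vec (Form 4) s) →
                  {_ : True ((true ∷ f) ∷ lift C ⊒? (true ∷ f′) ∷ lift C)} {_ : True ((true ∷ f′) ∷ lift C ⊒? (true ∷ f) ∷ lift C)} →
                  H (Q ⊗ μ) ((true ∷ f) ∷ lift C) ≤ ℓ+ Q f′ + H μ C
        shifted Q f f′ C {p} {q} = ≤-respˡ-≈ (H-≡ (∏-nonNeg (Q ∷ Xs)) ((true ∷ f′) ∷ lift C) ((true ∷ f) ∷ lift C) {q} {p})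
          (≤-respʳ-≈ (+-cong (H-law (Q ∷ Xs) (true ∷ f′)) (H-lift Q μ C))
            (H-subadditive (∏-nonNeg (Q ∷ Xs)) (∏-mass (Q ∷ Xs)) (true ∷ f′) (lift C)))

        rearrange : ∀ {m p q e w k u v p′ q′ k′ w′ c d} → p ≈ p′ → q ≈ q′ → k ≈ k′ → w ≈ w′ → u ≤ c + w → v ≤ d + w →
          m + fromℕ 10 * p + fromℕ 10 * q + (e + fromℕ 2 * w) ≤ fromℕ 18 * k + fromℕ 2 * u + fromℕ 2 * v →
          m + fromℕ 10 * p′ + fromℕ 10 * q′ + (e + fromℕ 2 * w′) ≤ fromℕ 18 * k′ + fromℕ 2 * (c + w′) + fromℕ 2 * (d + w′)
        rearrange {m} {e = e} {w} {u = u} {v} {p′} {q′} {k′} {w′} {c} {d} p q k w≈ u≤ v≤ h =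
          linear 11 (λ m p q e w k u v c d w′ →
              1 ×≤ m :+ con 10 :* p :+ con 10 :* q :+ (e :+ con 2 :* w) :≤ con 18 :* k :+ con 2 :* u :+ con 2 :* v
            ⟹ 2 ×≤ u :≤ c :+ w
            ⟹ 2 ×≤ v :≤ d :+ w
            ⟹ 2 ×≤ w :≤ w′
            ⟹ ⊢ 1 ×≤ m :+ con 10 :* p :+ con 10 :* q :+ (e :+ con 2 :* w′)
                   :≤ con 18 :* k :+ con 2 :* (c :+ w′) :+ con 2 :* (d :+ w′)) refl
            m p′ q′ e w k′ u v c d w′
            (≤-respˡ-≈ (+-congʳ (+-cong (+-congˡ (*-congˡ p)) (*-congˡ q))) (≤-respʳ-≈ (+-congʳ (+-congʳ (*-congˡ k))) h))
            u≤ v≤ (≤-reflexive w≈)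

        zeros : H μ (𝟎 ∷ 𝟎 ∷ []) ≈ 0#
        zeros = trans (H-≡ 0≤μ (𝟎 ∷ 𝟎 ∷ []) []) (H-[] 0≤μ mass)

        -- Steps 1 to 4 compare (X , Y) with (X + Y′ , X′ + Y), with (X , Y) conditioned on
        -- these two sums, with (X + X′ , Y + Y′), and with (X , Y) conditioned on these.
        -- Steps 5 to 7 are the endgame for the cyclic permutations of U, V and W.
        step₁ : m + fromℕ 10 * ℓ (x ⊕ y) + fromℕ 10 * ℓ (x ⊕ y) + (e₁ + e₂ + fromℕ 2 * 0#) ≤
                fromℕ 18 * ℓ S + fromℕ 2 * (ℓ+ Q₁ (x ⊕ y) + 0#) + fromℕ 2 * (ℓ+ Q₂ (x ⊕ y) + 0#)
        step₁ = rearrange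
          (trans (H-≡ 0≤μ (x ⊕ y′ ∷ 𝟎 ∷ 𝟎 ∷ []) (x ⊕ y′ ∷ [])) (H-law Xs (x ⊕ y′)))
          (trans (H-≡ 0≤μ (x′ ⊕ y ∷ 𝟎 ∷ 𝟎 ∷ []) (x′ ⊕ y ∷ [])) (H-law Xs (x′ ⊕ y)))
          (trans (H-≡ 0≤μ (S ∷ 𝟎 ∷ 𝟎 ∷ []) (S ∷ [])) (H-law Xs S)) zeros
          (shifted Q₁ (x ⊕ y′) (x ⊕ y′) (𝟎 ∷ 𝟎 ∷ [])) (shifted Q₂ (x′ ⊕ y) (x′ ⊕ y) (𝟎 ∷ 𝟎 ∷ []))
          (minimal-product minimal Xs (x ⊕ y′) (x ⊕ y′) (x′ ⊕ y) 𝟎 𝟎 refl refl)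

        step₂ : let w = ℓ (x ⊕ y) + ℓ (x ⊕ y) in
                m + fromℕ 10 * (ℓ x + (ℓ y + ℓ (x ⊕ y))) + fromℕ 10 * (ℓ y + (ℓ x + ℓ (x ⊕ y))) + (e₁ + e₂ + fromℕ 2 * w) ≤
                fromℕ 18 * J + fromℕ 2 * (ℓ+ Q₁ x + w) + fromℕ 2 * (ℓ+ Q₂ y + w)
        step₂ = rearrange
          (trans (H-≡ 0≤μ (x ∷ x ⊕ y′ ∷ x′ ⊕ y ∷ []) (x ∷ y′ ∷ x′ ⊕ y ∷ [])) (triple x x y′ y′ (x′ ⊕ y) refl refl refl refl))
          (trans (H-≡ 0≤μ (y ∷ x ⊕ y′ ∷ x′ ⊕ y ∷ []) (y ∷ x′ ∷ x ⊕ y′ ∷ [])) (triple y y x′ x′ (x ⊕ y′) refl refl refl refl))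
          (H-≡ 0≤μ (x ⊕ y ∷ x ⊕ y′ ∷ x′ ⊕ y ∷ []) (x ⊕ y ∷ x′ ⊕ y ∷ S ∷ []))
          (pair (x ⊕ y′) (x ⊕ y′) (x′ ⊕ y) refl refl)
          (shifted Q₁ x x (x ⊕ y′ ∷ x′ ⊕ y ∷ [])) (shifted Q₂ y y (x ⊕ y′ ∷ x′ ⊕ y ∷ []))
          (minimal-product minimal Xs (x ⊕ y′) x y (x ⊕ y′) (x′ ⊕ y) refl refl)

        step₃ : m + fromℕ 10 * ℓ (x ⊕ x′) + fromℕ 10 * ℓ (y ⊕ y′) + (e₁ + e₂ + fromℕ 2 * 0#) ≤
                fromℕ 18 * ℓ S + fromℕ 2 * (ℓ+ Q₁ (x ⊕ x′) + 0#) + fromℕ 2 * (ℓ+ Q₂ (y ⊕ y′) + 0#)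
        step₃ = rearrange
          (trans (H-≡ 0≤μ (x ⊕ x′ ∷ 𝟎 ∷ 𝟎 ∷ []) (x ⊕ x′ ∷ [])) (H-law Xs (x ⊕ x′)))
          (trans (H-≡ 0≤μ (y ⊕ y′ ∷ 𝟎 ∷ 𝟎 ∷ []) (y ⊕ y′ ∷ [])) (H-law Xs (y ⊕ y′)))
          (trans (H-≡ 0≤μ (S ∷ 𝟎 ∷ 𝟎 ∷ []) (S ∷ [])) (H-law Xs S)) zeros
          (shifted Q₁ (x ⊕ x′) (x ⊕ x′) (𝟎 ∷ 𝟎 ∷ [])) (shifted Q₂ (y ⊕ y′) (y ⊕ y′) (𝟎 ∷ 𝟎 ∷ []))
          (minimal-product minimal Xs (x ⊕ x′) (x ⊕ x′) (y ⊕ y′) 𝟎 𝟎 refl refl)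

        step₄ : let w = ℓ (x ⊕ x′) + ℓ (y ⊕ y′) in
                m + fromℕ 10 * (ℓ x + (ℓ x + ℓ (y ⊕ y′))) + fromℕ 10 * (ℓ y + (ℓ y + ℓ (x ⊕ x′))) + (e₁ + e₂ + fromℕ 2 * w) ≤
                fromℕ 18 * J + fromℕ 2 * (ℓ+ Q₁ x + w) + fromℕ 2 * (ℓ+ Q₂ y + w)
        step₄ = rearrange
          (trans (H-≡ 0≤μ (x ∷ x ⊕ x′ ∷ y ⊕ y′ ∷ []) (x ∷ x′ ∷ y ⊕ y′ ∷ [])) (triple x x x′ x′ (y ⊕ y′) refl refl refl refl))
          (trans (H-≡ 0≤μ (y ∷ x ⊕ x′ ∷ y ⊕ y′ ∷ []) (y ∷ y′ ∷ x ⊕ x′ ∷ [])) (triple y y y′ y′ (x ⊕ x′) refl refl refl refl))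
          (H-≡ 0≤μ (x ⊕ y ∷ x ⊕ x′ ∷ y ⊕ y′ ∷ []) (x ⊕ y ∷ x′ ⊕ y ∷ S ∷ []))
          (pair (x ⊕ x′) (x ⊕ x′) (y ⊕ y′) refl refl)
          (shifted Q₁ x x (x ⊕ x′ ∷ y ⊕ y′ ∷ [])) (shifted Q₂ y y (x ⊕ x′ ∷ y ⊕ y′ ∷ []))
          (minimal-product minimal Xs (x ⊕ x′) x y (x ⊕ x′) (y ⊕ y′) refl refl)

        U-S : H μ (x ⊕ y ∷ S ∷ []) ≈ ℓ (x ⊕ y) + ℓ (x ⊕ y)
        U-S = trans (H-≡ 0≤μ (x ⊕ y ∷ S ∷ []) (x ⊕ y ∷ x′ ⊕ y′ ∷ [])) (pair (x ⊕ y) (x ⊕ y) (x′ ⊕ y′) refl refl)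

        V-S : H μ (x′ ⊕ y ∷ S ∷ []) ≈ ℓ (x ⊕ y) + ℓ (x ⊕ y)
        V-S = trans (H-≡ 0≤μ (x′ ⊕ y ∷ S ∷ []) (x′ ⊕ y ∷ x ⊕ y′ ∷ [])) (pair (x′ ⊕ y) (x′ ⊕ y) (x ⊕ y′) refl refl)

        W-S : H μ (x ⊕ x′ ∷ S ∷ []) ≈ ℓ (x ⊕ x′) + ℓ (y ⊕ y′)
        W-S = trans (H-≡ 0≤μ (x ⊕ x′ ∷ S ∷ []) (x ⊕ x′ ∷ y ⊕ y′ ∷ [])) (pair (x ⊕ x′) (x ⊕ x′) (y ⊕ y′) refl refl)

        -- The coefficients come from `balog-szemerédi-gowers`: 56 = 10 + 10 + 36 as both triples
        -- have entropy `J`, 54 = 18 · 3, and 38 = 36 - 2 + 4, the 4 being the price of dropping the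
        -- condition in `q₁` and `q₂`.
        endgame : ∀ A Z {a b z c d} → H μ (A ∷ Z ∷ S ∷ []) ≈ J → H μ (A ⊕ Z ∷ Z ∷ S ∷ []) ≈ J →
          H μ (A ∷ S ∷ []) ≈ a → H μ (A ⊕ Z ∷ S ∷ []) ≈ b → H μ (Z ∷ S ∷ []) ≈ z →
          H (Q₁ ⊗ μ) ((true ∷ A) ∷ lift (Z ∷ S ∷ [])) ≤ c + H μ (Z ∷ S ∷ []) →
          H (Q₂ ⊗ μ) ((true ∷ A ⊕ Z) ∷ lift (Z ∷ S ∷ [])) ≤ d + H μ (Z ∷ S ∷ []) →
          m + fromℕ 56 * J + (e₁ + e₂) + fromℕ 54 * ℓ S ≤ fromℕ 36 * (a + b) + fromℕ 38 * z + fromℕ 2 * (c + d)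
        endgame A Z {a} {b} {z} {c} {d} J₁ J₂ a≈ b≈ z≈ c≤ d≤ = linear 11 (λ m J e s a b z c d q₁ q₂ →
              1 ×≤ (m :+ con 10 :* J :+ con 10 :* J :+ (e :+ con 2 :* z)) :+ con 18 :* (con 3 :* s :+ con 2 :* J)
                   :≤ con 36 :* (a :+ b :+ z) :+ (con 2 :* q₁ :+ con 2 :* q₂)
            ⟹ 2 ×≤ q₁ :≤ c :+ z
            ⟹ 2 ×≤ q₂ :≤ d :+ z
            ⟹ ⊢ 1 ×≤ m :+ con 56 :* J :+ e :+ con 54 :* s
                   :≤ con 36 :* (a :+ b) :+ con 38 :* z :+ con 2 :* (c :+ d)) refl
            m J (e₁ + e₂) (ℓ S) a b z c d _ _
            (≤-respˡ-≈ (+-cong (+-cong (+-cong (+-congˡ (*-congˡ J₁)) (*-congˡ J₂)) (+-congˡ (*-congˡ z≈)))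
                               (*-congˡ (+-cong (*-congˡ (H-law Xs S)) (*-congˡ J₁))))
              (≤-respʳ-≈ (+-congʳ (*-congˡ (+-cong (+-cong a≈ b≈) z≈)))
                (balog-szemerédi-gowers 0≤μ mass A Z S minimal)))
            (≤-respʳ-≈ (+-congˡ z≈) c≤) (≤-respʳ-≈ (+-congˡ z≈) d≤)

        step₅ : m + fromℕ 56 * J + (e₁ + e₂) + fromℕ 54 * ℓ S ≤
                fromℕ 36 * ((ℓ (x ⊕ y) + ℓ (x ⊕ y)) + (ℓ (x ⊕ y) + ℓ (x ⊕ y))) + fromℕ 38 * (ℓ (x ⊕ x′) + ℓ (y ⊕ y′)) +
                  fromℕ 2 * (ℓ+ Q₁ (x ⊕ y) + ℓ+ Q₂ (x ⊕ y))
        step₅ = endgame (x ⊕ y) (x ⊕ x′)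
          (H-≡ 0≤μ (x ⊕ y ∷ x ⊕ x′ ∷ S ∷ []) (x ⊕ y ∷ x′ ⊕ y ∷ S ∷ [])) (H-≡ 0≤μ (x′ ⊕ y ∷ x ⊕ x′ ∷ S ∷ []) (x ⊕ y ∷ x′ ⊕ y ∷ S ∷ []))
          U-S V-S W-S
          (shifted Q₁ (x ⊕ y) (x ⊕ y) (x ⊕ x′ ∷ S ∷ [])) (shifted Q₂ (x′ ⊕ y) (x′ ⊕ y) (x ⊕ x′ ∷ S ∷ []))

        step₆ : m + fromℕ 56 * J + (e₁ + e₂) + fromℕ 54 * ℓ S ≤
                fromℕ 36 * ((ℓ (x ⊕ y) + ℓ (x ⊕ y)) + (ℓ (x ⊕ x′) + ℓ (y ⊕ y′))) + fromℕ 38 * (ℓ (x ⊕ y) + ℓ (x ⊕ y)) +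
                  fromℕ 2 * (ℓ+ Q₁ (x ⊕ y) + ℓ+ Q₂ (y ⊕ y′))
        step₆ = endgame (x′ ⊕ y) (x ⊕ y)
          (H-≡ 0≤μ (x′ ⊕ y ∷ x ⊕ y ∷ S ∷ []) (x ⊕ y ∷ x′ ⊕ y ∷ S ∷ [])) (H-≡ 0≤μ (x ⊕ x′ ∷ x ⊕ y ∷ S ∷ []) (x ⊕ y ∷ x′ ⊕ y ∷ S ∷ []))
          V-S W-S U-S
          -- Given `S`, the sums `x + x′` and `y + y′` determine each other; only the second can be
          -- compared with `Q₂ + Y` by `add-last`.
          (shifted Q₁ (x′ ⊕ y) (x′ ⊕ y) (x ⊕ y ∷ S ∷ [])) (shifted Q₂ (x ⊕ x′) (y ⊕ y′) (x ⊕ y ∷ S ∷ []))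

        step₇ : m + fromℕ 56 * J + (e₁ + e₂) + fromℕ 54 * ℓ S ≤
                fromℕ 36 * ((ℓ (x ⊕ x′) + ℓ (y ⊕ y′)) + (ℓ (x ⊕ y) + ℓ (x ⊕ y))) + fromℕ 38 * (ℓ (x ⊕ y) + ℓ (x ⊕ y)) +
                  fromℕ 2 * (ℓ+ Q₁ (x ⊕ x′) + ℓ+ Q₂ (x ⊕ y))
        step₇ = endgame (x ⊕ x′) (x′ ⊕ y)
          (H-≡ 0≤μ (x ⊕ x′ ∷ x′ ⊕ y ∷ S ∷ []) (x ⊕ y ∷ x′ ⊕ y ∷ S ∷ [])) (H-≡ 0≤μ (x ⊕ y ∷ x′ ⊕ y ∷ S ∷ []) (x ⊕ y ∷ x′ ⊕ y ∷ S ∷ []))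
          W-S U-S V-S
          (shifted Q₁ (x ⊕ x′) (x ⊕ x′) (x′ ⊕ y ∷ S ∷ [])) (shifted Q₂ (x ⊕ y) (x ⊕ y) (x′ ⊕ y ∷ S ∷ []))

      -- The factors solve the linear program posed by the seven steps.
      minimiser-dist : ∀ {ε} → τ Q₁ Q₂ X Y ≤ m + ε → dist X Y ≤ fromℕ 8 * ε
      minimiser-dist {ε} τ≤ = ≤-respˡ-≈ (sym distXY) (linear 17 (λ m ε a b s s₁ s₂ S J c₁ c₂ e₁ e₂ u₁ u₂ u₃ u₄ →
            -- The weights 1, 12, 26, 16, 3, 3, 3 of the steps add up to 64, which cancels `m`. The
            -- entropy `J` cancels as 18 · (12 + 16) = 9 · 56, and that of `S` as 18 · (1 + 26) = 9
            -- · 54. The weights 14 and 58 are the coefficients of `u₁` to `u₄` in the sum.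
            64 ×≤ con 9 :* (con 2 :* s :- a :- b) :+ ((con 2 :* c₁ :- e₁ :- a) :+ (con 2 :* c₂ :- e₂ :- b)) :≤ m :+ ε
          ⟹ 1 ×≤ m :+ con 10 :* s :+ con 10 :* s :+ (e₁ :+ e₂ :+ con 2 :* con 0)
                 :≤ con 18 :* S :+ con 2 :* (u₁ :+ con 0) :+ con 2 :* (u₂ :+ con 0)
          ⟹ 12 ×≤ m :+ con 10 :* (a :+ (b :+ s)) :+ con 10 :* (b :+ (a :+ s)) :+ (e₁ :+ e₂ :+ con 2 :* (s :+ s))
                 :≤ con 18 :* J :+ con 2 :* (c₁ :+ (s :+ s)) :+ con 2 :* (c₂ :+ (s :+ s))
          ⟹ 26 ×≤ m :+ con 10 :* s₁ :+ con 10 :* s₂ :+ (e₁ :+ e₂ :+ con 2 :* con 0)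
                 :≤ con 18 :* S :+ con 2 :* (u₃ :+ con 0) :+ con 2 :* (u₄ :+ con 0)
          ⟹ 16 ×≤ m :+ con 10 :* (a :+ (a :+ s₂)) :+ con 10 :* (b :+ (b :+ s₁)) :+ (e₁ :+ e₂ :+ con 2 :* (s₁ :+ s₂))
                 :≤ con 18 :* J :+ con 2 :* (c₁ :+ (s₁ :+ s₂)) :+ con 2 :* (c₂ :+ (s₁ :+ s₂))
          ⟹ 3 ×≤ m :+ con 56 :* J :+ (e₁ :+ e₂) :+ con 54 :* S
                 :≤ con 36 :* ((s :+ s) :+ (s :+ s)) :+ con 38 :* (s₁ :+ s₂) :+ con 2 :* (u₁ :+ u₂)
          ⟹ 3 ×≤ m :+ con 56 :* J :+ (e₁ :+ e₂) :+ con 54 :* S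
                 :≤ con 36 :* ((s :+ s) :+ (s₁ :+ s₂)) :+ con 38 :* (s :+ s) :+ con 2 :* (u₁ :+ u₄)
          ⟹ 3 ×≤ m :+ con 56 :* J :+ (e₁ :+ e₂) :+ con 54 :* S
                 :≤ con 36 :* ((s₁ :+ s₂) :+ (s :+ s)) :+ con 38 :* (s :+ s) :+ con 2 :* (u₃ :+ u₂)
          ⟹ 14 ×≤ u₁ :+ a :≤ c₁ :+ s
          ⟹ 14 ×≤ u₂ :+ b :≤ c₂ :+ s
          ⟹ 58 ×≤ u₃ :+ a :≤ c₁ :+ s₁
          ⟹ 58 ×≤ u₄ :+ b :≤ c₂ :+ s₂
          ⟹ ⊢ 8 ×≤ con 2 :* s :- a :- b :≤ con 8 :* ε) refl
          m ε (ℓ x) (ℓ y) (ℓ (x ⊕ y)) (ℓ (x ⊕ x′)) (ℓ (y ⊕ y′)) (ℓ S) J (ℓ+ Q₁ x) (ℓ+ Q₂ y) e₁ e₂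
          (ℓ+ Q₁ (x ⊕ y)) (ℓ+ Q₂ (x ⊕ y)) (ℓ+ Q₁ (x ⊕ x′)) (ℓ+ Q₂ (y ⊕ y′))
          (≤-respˡ-≈ (+-cong (*-congˡ distXY) (+-cong (dist-law Q₁ X) (dist-law Q₂ Y))) τ≤)
          step₁ step₂ step₃ step₄ step₅ step₆ step₇
          (add-last Q₁ X Y) (add-middle Q₂ X Y) (add-last Q₁ X X) (add-last Q₂ Y Y))
        where
        distXY : dist X Y ≈ fromℕ 2 * ℓ (x ⊕ y) - ℓ x - ℓ y
        distXY = trans (dist-law X Y) (+-congʳ (+-congˡ (-‿cong (sym (E-cong (law-single X))))))

  -- The triangle inequality, and subgroups from small doubling

  module _ {n : ℕ} where
    private
      G = Vec Bool n

    triangle : ∀ (X Y Z : RandomVariable n) → dist X Z ≤ dist X Y + dist Y Z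
    triangle X Y Z = linear 9 (λ xy yz xz x y z XZ XY YZ →
          2 ×≤ xz :+ y :≤ xy :+ yz
        ⟹ 1 ×≤ XZ :≤ con 2 :* xz :- x :- z
        ⟹ 1 ×≤ con 2 :* xy :- x :- y :≤ XY
        ⟹ 1 ×≤ con 2 :* yz :- y :- z :≤ YZ
        ⟹ ⊢ 1 ×≤ XZ :≤ XY :+ YZ) refl
        _ _ _ (E (pmf X)) (ℓ Y) (ℓ Z) (dist X Z) (dist X Y) (dist Y Z)
        (triangle-middle X Y Z) (≤-reflexive (dist-law X Z)) (≤-reflexive (sym (dist-law X Y)))
        (≤-reflexive (sym (trans (dist-law Y Z) (+-congʳ (+-congˡ (-‿cong (sym (E-cong (law-single Y)))))))))
      where
      ℓ : RandomVariable n → Carrier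
      ℓ X = E (law (X ∷ []) (true ∷ []))

    -- The distance of `X` from itself is nonnegative by the triangle `X`, `X`, `Y`, and at most
    -- twice that of `X` from `Y` by the triangle `X`, `Y`, `X`.
    dist-nonNeg : ∀ X Y → 0# ≤ dist X Y
    dist-nonNeg X Y = linear 3 (λ x xy yx →
          1 ×≤ x :≤ xy :+ yx ⟹ 1 ×≤ xy :≤ x :+ xy ⟹ 1 ×≤ yx :≤ xy ⟹ ⊢ 2 ×≤ con 0 :≤ xy) refl
      (dist X X) (dist X Y) (dist Y X) (triangle X Y X) (triangle X X Y) (≤-reflexive (dist-comm Y X))

    module _ where
      open List using ([]; _∷_)

      maximum : ∀ (f : G → Carrier) → ∃ λ x → ∀ y → f y ≤ f x
      maximum f = let (x , max) = go 𝟎 (elements n) in x , λ y → proj₂ max y (∈-elements y)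
        where
        go : ∀ a xs → ∃ λ x → f a ≤ f x × ∀ y → y ∈ xs → f y ≤ f x
        go a []       = a , ≤-refl , λ _ ()
        go a (b ∷ xs) with total (f a) (f b)
        ... | inj₁ a≤b = let (x , b≤x , max) = go b xs in
          x , ≤-trans a≤b b≤x , λ { y (here refl) → b≤x ; y (there y∈) → max y y∈ }
        ... | inj₂ b≤a = let (x , a≤x , max) = go a xs in
          x , a≤x , λ { y (here refl) → ≤-trans b≤a a≤x ; y (there y∈) → max y y∈ }

      ∈⇒1≤length : ∀ {A : Set} {x : A} {xs} → x ∈ xs → 1# ≤ fromℕ (length xs)
      ∈⇒1≤length {xs = _ ∷ xs} _ = ≤-respˡ-≈ (+-identityʳ 1#) (+-monoʳ 1# (fromℕ-nonNeg (length xs)))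

    N : Carrier
    N = ∑ {A = G} (λ _ → 1#)

    ∑-const : ∀ c → ∑ {A = G} (λ _ → c) ≈ N * c
    ∑-const c = trans (∑-cong λ _ → sym (*-identityˡ c)) (∑-*ʳ c _)

    -- This is `log t ≤ t - 1` for `t = s / q`, multiplied by `q`. The function used for `s` later
    -- has mass slightly above one, so the term `s - q` is kept.
    h≤cross-entropy : ∀ {q s} → 0# ≤ q → 0# < s → h q ≤ q * - log s + (s - q)
    h≤cross-entropy {q} {s} 0≤q 0<s = by (q ≤? 0#)
      where
      by : Dec (q ≤ 0#) → h q ≤ q * - log s + (s - q)
      by (yes q≤0) = linear 4 (λ s q hq ql →
                1 ×≤ con 0 :≤ s
              ⟹ 1 ×≤ hq :≤ con 0
              ⟹ 1 ×≤ con 0 :≤ ql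
              ⟹ 1 ×≤ q :≤ con 0
              ⟹ ⊢ 1 ×≤ hq :≤ ql :+ (s :- q)) refl
        s q (h q) (q * - log s) (<⇒≤ 0<s) (≤-reflexive (h-≈0 q≈0)) (≤-reflexive (sym (trans (*-congʳ q≈0) (zeroˡ _)))) q≤0
        where
        q≈0 : q ≈ 0#
        q≈0 = antisym q≤0 0≤q
      by (no 0<q) = linear 6 (λ q s lq ls lt t →
            1 ×≤ q :* lt :≤ q :* (s :* t :- :1)
          ⟹ 1 ×≤ q :* (ls :+ :- lq) :≤ q :* lt
          ⟹ 1 ×≤ q :* (s :* t) :≤ s
          ⟹ ⊢ 1 ×≤ :- (q :* lq) :≤ q :* (:- ls) :+ (s :- q)) refl
        q s (log q) (log s) (log (s * q ⁻¹)) (q ⁻¹)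
        (*-monoˡ 0≤q (log≤x-1 (*-pos-strict 0<s (⁻¹-pos 0<q))))
        (≤-reflexive (*-congˡ (sym (trans (log-* 0<s (⁻¹-pos 0<q)) (+-congˡ (log-⁻¹ 0<q))))))
        (≤-reflexive (normalise-≈ s 0<q))

    ∑-convolution : ∀ (X Y : RandomVariable n) (φ : G → Carrier) →
                    ∑ (λ g → convolution X Y g * φ g) ≈ ∑ (λ x → ∑ (λ y → (pmf X x * pmf Y y) * φ (x ⊕ y)))
    ∑-convolution X Y φ = begin
      ∑ (λ g → convolution X Y g * φ g)                                    ≈⟨ ∑-cong (λ g → sym (∑-*ʳ _ _)) ⟩
      ∑ (λ g → ∑ (λ x → (pmf X x * pmf Y (x ⊕ g)) * φ g))                  ≈⟨ ∑-swap _ ⟩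
      ∑ (λ x → ∑ (λ g → (pmf X x * pmf Y (x ⊕ g)) * φ g))                  ≈⟨ ∑-cong (λ x → ∑-⊕ x _) ⟨
      ∑ (λ x → ∑ (λ y → (pmf X x * pmf Y (x ⊕ (x ⊕ y))) * φ (x ⊕ y)))
        ≈⟨ ∑-cong (λ x → ∑-cong λ y → *-congʳ (*-congˡ (reflexive (≡.cong (pmf Y) (⊕-cancelˡ x y))))) ⟩
      ∑ (λ x → ∑ (λ y → (pmf X x * pmf Y y) * φ (x ⊕ y)))                  ∎

    ∑-convolution-mass : ∀ (X Y : RandomVariable n) → ∑ (convolution X Y) ≈ 1#
    ∑-convolution-mass X Y = begin
      ∑ (convolution X Y)                        ≈⟨ ∑-swap _ ⟩
      ∑ (λ x → ∑ (λ z → pmf X x * pmf Y (x ⊕ z))) ≈⟨ ∑-cong (λ x → trans (∑-*ˡ _ _) (*-congˡ (∑-⊕ x (pmf Y)))) ⟩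
      ∑ (λ x → pmf X x * ∑ (pmf Y))              ≈⟨ ∑-mass X _ ⟩
      ∑ (pmf Y)                                  ≈⟨ pmf-mass Y ⟩
      1#                                         ∎

    module _ (X : RandomVariable n) where
      private
        p r : G → Carrier
        p = pmf X
        r = convolution X X
        0≤p = nonNeg X
        0≤r = convolution-nonNeg X X

        ∑∑ : (G → G → Carrier) → Carrier
        ∑∑ f = ∑ λ x → ∑ (f x)

        entropy-r : E r ≈ ∑∑ (λ x y → (p x * p y) * - log (r (x ⊕ y)))
        entropy-r = trans (∑-cong λ z → -‿distribʳ-* _ _) (∑-convolution X X λ z → - log (r z))

        entropy-p : E p ≈ ∑∑ (λ x y → (p x * p y) * - log (p x))
        entropy-p = ∑-cong λ x → begin
          h (p x)                                    ≈⟨ -‿distribʳ-* _ _ ⟩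
          p x * - log (p x)
            ≈⟨ *-congʳ (trans (∑-*ˡ _ _) (trans (*-congˡ (pmf-mass X)) (*-identityʳ _))) ⟨
          ∑ (λ y → p x * p y) * - log (p x)          ≈⟨ ∑-*ʳ _ _ ⟨
          ∑ (λ y → (p x * p y) * - log (p x))        ∎

        mass-r : ∑∑ (λ x y → p y * r (x ⊕ y)) ≈ 1#
        mass-r = begin
          ∑∑ (λ x y → p y * r (x ⊕ y))       ≈⟨ ∑-swap _ ⟩
          ∑ (λ y → ∑ (λ x → p y * r (x ⊕ y)))
            ≈⟨ ∑-cong (λ y → trans (∑-*ˡ _ _) (*-congˡ (trans (∑-cong λ x → reflexive (≡.cong r (⊕-comm x y))) (∑-⊕ y r)))) ⟩
          ∑ (λ y → p y * ∑ r)                ≈⟨ ∑-mass X _ ⟩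
          ∑ r                                ≈⟨ ∑-convolution-mass X X ⟩
          1#                                 ∎

        mass-p : ∑∑ (λ x y → p x * p y) ≈ 1#
        mass-p = trans (∑-cong λ x → ∑-*ˡ _ _) (trans (∑-mass X _) (pmf-mass X))

        -- The summand p x p y (t - 1 - log t) with t = r (x + y) / p x.
        defect : G → G → Carrier
        defect x y = ((p x * p y) * - log (r (x ⊕ y)) + p y * r (x ⊕ y)) - ((p x * p y) * - log (p x) + p x * p y)

        ∑∑-+ : ∀ f g → ∑∑ (λ x y → f x y + g x y) ≈ ∑∑ f + ∑∑ g
        ∑∑-+ f g = trans (∑-cong λ x → ∑-+ (f x) (g x)) (∑-+ _ _)

        ∑∑-neg : ∀ f → ∑∑ (λ x y → - f x y) ≈ - ∑∑ f
        ∑∑-neg f = trans (∑-cong λ x → ∑-neg (f x)) (∑-neg _)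

        -- The correction terms `p y * r (x ⊕ y)` and `p x * p y` both sum to one; they make each
        -- summand nonnegative without changing the total.
        ∑-defect : ∑∑ defect ≈ E r - E p
        ∑-defect = begin
          ∑∑ defect
            ≈⟨ trans (∑∑-+ _ _) (+-cong (∑∑-+ _ _) (trans (∑∑-neg _) (-‿cong (∑∑-+ _ _)))) ⟩
          _
            ≈⟨ +-cong (+-cong (sym entropy-r) mass-r) (-‿cong (+-cong (sym entropy-p) mass-p)) ⟩
          (E r + 1#) - (E p + 1#)       ≈⟨ solve 2 (λ a b → (a :+ :1) :- (b :+ :1) := a :- b) refl _ _ ⟩
          E r - E p                     ∎

        p*p≤r : ∀ x y → p x * p y ≤ r (x ⊕ y)
        p*p≤r x y = ≤-respˡ-≈ (*-congˡ (reflexive (≡.cong p (⊕-cancelˡ x y))))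
          (term≤∑ (λ x′ → *-pos (0≤p x′) (0≤p (x′ ⊕ (x ⊕ y)))) x)

        -- log t ≤ 2 (u - 1) + (t / u² - 1) for t = r (x + y) / p x and v = u⁻¹.
        defect-≥ : ∀ {u v} x y → 0# < u → u * v ≈ 1# → 0# < p x → 0# < p y →
                   p y * (r (x ⊕ y) - (p x * (fromℕ 2 * (u - 1#)) + (r (x ⊕ y) * (v * v)))) ≤ defect x y
        defect-≥ {u} {v} x y 0<u uv≈1 0<px 0<py = linear 10 (λ P Q R lP lR lu lt u v i →
              1 ×≤ (P :* Q) :* lt :≤ (P :* Q) :* ((R :* i) :* (v :* v) :- :1)
            ⟹ 2 ×≤ (P :* Q) :* lu :≤ (P :* Q) :* (u :- :1)
            ⟹ 1 ×≤ (P :* Q) :* ((lR :+ (:- lP)) :+ (:- lu :+ :- lu)) :≤ (P :* Q) :* lt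
            ⟹ 1 ×≤ ((P :* Q) :* (R :* i)) :* (v :* v) :≤ (Q :* R) :* (v :* v)
            ⟹ ⊢ 1 ×≤ Q :* (R :- (P :* (con 2 :* (u :- :1)) :+ R :* (v :* v)))
                     :≤ ((P :* Q) :* (:- lR) :+ Q :* R) :- ((P :* Q) :* (:- lP) :+ P :* Q)) refl
            (p x) (p y) R (log (p x)) (log R) (log u) (log t) u v (p x ⁻¹)
            (*-monoˡ 0≤pq (log≤x-1 0<t)) (*-monoˡ 0≤pq (log≤x-1 0<u))
            (≤-reflexive (*-congˡ (sym log-t)))
            (≤-reflexive (*-congʳ (trans (solve 4 (λ P Q R i → (P :* Q) :* (R :* i) :=
                 Q :* (P :* (R :* i))) refl _ _ _ _)
              (*-congˡ (normalise-≈ R 0<px)))))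
          where
          R = r (x ⊕ y)
          0<v : 0# < v
          0<v = pos-resp-≈ (sym (⁻¹-unique 0<u uv≈1)) (⁻¹-pos 0<u)
          0<R : 0# < R
          0<R = <-≤-trans (*-pos-strict 0<px 0<py) (p*p≤r x y)
          0≤pq = *-pos (0≤p x) (0≤p y)
          t = (R * p x ⁻¹) * (v * v)
          0<t : 0# < t
          0<t = *-pos-strict (*-pos-strict 0<R (⁻¹-pos 0<px)) (*-pos-strict 0<v 0<v)
          log-v : log v ≈ - log u
          log-v = trans (log-resp-≈ (⁻¹-unique 0<u uv≈1)) (log-⁻¹ 0<u)
          log-t : log t ≈ (log R + - log (p x)) + (- log u + - log u)
          log-t = trans (log-* (*-pos-strict 0<R (⁻¹-pos 0<px)) (*-pos-strict 0<v 0<v))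
            (+-cong (trans (log-* 0<R (⁻¹-pos 0<px)) (+-congˡ (log-⁻¹ 0<px)))
                    (trans (log-* 0<v 0<v) (+-cong log-v log-v)))

        defect-nonNeg : ∀ x y → 0# ≤ defect x y
        defect-nonNeg x y = by (p x ≤? 0#) (p y ≤? 0#)
          where
          by : Dec (p x ≤ 0#) → Dec (p y ≤ 0#) → 0# ≤ defect x y
          by _          (yes py≤0) = ≤-reflexive (sym (begin
            defect x y
              ≈⟨ solve 5 (λ P Q R lR lP → ((P :* Q) :* lR :+ Q :* R) :- ((P :* Q) :* lP :+ P :* Q) :=
                   Q :* (P :* lR :+ R :- (P :* lP :+ P))) refl _ _ _ _ _ ⟩
            p y * _   ≈⟨ *-congʳ (antisym py≤0 (0≤p y)) ⟩
            0# * _    ≈⟨ zeroˡ _ ⟩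
            0#        ∎))
          by (yes px≤0) (no _)     = ≤-respʳ-≈ (begin
            p y * r (x ⊕ y)
              ≈⟨ solve 2 (λ q k → q :=
                   q :+ con 0 :* k) refl _ (p y * - log (r (x ⊕ y)) - (p y * - log (p x) + p y)) ⟩
            p y * r (x ⊕ y) + 0# * _  ≈⟨ +-congˡ (*-congʳ (antisym px≤0 (0≤p x))) ⟨
            p y * r (x ⊕ y) + p x * (p y * - log (r (x ⊕ y)) - (p y * - log (p x) + p y))
              ≈⟨ solve 5 (λ P Q R lR lP → ((P :* Q) :* lR :+ Q :* R) :- ((P :* Q) :* lP :+ P :* Q) :=
                   Q :* R :+ P :* (Q :* lR :- (Q :* lP :+ Q))) refl _ _ _ _ _ ⟨
            defect x y ∎) (*-pos (0≤p y) (0≤r (x ⊕ y)))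
          -- At `u = v = 1` the lower bound of `defect-≥` is zero.
          by (no 0<px)  (no 0<py)  = ≤-respˡ-≈
            (solve 3 (λ P Q R → Q :* (R :- (P :* (con 2 :* (:1 :- :1)) :+ R :* (:1 :* :1))) :=
                 con 0) refl (p x) (p y) (r (x ⊕ y)))
            (defect-≥ x y 0<1 (*-identityˡ 1#) 0<px 0<py)

        defect-≤ : ∀ x y → defect x y ≤ E r - E p
        defect-≤ x y = ≤-respʳ-≈ ∑-defect (≤-trans (term≤∑ (defect-nonNeg x) y)
          (term≤∑ (λ x → ∑-nonNeg (defect-nonNeg x)) x))

      module _ (σ : Carrier) (0<σ : 0# < σ) (σ-small : fromℕ 5 * σ * (N * N) ≤ 1#)
               (near : E r - E p < (σ * σ) * (σ * σ) * (σ * σ)) where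
        private
          0≤σ = <⇒≤ 0<σ

          α : Carrier
          α = σ * σ

          0≤α : 0# ≤ α
          0≤α = *-pos 0≤σ 0≤σ

          0<α : 0# < α
          0<α = *-pos-strict 0<σ 0<σ

        x₀ : G
        x₀ = proj₁ (maximum p)

        Heavy : G → Set
        Heavy x = α ≤ p x

        private
          M : Carrier
          M = p x₀

          p≤M : ∀ x → p x ≤ M
          p≤M = proj₂ (maximum p)

          0≤M : 0# ≤ M
          0≤M = 0≤p x₀

          M≤1 : M ≤ 1#
          M≤1 = ≤-respʳ-≈ (pmf-mass X) (term≤∑ 0≤p x₀)

          0≤N : 0# ≤ N
          0≤N = ∑-nonNeg λ _ → <⇒≤ 0<1

          1≤NM : 1# ≤ N * M
          1≤NM = ≤-respˡ-≈ (pmf-mass X) (≤-respʳ-≈ (∑-const M) (∑-mono p≤M))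

          0≤NM : 0# ≤ N * M
          0≤NM = *-pos 0≤N 0≤M

          -- As `N M ≥ 1`, the smallness of `σ` against the size of the group becomes smallness
          -- against the maximal mass: `5 σ ≤ 5 σ N² M² ≤ M²`.
          5σ≤M² : fromℕ 5 * σ ≤ M * M
          5σ≤M² = linear 3 (λ σ N M →
                1 ×≤ :1 :* (con 5 :* σ) :≤ (N :* M) :* (con 5 :* σ)
              ⟹ 1 ×≤ (con 5 :* σ :* (N :* M)) :* :1 :≤ (con 5 :* σ :* (N :* M)) :* (N :* M)
              ⟹ 1 ×≤ (M :* M) :* (con 5 :* σ :* (N :* N)) :≤ (M :* M) :* :1
              ⟹ ⊢ 1 ×≤ con 5 :* σ :≤ M :* M) refl σ N M
            (*-monoʳ 0≤5σ 1≤NM) (*-monoˡ (*-pos 0≤5σ 0≤NM) 1≤NM) (*-monoˡ (*-pos 0≤M 0≤M) σ-small)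
            where 0≤5σ = *-pos (fromℕ-nonNeg 5) 0≤σ

          5σ≤1 : fromℕ 5 * σ ≤ 1#
          5σ≤1 = ≤-trans 5σ≤M² (≤-trans (*-monoˡ 0≤M M≤1) (≤-respˡ-≈ (sym (*-identityʳ M)) M≤1))

          α≤σ : α ≤ σ
          α≤σ = linear 1 (λ s → 1 ×≤ s :* (con 5 :* s) :≤ s :* :1 ⟹ 4 ×≤ con 0 :≤ s ⟹ ⊢ 5 ×≤ s :* s :≤ s) refl σ
            (*-monoˡ 0≤σ 5σ≤1) 0≤σ

          x₀-heavy : Heavy x₀
          x₀-heavy = linear 3 (λ a s M →
                    1 ×≤ a :≤ s
                  ⟹ 1 ×≤ con 5 :* s :≤ M :* M
                  ⟹ 1 ×≤ M :* M :≤ M :* :1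
                  ⟹ 4 ×≤ con 0 :≤ s
                  ⟹ ⊢ 1 ×≤ a :≤ M) refl
            α σ M α≤σ 5σ≤M² (*-monoˡ 0≤M M≤1) 0≤σ

          0<M : 0# < M
          0<M = <-≤-trans 0<α x₀-heavy

          -- Suppose not. With `u = 1 - σ`, so that `1 - 2 σ = u² - α`, the bound `defect-≥` makes
          -- the defect at least `p y * (p x * α)`, hence at least `α³` for heavy `x` and `y`. By
          -- `near`, no single defect reaches `α³`.
          r-≥ : ∀ x y → Heavy x → Heavy y → (1# - fromℕ 2 * σ) * p x ≤ r (x ⊕ y)
          r-≥ x y x-heavy y-heavy with total ((1# - fromℕ 2 * σ) * p x) (r (x ⊕ y))
          ... | inj₁ done = done
          ... | inj₂ R≤   = contradiction (≤-trans large (defect-≤ x y)) near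
            where
            u v R : Carrier
            u = 1# - σ
            v = u ⁻¹
            R = r (x ⊕ y)
            0<u : 0# < u
            0<u u≤0 = 0<1 (linear 1 (λ s → 5 ×≤ :1 :- s :≤ con 0 ⟹ 1 ×≤ con 5 :* s :≤ :1 ⟹ ⊢ 4 ×≤ :1 :≤ con 0) refl
              σ u≤0 5σ≤1)
            uv≈1 : u * v ≈ 1#
            uv≈1 = ⁻¹-inverseʳ (>⇒≉ 0<u)
            1≤v : 1# ≤ v
            1≤v = ≤-respˡ-≈ 1⁻¹≈1 (⁻¹-antitone 0<u (linear 1 (λ s → 1 ×≤ con 0 :≤ s ⟹ ⊢ 1 ×≤ :1 :- s :≤ :1) refl σ 0≤σ))
            0≤v²-1 : 0# ≤ v * v - 1#
            0≤v²-1 = linear 1 (λ v → 1 ×≤ :1 :* v :≤ v :* v ⟹ 1 ×≤ :1 :≤ v ⟹ ⊢ 1 ×≤ con 0 :≤ v :* v :- :1) refl v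
              (*-monoʳ (≤-trans (<⇒≤ 0<1) 1≤v) 1≤v) 1≤v
            bracket : p x * α ≤ R - (p x * (fromℕ 2 * (u - 1#)) + R * (v * v))
            bracket = linear 4 (λ P R s v →
                  1 ×≤ R :* (v :* v :- :1) :≤ ((:1 :- con 2 :* s) :* P) :* (v :* v :- :1)
                ⟹ 1 ×≤ con 0 :≤ (P :* (s :* s)) :* (v :* v :- :1)
                ⟹ 1 ×≤ P :* (((:1 :- s) :* v) :* ((:1 :- s) :* v)) :≤ P :* (:1 :* :1)
                ⟹ ⊢ 1 ×≤ P :* (s :* s) :≤ R :- (P :* (con 2 :* ((:1 :- s) :- :1)) :+ R :* (v :* v))) refl
              (p x) R σ v (*-monoʳ 0≤v²-1 R≤) (*-pos (*-pos (0≤p x) 0≤α) 0≤v²-1)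
              (≤-reflexive (*-congˡ (*-cong uv≈1 uv≈1)))
            large : α * α * α ≤ defect x y
            large = ≤-trans (≤-trans (≤-trans
              (≤-reflexive (*-assoc _ _ _))
              (*-monoʳ (*-pos 0≤α 0≤α) y-heavy))
              (*-monoˡ (0≤p y) (≤-trans (*-monoʳ 0≤α x-heavy) bracket)))
              (defect-≥ x y 0<u uv≈1 (<-≤-trans 0<α x-heavy) (<-≤-trans 0<α y-heavy))

          -- In r z = ∑ p w p (w + z) only the summand w = x₀ is not bounded by p w M.
          r-≤ : ∀ z → r z ≤ M + M * (p (x₀ ⊕ z) - M)
          r-≤ z = ≤-respʳ-≈ (trans (∑-+ _ _) (+-cong (∑-mass X M) (∑-δˡ x₀ _)))
            (∑-mono λ w → term w)
            where
            term : ∀ w → p w * p (w ⊕ z) ≤ p w * M + δ x₀ w * (p w * (p (w ⊕ z) - M))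
            term w with x₀ ≟ w
            ... | yes refl = linear 3 (λ M q d →
                      1 ×≤ M :* (q :- M) :≤ d :* (M :* (q :- M))
                    ⟹ ⊢ 1 ×≤ M :* q :≤ M :* M :+ d :* (M :* (q :- M))) refl
              M (p (w ⊕ z)) (δ x₀ w) (≤-reflexive (sym (trans (*-congʳ (δ-yes refl)) (*-identityˡ _))))
            ... | no x₀≢w = ≤-trans (*-monoˡ (0≤p w) (p≤M (w ⊕ z)))
              (≤-reflexive (sym (trans (+-congˡ (trans (*-congʳ (δ-no x₀≢w)) (zeroˡ _))) (+-identityʳ _))))

        -- The bounds `r-≥` and `r-≤` are compared at `x₀ + x`; a mass well below `M` at `x` would
        -- pull `r` too far below `M` there.
        heavy⇒near-maximum : ∀ x → Heavy x → M - fromℕ 2 * σ ≤ p x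
        heavy⇒near-maximum x x-heavy = *-cancel-≤ 0<M (linear 3 (λ M s q →
              1 ×≤ (:1 :- con 2 :* s) :* M :≤ M :+ M :* (q :- M)
            ⟹ ⊢ 1 ×≤ M :* (M :- con 2 :* s) :≤ M :* q) refl M σ (p x)
          (≤-trans (r-≥ x₀ x x₀-heavy x-heavy) (≤-respʳ-≈ (+-congˡ (*-congˡ (+-congʳ (reflexive (≡.cong p (⊕-cancelˡ x₀ x))))))
            (r-≤ (x₀ ⊕ x)))))

        -- Combining `r-≥`, `r-≤` and `heavy⇒near-maximum`, the mass `q` at `x₀ + x + y` satisfies
        -- `M q ≥ M² - 2 σ - 2 σ M`. Of the `5 σ` contained in `M²`, four cover the losses and the
        -- fifth covers `M α ≤ α ≤ σ`. Closure under sums with `x₀` is what makes the heavy points a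
        -- coset.
        heavy-closed : ∀ x y → Heavy x → Heavy y → Heavy (x₀ ⊕ (x ⊕ y))
        heavy-closed x y x-heavy y-heavy = *-cancel-≤ 0<M (linear 5 (λ M s a q P →
              1 ×≤ (:1 :- con 2 :* s) :* P :≤ M :+ M :* (q :- M)
            ⟹ 1 ×≤ (:1 :- con 2 :* s) :* (M :- con 2 :* s) :≤ (:1 :- con 2 :* s) :* P
            ⟹ 1 ×≤ con 5 :* s :≤ M :* M
            ⟹ 1 ×≤ M :* a :≤ :1 :* a
            ⟹ 1 ×≤ a :≤ s
            ⟹ 4 ×≤ con 0 :≤ s :* s
            ⟹ 2 ×≤ M :* s :≤ :1 :* s
            ⟹ ⊢ 1 ×≤ M :* a :≤ M :* q) refl M σ α (p (x₀ ⊕ (x ⊕ y))) (p x)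
          (≤-trans (r-≥ x y x-heavy y-heavy) (r-≤ (x ⊕ y)))
          (*-monoˡ 0≤1-2σ (heavy⇒near-maximum x x-heavy))
          5σ≤M² (*-monoʳ 0≤α M≤1) α≤σ 0≤α (*-monoʳ 0≤σ M≤1))
          where
          0≤1-2σ : 0# ≤ 1# - fromℕ 2 * σ
          0≤1-2σ = linear 1 (λ s →
                    1 ×≤ con 5 :* s :≤ :1
                  ⟹ 3 ×≤ con 0 :≤ s
                  ⟹ ⊢ 1 ×≤ con 0 :≤ :1 :- con 2 :* s) refl
                σ 5σ≤1 0≤σ

        module _ (f : G → Bool) (f⇒heavy : ∀ x → f x ≡ true → Heavy (x₀ ⊕ x)) (heavy⇒f : ∀ x → Heavy (x₀ ⊕ x) → f x ≡ true) where

          heavy-subgroup : Closed f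
          heavy-subgroup = closed (heavy⇒f 𝟎 (≡.subst Heavy (≡.sym (⊕-identityʳ x₀)) x₀-heavy))
            λ x y fx fy → heavy⇒f (x ⊕ y) (≡.subst (λ z → Heavy (x₀ ⊕ z)) (cancel x y)
              (heavy-closed (x₀ ⊕ x) (x₀ ⊕ y) (f⇒heavy x fx) (f⇒heavy y fy)))
            where
            cancel : ∀ x y → (x₀ ⊕ x) ⊕ (x₀ ⊕ y) ≡ x ⊕ y
            cancel x y = ≡.trans (≡.cong (_⊕ (x₀ ⊕ y)) (⊕-comm x₀ x)) (≡.trans (⊕-assoc x x₀ _) (≡.cong (x ⊕_) (⊕-cancelˡ x₀ y)))

          -- `U` is built from a proof of closedness, and the gap hypothesis supplies one of its
          -- own, so the bound is proved for an arbitrary such proof.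
          module _ (f-closed : Closed f) where
            private
              K = subgroup f f-closed

              Y : RandomVariable n
              Y = U K

              u : G → Carrier
              u = pmf Y

              k : Carrier
              k = fromℕ (order K)

              1≤k : 1# ≤ k
              1≤k = ∈⇒1≤length (∈-filter⁺ (Subgroup.member? K) (∈-elements 𝟎) (Closed.contains-𝟎 f-closed))

              0<k : 0# < k
              0<k = <-≤-trans 0<1 1≤k

              u-in : ∀ {y} → f y ≡ true → u y ≈ k ⁻¹
              u-in {y} fy with f y Bool.≟ true
              ... | yes _ = ≈-refl
              ... | no ¬fy = contradiction fy ¬fy

              u-out : ∀ {y} → ¬ (f y ≡ true) → u y ≈ 0#
              u-out {y} ¬fy with f y Bool.≟ true
              ... | yes fy = contradiction fy ¬fy
              ... | no _   = ≈-refl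

              by-membership : ∀ {P : Set} y → (f y ≡ true → P) → (¬ (f y ≡ true) → P) → P
              by-membership y yes-case no-case with f y Bool.≟ true
              ... | yes fy = yes-case fy
              ... | no ¬fy = no-case ¬fy

              ku≈1 : ∀ {y} → f y ≡ true → k * u y ≈ 1#
              ku≈1 fy = trans (*-congˡ (u-in fy)) (⁻¹-inverseʳ (>⇒≉ 0<k))

              ku≈0 : ∀ {y} → ¬ (f y ≡ true) → k * u y ≈ 0#
              ku≈0 ¬fy = trans (*-congˡ (u-out ¬fy)) (zeroʳ k)

              ∑-ku : ∀ c → ∑ (λ y → (k * u y) * c) ≈ k * c
              ∑-ku c = trans (∑-*ʳ c _) (*-congʳ (trans (∑-*ˡ k u) (trans (*-congˡ (pmf-mass Y)) (*-identityʳ k))))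

              0≤log-k : 0# ≤ log k
              0≤log-k = ≤-respˡ-≈ log-1 (log-mono 0<1 1≤k)

              k≤N : k ≤ N
              k≤N = ≤-respˡ-≈ (trans (∑-ku 1#) (*-identityʳ k)) (∑-mono λ y → ≤-respˡ-≈ (sym (*-identityʳ _))
                (by-membership y (λ fy → ≤-reflexive (ku≈1 fy)) (λ ¬fy → ≤-respˡ-≈ (sym (ku≈0 ¬fy)) (<⇒≤ 0<1))))

              kM≤ : k * (M - fromℕ 2 * σ) ≤ 1#
              kM≤ = ≤-respˡ-≈ (∑-ku _) (≤-respʳ-≈ (trans (∑-⊕ x₀ p) (pmf-mass X)) (∑-mono λ y → by-membership y
                (λ fy → ≤-respˡ-≈ (sym (trans (*-congʳ (ku≈1 fy)) (*-identityˡ _))) (heavy⇒near-maximum _ (f⇒heavy y fy)))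
                (λ ¬fy → ≤-respˡ-≈ (sym (trans (*-congʳ (ku≈0 ¬fy)) (zeroˡ _))) (0≤p _))))

              -- This is `log (k M) ≤ k M - 1` together with `kM≤`. With `entropy-p-≥` it places
              -- `E p` at most a small error below `log k`.
              log-k+log-M : log k + log M ≤ fromℕ 2 * σ * N
              log-k+log-M = linear 6 (λ lk lM k M s N →
                    1 ×≤ lk :+ lM :≤ k :* M :- :1
                  ⟹ 1 ×≤ k :* (M :- con 2 :* s) :≤ :1
                  ⟹ 2 ×≤ s :* k :≤ s :* N
                  ⟹ ⊢ 1 ×≤ lk :+ lM :≤ con 2 :* s :* N) refl (log k) (log M) k M σ N
                (≤-respˡ-≈ (log-* 0<k 0<M) (log≤x-1 (*-pos-strict 0<k 0<M))) kM≤ (*-monoˡ 0≤σ k≤N)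

              entropy-u : E u ≈ log k
              entropy-u = trans (∑-cong term) (∑-mass Y (log k))
                where
                term : ∀ y → h (u y) ≈ u y * log k
                term y = by-membership y
                  (λ fy → trans (h-cong (u-in fy)) (trans (-‿cong (*-congˡ (log-⁻¹ 0<k)))
                    (trans (solve 2 (λ i l → :- (i :* (:- l)) := i :* l) refl _ _) (*-congʳ (sym (u-in fy))))))
                  (λ ¬fy → trans (h-≈0 (u-out ¬fy)) (sym (trans (*-congʳ (u-out ¬fy)) (zeroˡ _))))

              entropy-p-≥ : - log M ≤ E p
              entropy-p-≥ = ≤-respˡ-≈ (∑-mass X (- log M)) (∑-mono λ x → term x (p x ≤? 0#))
                where
                term : ∀ x → Dec (p x ≤ 0#) → p x * - log M ≤ h (p x)
                term x (yes px≤0) = ≤-reflexive (trans (*-congʳ px≈0) (trans (zeroˡ _) (sym (h-≈0 px≈0))))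
                  where
                  px≈0 : p x ≈ 0#
                  px≈0 = antisym px≤0 (0≤p x)
                term x (no 0<px) = linear 3 (λ P a b → 1 ×≤ P :* a :≤ P :* b ⟹ ⊢ 1 ×≤ P :* (:- b) :≤ :- (P :* a)) refl
                  (p x) (log (p x)) (log M) (*-monoˡ (0≤p x) (log-mono 0<px (p≤M x)))

              -- A positive function close to the distribution of x₀ + Y, which is
              -- concentrated where that of X + Y is.
              s : G → Carrier
              s g = u (x₀ ⊕ g) + σ

              σ≤s : ∀ g → σ ≤ s g
              σ≤s g = ≤-respˡ-≈ (+-identityˡ σ) (+-mono (nonNeg Y (x₀ ⊕ g)) ≤-refl)

              -- A heavy `x` plus an element `y` of the subgroup is heavy again, and there
              -- `s ≥ 1 / k`. A light `x` has `p x ≤ σ²`, while `- log s ≤ 1 / σ - 1`, so it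
              -- contributes at most `σ`: hence the square in the threshold `α`.
              cross-term : ∀ x y → (p x * u y) * - log (s (x ⊕ y)) ≤ u y * (p x * log k + σ)
              cross-term x y = by-membership y
                (λ fy → ≤-respˡ-≈ (solve 3 (λ a b c → b :* (a :* c) := (a :* b) :* c) refl _ _ _)
                  (*-monoˡ (nonNeg Y y) (inside fy (total α (p x)))))
                (λ ¬fy → ≤-reflexive (trans (*-congʳ (trans (*-congˡ (u-out ¬fy)) (zeroʳ _)))
                  (trans (zeroˡ _) (sym (trans (*-congʳ (u-out ¬fy)) (zeroˡ _))))))
                where
                inside : f y ≡ true → Heavy x ⊎ p x ≤ α → p x * - log (s (x ⊕ y)) ≤ p x * log k + σ
                inside fy (inj₁ x-heavy) = linear 5 (λ P l lk s li →
                          1 ×≤ P :* li :≤ P :* l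
                        ⟹ 1 ×≤ P :* (:- lk) :≤ P :* li
                        ⟹ 1 ×≤ con 0 :≤ s
                        ⟹ ⊢ 1 ×≤ P :* (:- l) :≤ P :* lk :+ s) refl
                  (p x) (log (s (x ⊕ y))) (log k) σ (log (k ⁻¹))
                  (*-monoˡ (0≤p x) (log-mono (⁻¹-pos 0<k) k⁻¹≤s)) (≤-reflexive (*-congˡ (sym (log-⁻¹ 0<k)))) 0≤σ
                  where
                  heavy-sum : Heavy (x ⊕ y)
                  heavy-sum = ≡.subst Heavy
                    (≡.trans (≡.cong (x₀ ⊕_) (≡.trans (≡.sym (⊕-assoc x x₀ y))
                      (≡.trans (≡.cong (_⊕ y) (⊕-comm x x₀)) (⊕-assoc x₀ x y)))) (⊕-cancelˡ x₀ (x ⊕ y)))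
                    (heavy-closed x (x₀ ⊕ y) x-heavy (f⇒heavy y fy))
                  k⁻¹≤s : k ⁻¹ ≤ s (x ⊕ y)
                  k⁻¹≤s = ≤-respˡ-≈ (trans (+-identityʳ _) (u-in (heavy⇒f _ (≡.subst Heavy (≡.sym (⊕-cancelˡ x₀ (x ⊕ y))) heavy-sum))))
                    (+-monoʳ _ 0≤σ)
                inside fy (inj₂ px≤α) = linear 6 (λ P l lk s i ls →
                      1 ×≤ P :* ls :≤ P :* l
                    ⟹ 1 ×≤ P :* (:- ls) :≤ P :* (i :- :1)
                    ⟹ 1 ×≤ con 0 :≤ P
                    ⟹ 1 ×≤ P :* i :≤ (s :* s) :* i
                    ⟹ 1 ×≤ s :* (s :* i) :≤ s :* :1
                    ⟹ 1 ×≤ con 0 :≤ P :* lk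
                    ⟹ ⊢ 1 ×≤ P :* (:- l) :≤ P :* lk :+ s) refl
                  (p x) (log (s (x ⊕ y))) (log k) σ (σ ⁻¹) (log σ)
                  (*-monoˡ (0≤p x) (log-mono 0<σ (σ≤s _)))
                  (*-monoˡ (0≤p x) (≤-respˡ-≈ (log-⁻¹ 0<σ) (log≤x-1 (⁻¹-pos 0<σ))))
                  (0≤p x) (*-monoʳ (⁻¹-nonNeg 0<σ) px≤α) (≤-reflexive (*-congˡ (⁻¹-inverseʳ (>⇒≉ 0<σ)))) (*-pos (0≤p x) 0≤log-k)

              cross-entropy : ∑ (λ g → convolution X Y g * - log (s g)) ≤ log k + N * σ
              cross-entropy = ≤-respˡ-≈ (sym (∑-convolution X Y _)) (≤-respʳ-≈ (begin
                ∑ (λ x → ∑ (λ y → u y * (p x * log k + σ)))  ≈⟨ ∑-cong (λ x → ∑-mass Y _) ⟩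
                ∑ (λ x → p x * log k + σ)
                  ≈⟨ trans (∑-+ _ _) (+-cong (∑-mass X _) (∑-const σ)) ⟩
                log k + N * σ                                ∎) (∑-mono λ x → ∑-mono λ y → cross-term x y))

              -- One error `σ N` comes from `cross-entropy`, the other from the mass `1 + σ N` of
              -- `s`.
              entropy-convolution : E (convolution X Y) ≤ log k + fromℕ 2 * σ * N
              entropy-convolution = linear 7 (λ e c ∑s ∑q lk N s →
                    1 ×≤ e :≤ c :+ (∑s :- ∑q)
                  ⟹ 1 ×≤ c :≤ lk :+ N :* s
                  ⟹ 1 ×≤ ∑s :≤ :1 :+ N :* s
                  ⟹ 1 ×≤ :1 :≤ ∑q
                  ⟹ ⊢ 1 ×≤ e :≤ lk :+ con 2 :* s :* N) refl
                _ _ (∑ s) (∑ (convolution X Y)) (log k) N σ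
                (≤-respʳ-≈ (trans (∑-+ _ _) (+-congˡ (trans (∑-+ _ _) (+-congˡ (∑-neg _)))))
                  (∑-mono λ g → h≤cross-entropy (convolution-nonNeg X Y g) (<-≤-trans 0<σ (σ≤s g))))
                cross-entropy
                (≤-reflexive (trans (∑-+ _ _) (+-cong (trans (∑-⊕ x₀ u) (pmf-mass Y)) (∑-const σ))))
                (≤-reflexive (sym (∑-convolution-mass X Y)))

            -- The factor 6 is twice the 2 of `entropy-convolution` plus the 2 of `log-k+log-M`.
            dist-uniform : dist X (U K) ≤ fromℕ 6 * σ * N
            dist-uniform = linear 7 (λ e p u lk lM s N →
                  2 ×≤ e :≤ lk :+ con 2 :* s :* N
                ⟹ 1 ×≤ :- lM :≤ p
                ⟹ 1 ×≤ lk :≤ u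
                ⟹ 1 ×≤ lk :+ lM :≤ con 2 :* s :* N
                ⟹ ⊢ 1 ×≤ con 2 :* e :- p :- u :≤ con 6 :* s :* N) refl
              (E (convolution X Y)) (E p) (E u) (log k) (log M) σ N
              entropy-convolution entropy-p-≥ (≤-reflexive (sym entropy-u)) log-k+log-M

  -- Search among finitely many subgroups

  module _ {n : ℕ} (score : (f : Vec Bool n → Bool) → Closed f → Carrier) (B : Carrier) where
    open List using ([]; _∷_)

    -- Finitely many failures have a least excess, so if no candidate meets the bound `B`, all miss
    -- it by a common positive `γ`. The cap `γ ≤ 1` later keeps `σ` small.
    search : ∀ fs → (∃ λ f → ∃ λ c → score f c ≤ B) ⊎
                    (∃ λ γ → 0# < γ × γ ≤ 1# × (∀ f → f ∈ fs → ¬ Closed f ⊎ (∃ λ c → B + γ ≤ score f c)))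
    search []       = inj₂ (1# , 0<1 , ≤-refl , λ _ ())
    search (f ∷ fs) with search fs
    ... | inj₁ found = inj₁ found
    ... | inj₂ (γ , 0<γ , γ≤1 , gap) with closed? f
    ...   | no ¬c = inj₂ (γ , 0<γ , γ≤1 , λ { g (here refl) → inj₁ ¬c ; g (there g∈) → gap g g∈ })
    ...   | yes c with score f c ≤? B
    ...     | yes s≤B = inj₁ (f , c , s≤B)
    ...     | no B<s with total γ (score f c - B)
    ...       | inj₁ γ≤ = inj₂ (γ , 0<γ , γ≤1 ,
      λ { g (here refl) → inj₂ (c , linear 3 (λ b γ s →
                1 ×≤ γ :≤ s :- b
              ⟹ ⊢ 1 ×≤ b :+ γ :≤ s) refl
            _ _ _ γ≤) ; g (there g∈) → gap g g∈ })
    ...       | inj₂ ≤γ = inj₂ (score f c - B ,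
      (λ s-B≤0 → B<s (linear 2 (λ b s → 1 ×≤ s :- b :≤ con 0 ⟹ ⊢ 1 ×≤ s :≤ b) refl _ _ s-B≤0)) , ≤-trans ≤γ γ≤1 ,
      λ { g (here refl) → inj₂ (c , linear 2 (λ b s → ⊢ 1 ×≤ b :+ (s :- b) :≤ s) refl _ _)
        ; g (there g∈)  → [ inj₁ , (λ (c′ , le) → inj₂ (c′ , ≤-trans (+-monoʳ B ≤γ) le)) ]′ (gap g g∈) })

  -- The infimum of τ and the final bounds

  module _ {n : ℕ} (Q₁ Q₂ : RandomVariable n) where

    private
      τ′ : RandomVariable n → RandomVariable n → Carrier
      τ′ = τ Q₁ Q₂

      Attained : Carrier → Set
      Attained t = ∃ λ X → ∃ λ Y → t ≈ - τ′ X Y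

      τ-nonNeg : ∀ X Y → 0# ≤ τ′ X Y
      τ-nonNeg X Y = linear 3 (λ a b c →
                9 ×≤ con 0 :≤ a
              ⟹ 1 ×≤ con 0 :≤ b
              ⟹ 1 ×≤ con 0 :≤ c
              ⟹ ⊢ 1 ×≤ con 0 :≤ con 9 :* a :+ (b :+ c)) refl
            _ _ _
        (dist-nonNeg X Y) (dist-nonNeg Q₁ X) (dist-nonNeg Q₂ Y)

      supremum : ∃ (LeastUpperBound Attained)
      supremum = complete Attained (_ , Q₁ , Q₂ , ≈-refl)
        (0# , λ { t (X , Y , t≈) → linear 2 (λ t s →
                  1 ×≤ t :≤ :- s
                ⟹ 1 ×≤ con 0 :≤ s
                ⟹ ⊢ 1 ×≤ t :≤ con 0) refl
              t _ (≤-reflexive t≈) (τ-nonNeg X Y) })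

    infimum : Carrier
    infimum = - proj₁ supremum

    infimum-≤ : ∀ X Y → infimum ≤ τ′ X Y
    infimum-≤ X Y = linear 2 (λ s t → 1 ×≤ :- t :≤ s ⟹ ⊢ 1 ×≤ :- s :≤ t) refl _ _
      (proj₁ (proj₂ supremum) _ (X , Y , ≈-refl))

    -- Completeness yields minimising pairs only up to double negation, which suffices
    -- for the contradiction no-gap.
    infimum-approached : ∀ {ε} → 0# < ε → ¬ (∀ X Y → ¬ (τ′ X Y ≤ infimum + ε))
    infimum-approached {ε} 0<ε none = 0<ε (linear 2 (λ s e →
              1 ×≤ s :≤ s :- e
            ⟹ ⊢ 1 ×≤ e :≤ con 0) refl
          (proj₁ supremum) ε
      (proj₂ (proj₂ supremum) _ λ { t (X , Y , t≈) →
        linear 4 (λ t τ s e →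
                  1 ×≤ t :≤ :- τ
                ⟹ 1 ×≤ :- s :+ e :≤ τ
                ⟹ ⊢ 1 ×≤ t :≤ s :- e) refl
              t _ _ ε (≤-reflexive t≈) (<⇒≤ (none X Y)) }))

    private
      score : (f : Vec Bool n → Bool) → Closed f → Carrier
      score f c = dist Q₁ (U (subgroup f c)) + dist Q₂ (U (subgroup f c))

      d₀ : Carrier
      d₀ = dist Q₁ Q₂

    module _ {γ : Carrier} (0<γ : 0# < γ) (γ≤1 : γ ≤ 1#)
             (gap : ∀ f → f ∈ functions n → ¬ Closed f ⊎ (∃ λ c → fromℕ 11 * d₀ + γ ≤ score f c)) where
      private
        K : Carrier
        K = N {n}

        1≤K : 1# ≤ K
        1≤K = term≤∑ (λ _ → <⇒≤ 0<1) 𝟎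

        0≤K : 0# ≤ K
        0≤K = ≤-trans (<⇒≤ 0<1) 1≤K

        -- With D σ = γ the errors below add up to at most 13 σ K² = γ / 2.
        D : Carrier
        D = fromℕ 26 * (K * K)

        0<D : 0# < D
        0<D = *-pos-strict (fromℕ-suc-pos 25) (*-pos-strict 0<K 0<K)
          where 0<K = <-≤-trans 0<1 1≤K

        σ : Carrier
        σ = γ * D ⁻¹

        0<σ : 0# < σ
        0<σ = *-pos-strict 0<γ (⁻¹-pos 0<D)

        0≤σ : 0# ≤ σ
        0≤σ = <⇒≤ 0<σ

        Dσ≈γ : D * σ ≈ γ
        Dσ≈γ = normalise-≈ γ 0<D

        σ≤σK : σ ≤ σ * K
        σ≤σK = ≤-respˡ-≈ (*-identityʳ σ) (*-monoˡ 0≤σ 1≤K)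

        σK≤σKK : σ * K ≤ σ * K * K
        σK≤σKK = ≤-respˡ-≈ (*-identityʳ _) (*-monoˡ (*-pos 0≤σ 0≤K) 1≤K)

        σ-small : fromℕ 5 * σ * (K * K) ≤ 1#
        σ-small = linear 3 (λ s K g →
                  1 ×≤ con 26 :* (K :* K) :* s :≤ g
                ⟹ 1 ×≤ g :≤ :1
                ⟹ 21 ×≤ con 0 :≤ s :* K :* K
                ⟹ ⊢ 1 ×≤ con 5 :* s :* (K :* K) :≤ :1) refl
          σ K γ (≤-reflexive Dσ≈γ) γ≤1 (*-pos (*-pos 0≤σ 0≤K) 0≤K)

        α³ ε : Carrier
        α³ = (σ * σ) * (σ * σ) * (σ * σ)
        -- A pair within `ε` of the infimum has `dist X Y ≤ 8 ε`, hence `dist X X ≤ 16 ε = α³`. As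
        -- this is twice the difference of entropies in `near`, there is a factor of two to spare.
        ε  = α³ * fromℕ 16 ⁻¹

        0<ε : 0# < ε
        0<ε = *-pos-strict (*-pos-strict (*-pos-strict 0<α 0<α) 0<α) (⁻¹-pos (fromℕ-suc-pos 15))
          where 0<α = *-pos-strict 0<σ 0<σ

        16ε≈α³ : fromℕ 16 * ε ≈ α³
        16ε≈α³ = normalise-≈ α³ (fromℕ-suc-pos 15)

        ε≤σ : ε ≤ σ
        ε≤σ = linear 3 (λ e a s → 1 ×≤ con 16 :* e :≤ a ⟹ 1 ×≤ a :≤ s ⟹ 15 ×≤ con 0 :≤ s ⟹ ⊢ 16 ×≤ e :≤ s) refl ε α³ σ
          (≤-reflexive 16ε≈α³) α³≤σ 0≤σ
          where
          σ≤1 : σ ≤ 1#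
          σ≤1 = linear 2 (λ s K →
                    1 ×≤ con 5 :* s :* (K :* K) :≤ :1
                  ⟹ 1 ×≤ s :≤ s :* K
                  ⟹ 1 ×≤ s :* K :≤ s :* K :* K
                  ⟹ 4 ×≤ con 0 :≤ s :* K :* K
                  ⟹ ⊢ 1 ×≤ s :≤ :1) refl
                σ K
            σ-small σ≤σK σK≤σKK (*-pos (*-pos 0≤σ 0≤K) 0≤K)
          0≤α = *-pos 0≤σ 0≤σ
          α≤1 : σ * σ ≤ 1#
          α≤1 = ≤-trans (*-monoˡ 0≤σ σ≤1) (≤-respˡ-≈ (sym (*-identityʳ σ)) σ≤1)
          α³≤σ : α³ ≤ σ
          α³≤σ = linear 2 (λ a s →
                    1 ×≤ (a :* a) :* a :≤ (a :* a) :* :1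
                  ⟹ 1 ×≤ a :* a :≤ a :* :1
                  ⟹ 1 ×≤ a :≤ s :* :1
                  ⟹ ⊢ 1 ×≤ (a :* a) :* a :≤ s) refl
                (σ * σ) σ
            (*-monoˡ (*-pos 0≤α 0≤α) α≤1) (*-monoˡ 0≤α α≤1) (*-monoˡ 0≤σ σ≤1)

      no-gap : ⊥
      no-gap = infimum-approached 0<ε λ X Y τ≤ → near-minimiser X Y τ≤ (minimiser-dist {Q₁ = Q₁} {Q₂ = Q₂} infimum-≤ X Y τ≤)
        where
        near-minimiser : ∀ X Y → τ′ X Y ≤ infimum + ε → dist X Y ≤ fromℕ 8 * ε → ⊥
        near-minimiser X Y τ≤ XY≤ = [ (λ ¬c → ¬c f-closed) , far ]′ (gap f f∈)
          where
          near : E (convolution X X) - E (pmf X) < α³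
          near α³≤ = 0<ε (linear 6 (λ e a r p XY YX →
                2 ×≤ con 16 :* e :≤ a
              ⟹ 2 ×≤ a :≤ r :- p
              ⟹ 1 ×≤ con 2 :* r :- p :- p :≤ XY :+ YX
              ⟹ 1 ×≤ YX :≤ XY
              ⟹ 2 ×≤ XY :≤ con 8 :* e
              ⟹ ⊢ 16 ×≤ e :≤ con 0) refl ε α³ _ _ (dist X Y) (dist Y X)
            (≤-reflexive 16ε≈α³) α³≤ (triangle X Y X) (≤-reflexive (dist-comm Y X)) XY≤)

          heavy? : Vec Bool n → Bool
          heavy? x = does ((σ * σ) ≤? pmf X (x₀ X σ 0<σ σ-small near ⊕ x))

          listed = functions-complete heavy?
          f = proj₁ listed
          f∈ = proj₁ (proj₂ listed)
          f≡ = proj₂ (proj₂ listed)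

          f⇒heavy : ∀ x → f x ≡ true → (σ * σ) ≤ pmf X (x₀ X σ 0<σ σ-small near ⊕ x)
          f⇒heavy x fx = via (≡.trans (≡.sym (f≡ x)) fx)
            where
            via : heavy? x ≡ true → (σ * σ) ≤ pmf X (x₀ X σ 0<σ σ-small near ⊕ x)
            via eq with (σ * σ) ≤? pmf X (x₀ X σ 0<σ σ-small near ⊕ x) | eq
            ... | yes h | _ = h
            ... | no _  | ()
          heavy⇒f : ∀ x → (σ * σ) ≤ pmf X (x₀ X σ 0<σ σ-small near ⊕ x) → f x ≡ true
          heavy⇒f x h = ≡.trans (f≡ x) (dec-true ((σ * σ) ≤? pmf X (x₀ X σ 0<σ σ-small near ⊕ x)) h)

          f-closed : Closed f
          f-closed = heavy-subgroup X σ 0<σ σ-small near f f⇒heavy heavy⇒f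

          far : (∃ λ c → fromℕ 11 * d₀ + γ ≤ score f c) → ⊥
          -- The distances to `V` are routed through `X` and `Y`, and that of `Y` to `V` again
          -- through `X`. This last detour costs one `dist X Y`, paid from the nine in `τ`; the
          -- remaining eight are dropped. The infimum is at most `τ` at `(Q₂ , Q₁)`, which is
          -- `11 d₀`.
          far (c , B+γ≤) = 0<γ (linear 15 (λ d g QX QY XH YH Q₁X Q₂Y XY YX e s K d′ τ →
                2 ×≤ con 11 :* d :+ g :≤ QX :+ QY
              ⟹ 2 ×≤ QX :≤ Q₁X :+ XH
              ⟹ 2 ×≤ QY :≤ Q₂Y :+ YH
              ⟹ 2 ×≤ YH :≤ YX :+ XH
              ⟹ 2 ×≤ YX :≤ XY
              ⟹ 2 ×≤ con 9 :* XY :+ (Q₁X :+ Q₂Y) :≤ τ :+ e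
              ⟹ 2 ×≤ τ :≤ con 9 :* d′ :+ (d :+ d′)
              ⟹ 20 ×≤ d′ :≤ d
              ⟹ 16 ×≤ con 0 :≤ XY
              ⟹ 4 ×≤ XH :≤ con 6 :* s :* K
              ⟹ 2 ×≤ e :≤ s
              ⟹ 2 ×≤ s :≤ s :* K
              ⟹ 26 ×≤ s :* K :≤ s :* K :* K
              ⟹ 1 ×≤ con 26 :* (K :* K) :* s :≤ g
              ⟹ ⊢ 1 ×≤ g :≤ con 0) refl
            d₀ γ (dist Q₁ V) (dist Q₂ V) (dist X V) (dist Y V) (dist Q₁ X) (dist Q₂ Y) (dist X Y) (dist Y X) ε σ K (dist Q₂ Q₁) infimum
            B+γ≤ (triangle Q₁ X V) (triangle Q₂ Y V) (triangle Y X V) (≤-reflexive (dist-comm Y X)) τ≤ (infimum-≤ Q₂ Q₁)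
            (≤-reflexive (dist-comm Q₂ Q₁)) (dist-nonNeg X Y)
            (dist-uniform X σ 0<σ σ-small near f f⇒heavy heavy⇒f c) ε≤σ σ≤σK σK≤σKK (≤-reflexive Dσ≈γ))
            where
            V : RandomVariable n
            V = U (subgroup f c)

    close-subgroup : ∃ λ (H : Subgroup (F₂^ n)) → dist Q₁ (U H) + dist Q₂ (U H) ≤ fromℕ 11 * d₀
    close-subgroup with search score (fromℕ 11 * d₀) (functions n)
    ... | inj₁ (f , c , le)          = subgroup f c , le
    ... | inj₂ (γ , 0<γ , γ≤1 , gap) = ⊥-elim (no-gap 0<γ γ≤1 gap)

    -- By the triangle inequality the two distances to `U H` differ by at most `d₀`, so twice either
    -- of them is at most (11 + 1) `d₀`.
    distance-bounds : ∀ {H : Subgroup (F₂^ n)} → dist Q₁ (U H) + dist Q₂ (U H) ≤ fromℕ 11 * d₀ →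
      (d[ Q₁ ⨾ U H ] + d[ Q₂ ⨾ U H ] ≤ fromℕ 11 * d[ Q₁ ⨾ Q₂ ]) ×
      (d[ Q₁ ⨾ U H ] ≤ fromℕ 6 * d[ Q₁ ⨾ Q₂ ]) ×
      (d[ Q₂ ⨾ U H ] ≤ fromℕ 6 * d[ Q₁ ⨾ Q₂ ])
    distance-bounds {H} le =
      halve₂ le ,
      halve Q₁ (U H) Q₁ Q₂ 6 (linear 3 (λ a b d →
                1 ×≤ a :+ b :≤ con 11 :* d
              ⟹ 1 ×≤ a :≤ d :+ b
              ⟹ ⊢ 2 ×≤ a :≤ con 6 :* d) refl
            _ _ _ le (triangle Q₁ Q₂ (U H))) ,
      halve Q₂ (U H) Q₁ Q₂ 6 (linear 4 (λ a b d d′ →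
                1 ×≤ a :+ b :≤ con 11 :* d
              ⟹ 1 ×≤ b :≤ d′ :+ a
              ⟹ 1 ×≤ d′ :≤ d
              ⟹ ⊢ 2 ×≤ b :≤ con 6 :* d) refl
            _ _ _ _ le (triangle Q₂ Q₁ (U H)) (≤-reflexive (dist-comm Q₂ Q₁)))
      where
      halve : ∀ (X Y Z W : RandomVariable n) k → dist X Y ≤ fromℕ k * dist Z W → d[ X ⨾ Y ] ≤ fromℕ k * d[ Z ⨾ W ]
      halve X Y Z W k h = linear 3 (λ x z k →
                1 ×≤ con 2 :* x :≤ k :* (con 2 :* z)
              ⟹ ⊢ 2 ×≤ x :≤ k :* z) refl
            _ _ (fromℕ k)
        (≤-respˡ-≈ (sym (2d≈dist X Y)) (≤-respʳ-≈ (*-congˡ (sym (2d≈dist Z W))) h))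
      halve₂ : dist Q₁ (U H) + dist Q₂ (U H) ≤ fromℕ 11 * d₀ → d[ Q₁ ⨾ U H ] + d[ Q₂ ⨾ U H ] ≤ fromℕ 11 * d[ Q₁ ⨾ Q₂ ]
      halve₂ h = linear 3 (λ x y z →
                1 ×≤ con 2 :* x :+ con 2 :* y :≤ con 11 :* (con 2 :* z)
              ⟹ ⊢ 2 ×≤ x :+ y :≤ con 11 :* z) refl
            _ _ _
        (≤-respˡ-≈ (sym (+-cong (2d≈dist Q₁ (U H)) (2d≈dist Q₂ (U H)))) (≤-respʳ-≈ (*-congˡ (sym (2d≈dist Q₁ Q₂))) h))

theorem1p8 : (ℝ : CompleteOrderedField) →
    let open CompleteOrderedField ℝ
        open OverReals ℝ
    in
    (n : ℕ) → .{{_ : NonZero n}} →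
    (X₁ X₂ : RandomVariable n) →
    ∃ λ (H : Subgroup (F₂^ n)) →
      (d[ X₁ ⨾ U H ] + d[ X₂ ⨾ U H ] ≤ fromℕ 11 * d[ X₁ ⨾ X₂ ])
      × (d[ X₁ ⨾ U H ] ≤ fromℕ 6 * d[ X₁ ⨾ X₂ ])
      × (d[ X₂ ⨾ U H ] ≤ fromℕ 6 * d[ X₁ ⨾ X₂ ])
theorem1p8 ℝ n X₁ X₂ = let (H , le) = close-subgroup X₁ X₂ in H , distance-bounds X₁ X₂ {H} le
  where open PFR ℝ
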